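{- For every nonnegative integer $n$ and every integer $k\geq 2$, \begin{align*} 4\overline{b}_5\left(5^{k}(n+3)-3\right) &\equiv 5\overline{b}_5(n) - \overline{b}_5(5n+12) \pmod{5^k},\\ \overline{b}_5\left(5^k(20n+18)-3\right) &\equiv 0 \pmod{\tfrac{5^{k}-1}{4}},\\ \overline{b}_5\left(5^k(20n+22)-3\right) &\equiv 0 \pmod{\tfrac{5^{k}-1}{4}}. \end{align*}
   Context: For $j\ge1$ let $f_j:=\prod_{k\ge 1}(1-q^{jk})$ (for $|q|<1$, or as a formal power series). Let $\psi(-q):=\sum_{n=0}^{\infty}(-q)^{n(n+1)/2}=f_1f_4/f_2$, so that $\psi(-q^5)=f_5f_{20}/f_{10}$. The integers $\overline{b}_5(n)$ are defined by $$\sum_{n=0}^\infty \overline{b}_5(n)q^n=\frac{\psi^5(-q^5)}{\psi(-q)}=1+q+q^2+2q^3+3q^4-q^5+2q^7-2q^9+6q^{10}+\cdots .$$ Note that $(5^k-1)/4$ is an integer for every $k\ge 1$. -}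

module Defs where

open import Data.Bool.Base using (if_then_else_)
open import Data.Fin.Base using (toℕ)
open import Data.Integer.Base using (ℤ; +_; -[1+_]; 0ℤ; 1ℤ; _+_; _-_; _*_; _^_)
open import Data.Integer.Divisibility.Signed using (_∣_)
open import Data.Integer.Properties using (+-0-monoid; *-identityʳ; +-comm; +-assoc; +-inverseˡ; +-identityʳ)
open import Data.List.Base using (map; upTo; _∷_; [])
open import Data.Nat.Base as ℕ using (ℕ; zero; suc; _∸_; _≡ᵇ_)
open import Data.Nat.DivMod using (_/_)
open import Relation.Binary.PropositionalEquality.Core using (_≡_; refl; trans; cong)

open import Algebra.Properties.Monoid.Sum +-0-monoid using (sum-syntax)

-- Formal power series over ℤ; f n is the coefficient of qⁿ.
Series : Set
Series = ℕ → ℤ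

infixl 7 _⊛_ _⊘_
infixr 8 _⊛^_

_⊛_ : Series → Series → Series
(f ⊛ g) n = ∑[ i < suc n ] (f (toℕ i) * g (n ∸ toℕ i))

one : Series
one zero    = 1ℤ
one (suc _) = 0ℤ

_⊛^_ : Series → ℕ → Series
f ⊛^ zero  = one
f ⊛^ suc k = f ⊛ (f ⊛^ k)

-- (f - f₀ g) / q, when g has constant term 1.
remainder : Series → Series → Series
remainder f g m = f (suc m) - f zero * g (suc m)

-- Long division. It is the quotient only when g has constant term 1,
-- see ⊘-⊛ below.
_⊘_ : Series → Series → Series
(f ⊘ g) zero    = f zero
(f ⊘ g) (suc n) = (remainder f g ⊘ g) n

⊘-⊛ : ∀ f g → g zero ≡ 1ℤ → ∀ n → ((f ⊘ g) ⊛ g) n ≡ f n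
⊘-⊛ f g g₀ zero
  rewrite g₀ | *-identityʳ (f zero) = +-identityʳ (f zero)
⊘-⊛ f g g₀ (suc n) =
  trans (cong (λ z → f zero * g (suc n) + z) (⊘-⊛ (remainder f g) g g₀ n))
        (cancel (f zero * g (suc n)) (f (suc n)))
  where
  cancel : ∀ x y → x + (y - x) ≡ y
  cancel x y = trans (+-comm x (y - x))
                 (trans (+-assoc y _ x)
                   (trans (cong (λ z → y + z) (+-inverseˡ x)) (+-identityʳ y)))

triangular : ℕ → ℕ
triangular n = n ℕ.* (n ℕ.+ 1) / 2

-- monomial c d is c qᵈ.
monomial : ℤ → ℕ → Series
monomial c d m = if m ≡ᵇ d then c else 0ℤ

-- ψ(-qʲ) = Σₙ (-qʲ)^(n(n+1)/2), where (-qʲ)ᵗ = (-1)ᵗ q^(jt).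
-- Since j · n(n+1)/2 ≥ n for j ≥ 1, the terms with n > m do not
-- contribute to the coefficient of qᵐ.
ψ[-q^_] : (j : ℕ) .{{_ : ℕ.NonZero j}} → Series
ψ[-q^ j ] m =
  ∑[ i < suc m ]
    monomial (-[1+ 0 ] ^ triangular (toℕ i)) (j ℕ.* triangular (toℕ i)) m

b̅₅ : ℕ → ℤ
b̅₅ = (ψ[-q^ 5 ] ⊛^ 5) ⊘ ψ[-q^ 1 ]

b̅₅-generating-function : ∀ n → (b̅₅ ⊛ ψ[-q^ 1 ]) n ≡ (ψ[-q^ 5 ] ⊛^ 5) n
b̅₅-generating-function = ⊘-⊛ (ψ[-q^ 5 ] ⊛^ 5) ψ[-q^ 1 ] refl

b̅₅-initial :
  map b̅₅ (upTo 11) ≡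
  + 1 ∷ + 1 ∷ + 1 ∷ + 2 ∷ + 3 ∷ -[1+ 0 ] ∷ + 0 ∷ + 2 ∷ + 0 ∷ -[1+ 1 ] ∷ + 6 ∷ []
b̅₅-initial = refl

infix 4 _≡_[mod_]

_≡_[mod_] : ℤ → ℤ → ℕ → Set
a ≡ b [mod m ] = + m ∣ a - b

{-# OPTIONS --safe #-}

-- Let c(m) be the coefficient of q^m in C = q³ ψ(q⁵)⁵/ψ(q), so that b̅₅(n) = (-1)^n c(n + 3).
-- The key fact is c(25m) = 6 c(5m) - 5 c(m), that is (U₅ - 1)(U₅ - 5) C = 0. It gives
-- 4 c(5^k m) = (5^k - 1) c(5m) + (5 - 5^k) c(m), hence the first congruence, and it reduces
-- the other two to c(m) = 0 for m ≡ ±2 (mod 20).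
--
-- Let X = q ψ(q)³ψ(q⁵), Y = q² ψ(q)ψ(q⁵)³ and W = X - Y. In the 5-dissection
-- ψ(q) = A(q⁵) + q B(q⁵) + q³ ψ(q²⁵) one has A B = ψ(q)² - q ψ(q⁵)²; therefore
-- U₅ Y = X, U₅ X = 6X - 5Y, and X = 3Y on the exponents ≡ ±2 (mod 5). Moreover
-- Y - C = G(q²) for a series G with G(q) + G(q²) = W, and U₂ W = 2W. So G, and with it
-- C = Y - G(q²), inherits the recurrence, and both vanishing statements follow.
--
-- No infinite products are needed. All quadratic theta identities come from the rotations of ℤ²
-- by 1 + i and 2 + i. They yield, with Φ = φ(q)² - φ(q⁵)² and E = ψ(q²)² - q² ψ(q¹⁰)², the equation
-- Φ E = 4 q ψ(q⁵)² (ψ(q)² - q ψ(q⁵)²); squaring it in terms of φ(q²), ψ(q⁴), φ(q¹⁰), ψ(q²⁰) and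
-- separating the parity of the exponents yields a second relation, and the two together factor
-- to 4 q ψ(q) ψ(q¹⁰) E = ψ(q²) ψ(q⁵) Φ, from which the statements about G and W are formal.
-- Throughout q is replaced by q⁸ and factors 2 are absorbed, so that ψ becomes O = Σ q^(x²) over odd x.

module Submission where

open import Defs
open import Algebra.Bundles using (CommutativeRing)
open import Algebra.Solver.Ring.AlmostCommutativeRing
  using (AlmostCommutativeRing; fromCommutativeRing; _-Raw-AlmostCommutative⟶_; Induced-equivalence)
import Algebra.Solver.Ring as Solver
open import Data.Bool.Base as Bool using (true; false; if_then_else_)
open import Data.Fin.Base using (Fin; toℕ)
import Data.Fin.Properties as Fin
open import Data.Integer.Base as ℤ
  using (ℤ; +-*-rawRing; +_; -[1+_]; 0ℤ; 1ℤ; _+_; _-_; _*_; -_; ∣_∣; _⊖_)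
open import Data.Integer.Divisibility.Signed using (divides)
import Data.Integer.Properties as ℤ
open import Data.Integer.Tactic.RingSolver using (solve-∀)
open import Data.Maybe.Base using (just; nothing)
open import Data.Nat.Base as ℕ using (ℕ; zero; suc; _∸_; _≤_; _<_; _^_; NonZero; z≤n; s≤s)
open import Data.Nat.DivMod
  using (_%_; _/_; _mod_; %-distribˡ-+; %-distribˡ-*; [m+kn]%n≡m%n; m≡m%n+[m/n]*n; m<n⇒m%n≡m; m*n%n≡0;
         m*n/n≡m; m∣n⇒o%n%m≡o%m; m%n<n)
open import Data.Nat.Divisibility.Core as ℕ using (_∣_)
open import Data.Nat.Induction using (<-rec)
import Data.Nat.Properties as ℕ
open import Data.Nat.Tactic.RingSolver using () renaming (solve-∀ to solveℕ-∀)
open import Data.Product.Base using (_×_; _,_; proj₁; proj₂; ∃)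
open import Data.Sum.Base using (_⊎_; inj₁; inj₂; [_,_]′; map₁; map₂)
open import Function.Base using (_∘_)
open import Level using (0ℓ)
open import Relation.Binary.Definitions using (WeaklyDecidable)
open import Relation.Binary.PropositionalEquality
  using (_≡_; _≢_; refl; sym; trans; cong; cong₂; subst; module ≡-Reasoning)
open import Relation.Nullary.Decidable using (Dec; yes; no; True; toWitness; _⊎-dec_; _→-dec_; ¬?)
open import Relation.Nullary.Negation.Core using (contradiction)

open import Algebra.Properties.Monoid.Sum ℤ.+-0-monoid using (sum-syntax)

-- The series C is known only through its product with ψ(q), so each fact about it is won by
-- multiplying with theta series and cancelling them again. Power series over ℤ have no zero
-- divisors, hence one nonzero coefficient of a factor suffices to cancel it; the same device
-- discards the wrong factor whenever a product of two forms vanishes. Why the squaring helps: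
-- brought into the shape N = 4prst, where p, s, r, t are the values of φ and ψ involved, the first
-- relation has a left side N that is even in every variable. Its square therefore involves only p²,
-- s², r², t², and these are quadratic forms in the same four series at q². Each half of the parity
-- splitting is then a relation at q², and it can be pulled back to q because f(q²) = 0 forces f =
-- 0. So a second relation between the original four series appears. Why q⁸: ψ then becomes a sum
-- over odd squares, and a product of two such series is a sum over ℤ² whose weight depends on the
-- coordinates modulo 10 only. Theta identities thereby reduce to comparing 10 by 10 tables.

infix  4 _≈_
infixl 6 _⊕_ _⊝_
infix  8 ⊖_

-- The ring of formal power series

_≈_ : Series → Series → Set
f ≈ g = ∀ n → f n ≡ g n

_⊕_ _⊝_ : Series → Series → Series
(f ⊕ g) n = f n + g n
(f ⊝ g) n = f n - g n

⊖_ tail : Series → Series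
(⊖ f) n = - f n
tail f n = f (suc n)

-- Zero and one of the ring are taken in this form so that `κ` can serve as the coefficient
-- homomorphism of the ring solver.
κ : ℤ → Series
κ c zero    = c
κ c (suc _) = 0ℤ

κ0 : ∀ n → κ 0ℤ n ≡ 0ℤ
κ0 zero    = refl
κ0 (suc _) = refl

infixl 7 _·_

opaque
  -- Opacity keeps large products from being computed. They are handled through `·-zero` and
  -- `·-suc`, and unfolded again only to read off three coefficients.
  _·_ : Series → Series → Series
  _·_ = _⊛_

  ·≈⊛ : ∀ f g → f · g ≈ f ⊛ g
  ·≈⊛ f g n = refl

  ·-zero : ∀ f g → (f · g) 0 ≡ f 0 * g 0
  ·-zero f g = ℤ.+-identityʳ (f 0 * g 0)

  ·-suc : ∀ f g n → (f · g) (suc n) ≡ f 0 * g (suc n) + (tail f · g) n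
  ·-suc f g n = refl

·-cong : ∀ {f f′ g g′} → f ≈ f′ → g ≈ g′ → f · g ≈ f′ · g′
·-cong {f} {f′} {g} {g′} p q zero =
  trans (·-zero f g) (trans (cong₂ _*_ (p 0) (q 0)) (sym (·-zero f′ g′)))
·-cong {f} {f′} {g} {g′} p q (suc n) =
  trans (·-suc f g n)
    (trans (cong₂ _+_ (cong₂ _*_ (p 0) (q (suc n))) (·-cong (λ k → p (suc k)) q n))
      (sym (·-suc f′ g′ n)))

·-congˡ : ∀ f {g g′} → g ≈ g′ → f · g ≈ f · g′
·-congˡ f = ·-cong {f} (λ _ → refl)

·-congʳ : ∀ g {f f′} → f ≈ f′ → f · g ≈ f′ · g
·-congʳ g p = ·-cong {g = g} p (λ _ → refl)

-- The tail of f · g is f 0 times the tail of g plus tail f · g. The induction for associativity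
-- meets exactly this combination, and distributivity is the case c = 1.
·-linearˡ : ∀ c f g h n → ((λ k → c * f k + g k) · h) n ≡ c * (f · h) n + (g · h) n
·-linearˡ c f g h zero
  rewrite ·-zero (λ k → c * f k + g k) h | ·-zero f h | ·-zero g h = lemma c (f 0) (g 0) (h 0)
  where
  lemma : ∀ c x y z → (c * x + y) * z ≡ c * (x * z) + y * z
  lemma = solve-∀
·-linearˡ c f g h (suc n)
  rewrite ·-suc (λ k → c * f k + g k) h n | ·-suc f h n | ·-suc g h n
        | ·-linearˡ c (tail f) (tail g) h n =
  lemma c (f 0) (g 0) (h (suc n)) ((tail f · h) n) ((tail g · h) n)
  where
  lemma : ∀ c x y z u v → (c * x + y) * z + (c * u + v) ≡ c * (x * z + u) + (y * z + v)
  lemma = solve-∀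

·-sucʳ : ∀ f g n → (f · g) (suc n) ≡ f (suc n) * g 0 + (f · tail g) n
·-sucʳ f g zero
  rewrite ·-suc f g 0 | ·-zero (tail f) g | ·-zero f (tail g) = ℤ.+-comm (f 0 * g 1) (f 1 * g 0)
·-sucʳ f g (suc n)
  rewrite ·-suc f g (suc n) | ·-suc f (tail g) n | ·-sucʳ (tail f) g n =
  lemma (f 0 * g (suc (suc n))) (f (suc (suc n)) * g 0) ((tail f · tail g) n)
  where
  lemma : ∀ a b c → a + (b + c) ≡ b + (a + c)
  lemma = solve-∀

·-comm : ∀ f g → f · g ≈ g · f
·-comm f g zero
  rewrite ·-zero f g | ·-zero g f = ℤ.*-comm (f 0) (g 0)
·-comm f g (suc n)
  rewrite ·-suc f g n | ·-sucʳ g f n =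
  cong₂ _+_ (ℤ.*-comm (f 0) (g (suc n))) (·-comm (tail f) g n)

·-assoc : ∀ f g h → (f · g) · h ≈ f · (g · h)
·-assoc f g h zero
  rewrite ·-zero (f · g) h | ·-zero f g | ·-zero f (g · h) | ·-zero g h = ℤ.*-assoc (f 0) (g 0) (h 0)
·-assoc f g h (suc n) = begin
  ((f · g) · h) (suc n)
    ≡⟨ ·-suc (f · g) h n ⟩
  (f · g) 0 * h (suc n) + (tail (f · g) · h) n
    ≡⟨ cong₂ (λ x y → x * h (suc n) + y) (·-zero f g) (·-congʳ h (·-suc f g) n) ⟩
  f 0 * g 0 * h (suc n) + ((λ k → f 0 * g (suc k) + (tail f · g) k) · h) n
    ≡⟨ cong (λ z → f 0 * g 0 * h (suc n) + z) (·-linearˡ (f 0) (tail g) (tail f · g) h n) ⟩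
  f 0 * g 0 * h (suc n) + (f 0 * (tail g · h) n + ((tail f · g) · h) n)
    ≡⟨ cong (λ z → f 0 * g 0 * h (suc n) + (f 0 * (tail g · h) n + z)) (·-assoc (tail f) g h n) ⟩
  f 0 * g 0 * h (suc n) + (f 0 * (tail g · h) n + (tail f · (g · h)) n)
    ≡⟨ lemma (f 0) (g 0) (h (suc n)) ((tail g · h) n) ((tail f · (g · h)) n) ⟩
  f 0 * (g 0 * h (suc n) + (tail g · h) n) + (tail f · (g · h)) n
    ≡⟨ cong (λ z → f 0 * z + (tail f · (g · h)) n) (sym (·-suc g h n)) ⟩
  f 0 * (g · h) (suc n) + (tail f · (g · h)) n
    ≡⟨ sym (·-suc f (g · h) n) ⟩
  (f · (g · h)) (suc n) ∎
  where
  open ≡-Reasoning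
  lemma : ∀ x y z u v → x * y * z + (x * u + v) ≡ x * (y * z + u) + v
  lemma = solve-∀

0-· : ∀ f n → ((λ _ → 0ℤ) · f) n ≡ 0ℤ
0-· f zero    = ·-zero _ f
0-· f (suc n) = trans (·-suc _ f n) (trans (ℤ.+-identityˡ _) (0-· f n))

κ-· : ∀ c f n → (κ c · f) n ≡ c * f n
κ-· c f zero    = ·-zero (κ c) f
κ-· c f (suc n) = trans (·-suc (κ c) f n)
  (trans (cong (λ z → c * f (suc n) + z) (0-· f n)) (ℤ.+-identityʳ (c * f (suc n))))

·-distribʳ : ∀ h f g → (f ⊕ g) · h ≈ (f · h) ⊕ (g · h)
·-distribʳ h f g n =
  trans (·-congʳ h (λ k → cong (_+ g k) (sym (ℤ.*-identityˡ (f k)))) n)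
    (trans (·-linearˡ 1ℤ f g h n) (cong (_+ (g · h) n) (ℤ.*-identityˡ ((f · h) n))))

1-· : ∀ f → κ 1ℤ · f ≈ f
1-· f n = trans (κ-· 1ℤ f n) (ℤ.*-identityˡ (f n))

seriesRing : CommutativeRing 0ℓ 0ℓ
seriesRing = record
  { Carrier = Series ; _≈_ = _≈_ ; _+_ = _⊕_ ; _*_ = _·_ ; -_ = ⊖_ ; 0# = κ 0ℤ ; 1# = κ 1ℤ
  ; isCommutativeRing = record
    { isRing = record
      { +-isAbelianGroup = record
        { isGroup = record
          { isMonoid = record
            { isSemigroup = record
              { isMagma = record
                { isEquivalence = record
                  { refl  = λ _ → refl
                  ; sym   = λ p n → sym (p n)
                  ; trans = λ p q n → trans (p n) (q n) }
                ; ∙-cong = λ p q n → cong₂ _+_ (p n) (q n) }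
              ; assoc = λ f g h n → ℤ.+-assoc (f n) (g n) (h n) }
            ; identity = (λ f n → trans (cong (_+ f n) (κ0 n)) (ℤ.+-identityˡ (f n)))
                       , (λ f n → trans (cong (_+_ (f n)) (κ0 n)) (ℤ.+-identityʳ (f n))) }
          ; inverse = (λ f n → trans (ℤ.+-inverseˡ (f n)) (sym (κ0 n)))
                    , (λ f n → trans (ℤ.+-inverseʳ (f n)) (sym (κ0 n)))
          ; ⁻¹-cong = λ p n → cong -_ (p n) }
        ; comm = λ f g n → ℤ.+-comm (f n) (g n) }
      ; *-cong = ·-cong
      ; *-assoc = ·-assoc
      ; *-identity = 1-· , (λ f n → trans (·-comm f (κ 1ℤ) n) (1-· f n))
      ; distrib = (λ h f g n → trans (·-comm h (f ⊕ g) n)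
                    (trans (·-distribʳ h f g n) (cong₂ _+_ (·-comm f h n) (·-comm g h n))))
                , ·-distribʳ }
    ; *-comm = ·-comm } }

⊕-cong : ∀ {f f′ g g′} → f ≈ f′ → g ≈ g′ → f ⊕ g ≈ f′ ⊕ g′
⊕-cong p q n = cong₂ _+_ (p n) (q n)

⊝-cong : ∀ {f f′ g g′} → f ≈ f′ → g ≈ g′ → f ⊝ g ≈ f′ ⊝ g′
⊝-cong p q n = cong₂ _-_ (p n) (q n)

-- Substitution of a power of q

-- stretch e r f is qʳ f(q^(e+1)).
stretch : ℕ → ℕ → Series → Series
stretch e zero    f zero    = f zero
stretch e zero    f (suc n) = stretch e e (tail f) n
stretch e (suc r) f zero    = 0ℤ
stretch e (suc r) f (suc n) = stretch e r f n

-- V e f is f(q^(e+1)).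
V : ℕ → Series → Series
V e = stretch e 0

stretch-cong : ∀ e r {f g} → f ≈ g → stretch e r f ≈ stretch e r g
stretch-cong e zero    p zero    = p 0
stretch-cong e zero    p (suc n) = stretch-cong e e (λ k → p (suc k)) n
stretch-cong e (suc r) p zero    = refl
stretch-cong e (suc r) p (suc n) = stretch-cong e r p n

stretch-linear : ∀ e r c f g n →
  stretch e r (λ k → c * f k + g k) n ≡ c * stretch e r f n + stretch e r g n
stretch-linear e zero    c f g zero    = refl
stretch-linear e zero    c f g (suc n) = stretch-linear e e c (tail f) (tail g) n
stretch-linear e (suc r) c f g zero    = sym (trans (ℤ.+-identityʳ (c * 0ℤ)) (ℤ.*-zeroʳ c))
stretch-linear e (suc r) c f g (suc n) = stretch-linear e r c f g n

stretch-· : ∀ e r f g n → stretch e r (f · g) n ≡ (stretch e r f · V e g) n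
stretch-· e zero f g zero
  rewrite ·-zero f g = sym (·-zero (V e f) (V e g))
stretch-· e zero f g (suc n) = begin
  stretch e e (tail (f · g)) n
    ≡⟨ stretch-cong e e (·-suc f g) n ⟩
  stretch e e (λ k → f 0 * tail g k + (tail f · g) k) n
    ≡⟨ stretch-linear e e (f 0) (tail g) (tail f · g) n ⟩
  f 0 * stretch e e (tail g) n + stretch e e (tail f · g) n
    ≡⟨ cong (λ z → f 0 * stretch e e (tail g) n + z) (stretch-· e e (tail f) g n) ⟩
  f 0 * stretch e e (tail g) n + (stretch e e (tail f) · V e g) n
    ≡⟨ sym (·-suc (V e f) (V e g) n) ⟩
  (V e f · V e g) (suc n) ∎
  where open ≡-Reasoning
stretch-· e (suc r) f g zero    = sym (·-zero (stretch e (suc r) f) (V e g))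
stretch-· e (suc r) f g (suc n) =
  trans (stretch-· e r f g n)
    (sym (trans (·-suc (stretch e (suc r) f) (V e g) n) (ℤ.+-identityˡ ((stretch e r f · V e g) n))))

V-cong : ∀ e {f g} → f ≈ g → V e f ≈ V e g
V-cong e = stretch-cong e 0

V-· : ∀ e f g → V e (f · g) ≈ V e f · V e g
V-· e = stretch-· e 0

V-⊕ : ∀ e f g → V e (f ⊕ g) ≈ V e f ⊕ V e g
V-⊕ e f g n =
  trans (V-cong e (λ k → cong (_+ g k) (sym (ℤ.*-identityˡ (f k)))) n)
    (trans (stretch-linear e 0 1ℤ f g n) (cong (_+ V e g n) (ℤ.*-identityˡ (V e f n))))

V-⊝ : ∀ e f g → V e (f ⊝ g) ≈ V e f ⊝ V e g
V-⊝ e f g n =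
  trans (V-cong e (λ k → lemma (f k) (g k)) n)
    (trans (stretch-linear e 0 (-[1+ 0 ]) g f n) (sym (lemma (V e f n) (V e g n))))
  where
  lemma : ∀ x y → x - y ≡ -[1+ 0 ] * y + x
  lemma = solve-∀

V-κ : ∀ e c → V e (κ c) ≈ κ c
V-κ e c zero    = refl
V-κ e c (suc n) = vanish e n
  where
  vanish : ∀ r n → stretch e r (λ _ → 0ℤ) n ≡ 0ℤ
  vanish zero    zero    = refl
  vanish zero    (suc n) = vanish e n
  vanish (suc r) zero    = refl
  vanish (suc r) (suc n) = vanish r n

stretch-coefficient : ∀ e r f k → stretch e r f (r ℕ.+ k ℕ.* suc e) ≡ f k
stretch-coefficient e zero    f zero    = refl
stretch-coefficient e zero    f (suc k) = stretch-coefficient e e (tail f) k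
stretch-coefficient e (suc r) f k       = stretch-coefficient e r f k

stretch-support : ∀ e r f n → stretch e r f n ≡ 0ℤ ⊎ ∃ λ k → n ≡ r ℕ.+ k ℕ.* suc e
stretch-support e zero    f zero    = inj₂ (0 , refl)
stretch-support e zero    f (suc n) =
  map₂ (λ { (k , p) → suc k , cong suc p }) (stretch-support e e (tail f) n)
stretch-support e (suc r) f zero    = inj₁ refl
stretch-support e (suc r) f (suc n) =
  map₂ (λ { (k , p) → k , cong suc p }) (stretch-support e r f n)

V-coefficient : ∀ e f k → V e f (k ℕ.* suc e) ≡ f k
V-coefficient e = stretch-coefficient e 0

V-support : ∀ e f n → V e f n ≡ 0ℤ ⊎ ∃ λ k → n ≡ k ℕ.* suc e
V-support e = stretch-support e 0

V-injective : ∀ e {f g} → V e f ≈ V e g → f ≈ g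
V-injective e {f} {g} p k =
  trans (sym (V-coefficient e f k)) (trans (p (k ℕ.* suc e)) (V-coefficient e g k))

V-unique : ∀ e f h → (∀ k → h (k ℕ.* suc e) ≡ f k) →
  (∀ n → h n ≡ 0ℤ ⊎ ∃ λ k → n ≡ k ℕ.* suc e) → h ≈ V e f
V-unique e f h p q n with q n
... | inj₂ (k , refl) = trans (p k) (sym (V-coefficient e f k))
... | inj₁ h≡0 with V-support e f n
...   | inj₁ v≡0 = trans h≡0 (sym v≡0)
...   | inj₂ (k , refl) = trans (p k) (sym (V-coefficient e f k))

V-comm : ∀ d e f → V d (V e f) ≈ V e (V d f)
V-comm d e f = V-unique e (V d f) (V d (V e f)) values support
  where
  support : ∀ n → V d (V e f) n ≡ 0ℤ ⊎ ∃ λ k → n ≡ k ℕ.* suc e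
  support n with V-support d (V e f) n
  ... | inj₁ z = inj₁ z
  ... | inj₂ (k , refl) with V-support e f k
  ...   | inj₁ z = inj₁ (trans (V-coefficient d (V e f) k) z)
  ...   | inj₂ (j , refl) = inj₂ (j ℕ.* suc d , swap j (suc e) (suc d))
    where
    swap : ∀ a b c → a ℕ.* b ℕ.* c ≡ a ℕ.* c ℕ.* b
    swap = solveℕ-∀
  values : ∀ k → V d (V e f) (k ℕ.* suc e) ≡ V d f k
  values k with V-support d f k
  ... | inj₂ (j , refl) =
    trans (cong (V d (V e f)) (swap j (suc d) (suc e)))
      (trans (V-coefficient d (V e f) (j ℕ.* suc e))
        (trans (V-coefficient e f j) (sym (V-coefficient d f j))))
    where
    swap : ∀ a b c → a ℕ.* b ℕ.* c ≡ a ℕ.* c ℕ.* b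
    swap = solveℕ-∀
  ... | inj₁ z with V-support d (V e f) (k ℕ.* suc e)
  ...   | inj₁ z′ = trans z′ (sym z)
  ...   | inj₂ (i , p) with V-support e f i
  ...     | inj₁ z″ = trans (cong (V d (V e f)) p) (trans (V-coefficient d (V e f) i) (trans z″ (sym z)))
  ...     | inj₂ (j , refl) =
    trans (cong (V d (V e f)) p)
      (trans (V-coefficient d (V e f) i)
        (trans (V-coefficient e f j)
          (sym (trans (cong (V d f) k≡) (V-coefficient d f j)))))
    where
    swap : ∀ a b c → a ℕ.* b ℕ.* c ≡ a ℕ.* c ℕ.* b
    swap = solveℕ-∀
    k≡ : k ≡ j ℕ.* suc d
    k≡ = ℕ.*-cancelʳ-≡ k (j ℕ.* suc d) (suc e) (trans p (swap j (suc e) (suc d)))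

-- The nonzero coefficient f k may be any one, not only the lowest: as long as f 0 = 0, a factor q
-- is dropped from f and k decreases.
·-cancel : ∀ k f g → f k ≢ 0ℤ → f · g ≈ κ 0ℤ → g ≈ κ 0ℤ
·-cancel zero f g f₀≢0 p zero with ℤ.i*j≡0⇒i≡0∨j≡0 (f 0) (trans (sym (·-zero f g)) (p 0))
... | inj₁ z = contradiction z f₀≢0
... | inj₂ z = z
·-cancel zero f g f₀≢0 p (suc n) = trans (·-cancel 0 f (tail g) f₀≢0 p′ n) (κ0 n)
  where
  p′ : f · tail g ≈ κ 0ℤ
  p′ n = begin
    (f · tail g) n                       ≡⟨ sym (ℤ.+-identityˡ _) ⟩
    0ℤ + (f · tail g) n                  ≡⟨ cong (_+ (f · tail g) n) (sym (ℤ.*-zeroʳ (f (suc n)))) ⟩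
    f (suc n) * 0ℤ + (f · tail g) n      ≡⟨ cong (λ z → f (suc n) * z + (f · tail g) n) (sym (·-cancel 0 f g f₀≢0 p 0)) ⟩
    f (suc n) * g 0 + (f · tail g) n     ≡⟨ sym (·-sucʳ f g n) ⟩
    (f · g) (suc n)                      ≡⟨ p (suc n) ⟩
    0ℤ                                   ≡⟨ sym (κ0 n) ⟩
    κ 0ℤ n                               ∎
    where open ≡-Reasoning
·-cancel (suc k) f g fₖ≢0 p with f 0 ℤ.≟ 0ℤ
... | no f₀≢0  = ·-cancel 0 f g f₀≢0 p
... | yes f₀≡0 = ·-cancel k (tail f) g fₖ≢0 p′
  where
  p′ : tail f · g ≈ κ 0ℤ
  p′ n = begin
    (tail f · g) n                       ≡⟨ sym (ℤ.+-identityˡ _) ⟩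
    0ℤ * g (suc n) + (tail f · g) n      ≡⟨ cong (λ z → z * g (suc n) + (tail f · g) n) (sym f₀≡0) ⟩
    f 0 * g (suc n) + (tail f · g) n     ≡⟨ sym (·-suc f g n) ⟩
    (f · g) (suc n)                      ≡⟨ p (suc n) ⟩
    0ℤ                                   ≡⟨ sym (κ0 n) ⟩
    κ 0ℤ n                               ∎
    where open ≡-Reasoning

-- Series supported in one residue class

record Supp (d : ℕ) .{{_ : NonZero d}} (r : ℕ) (f : Series) : Set where
  constructor supp
  field supported : ∀ n → f n ≡ 0ℤ ⊎ n % d ≡ r % d

open Supp

-- P is whatever a contributing pair of exponents would prove; this is how information on the
-- exponents of the factors passes to the product.
·-elim : ∀ {P : Set} f g n → (∀ i j → i ℕ.+ j ≡ n → f i * g j ≡ 0ℤ ⊎ P) → (f · g) n ≡ 0ℤ ⊎ P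
·-elim f g zero h = map₁ (trans (·-zero f g)) (h 0 0 refl)
·-elim f g (suc n) h with h 0 (suc n) refl | ·-elim (tail f) g n (λ i j p → h (suc i) j (cong suc p))
... | inj₂ x | _      = inj₂ x
... | inj₁ _ | inj₂ x = inj₂ x
... | inj₁ a | inj₁ b = inj₁ (trans (·-suc f g n) (cong₂ _+_ a b))

module _ {d : ℕ} .{{_ : NonZero d}} where

  Supp-cong : ∀ {r f g} → f ≈ g → Supp d r f → Supp d r g
  Supp-cong p (supp s) = supp λ n → map₁ (trans (sym (p n))) (s n)

  Supp-· : ∀ {r r′ f g} → Supp d r f → Supp d r′ g → Supp d (r ℕ.+ r′) (f · g)
  Supp-· {r} {r′} {f} {g} (supp s) (supp s′) = supp λ n → ·-elim f g n (term n)
    where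
    term : ∀ n i j → i ℕ.+ j ≡ n → f i * g j ≡ 0ℤ ⊎ n % d ≡ (r ℕ.+ r′) % d
    term n i j refl with s i | s′ j
    ... | inj₁ z | _      = inj₁ (cong (_* g j) z)
    ... | inj₂ _ | inj₁ z = inj₁ (trans (cong (f i *_) z) (ℤ.*-zeroʳ (f i)))
    ... | inj₂ a | inj₂ b =
      inj₂ (trans (%-distribˡ-+ i j d) (trans (cong₂ (λ x y → (x ℕ.+ y) % d) a b) (sym (%-distribˡ-+ r r′ d))))

  Supp-⊕ : ∀ {r f g} → Supp d r f → Supp d r g → Supp d r (f ⊕ g)
  Supp-⊕ {r} {f} {g} (supp s) (supp s′) = supp sum
    where
    sum : ∀ n → (f ⊕ g) n ≡ 0ℤ ⊎ n % d ≡ r % d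
    sum n with s n | s′ n
    ... | inj₂ x | _      = inj₂ x
    ... | inj₁ _ | inj₂ x = inj₂ x
    ... | inj₁ a | inj₁ b = inj₁ (cong₂ _+_ a b)

  Supp-⊝ : ∀ {r f g} → Supp d r f → Supp d r g → Supp d r (f ⊝ g)
  Supp-⊝ {r} {f} {g} (supp s) (supp s′) =
    Supp-⊕ {f = f} {⊖ g} (supp s) (supp λ n → map₁ (cong (λ x → - x)) (s′ n))

  Supp-κ : ∀ c → Supp d 0 (κ c)
  Supp-κ c = supp λ { zero → inj₂ refl ; (suc n) → inj₁ refl }

  Supp-% : ∀ {r r′ f} → r % d ≡ r′ % d → Supp d r f → Supp d r′ f
  Supp-% p (supp s) = supp λ n → map₂ (λ q → trans q p) (s n)

  Supp-V′ : ∀ e {r f} → Supp d r f → Supp d (r ℕ.* suc e) (V e f)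
  Supp-V′ e {r} {f} (supp s) = supp stretched
    where
    stretched : ∀ n → V e f n ≡ 0ℤ ⊎ n % d ≡ (r ℕ.* suc e) % d
    stretched n with V-support e f n
    ... | inj₁ z = inj₁ z
    ... | inj₂ (k , refl) with s k
    ...   | inj₁ z = inj₁ (trans (V-coefficient e f k) z)
    ...   | inj₂ p = inj₂ (trans (%-distribˡ-* k (suc e) d)
              (trans (cong (λ x → (x ℕ.* (suc e % d)) % d) p) (sym (%-distribˡ-* r (suc e) d))))

  -- No exponent lies in both classes, so nothing in f can cancel against g. This is the tool for
  -- separating exponents.
  Supp-disjoint : ∀ {r r′ f g} → r % d ≢ r′ % d → Supp d r f → Supp d r′ g → f ⊕ g ≈ κ 0ℤ → f ≈ κ 0ℤ
  Supp-disjoint {f = f} {g} r≢r′ (supp s) (supp s′) p n with s n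
  ... | inj₁ z = trans z (sym (κ0 n))
  ... | inj₂ a with s′ n
  ...   | inj₂ b = contradiction (trans (sym a) b) r≢r′
  ...   | inj₁ z = trans (sym (trans (cong (λ x → f n + x) z) (ℤ.+-identityʳ (f n)))) (p n)

Supp-V : ∀ e {d D r f} .{{_ : NonZero d}} .{{_ : NonZero D}} → d ℕ.* suc e ≡ D →
  Supp d r f → Supp D (r ℕ.* suc e) (V e f)
Supp-V e {d} {r = r} {f} refl (supp s) = supp stretched
  where
  distribute : ∀ a b d c → (a ℕ.+ b ℕ.* d) ℕ.* c ≡ a ℕ.* c ℕ.+ b ℕ.* (d ℕ.* c)
  distribute = solveℕ-∀
  scale : ∀ x → (x ℕ.* suc e) % (d ℕ.* suc e) ≡ ((x % d) ℕ.* suc e) % (d ℕ.* suc e)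
  scale x = trans (cong (_% (d ℕ.* suc e))
                (trans (cong (ℕ._* suc e) (m≡m%n+[m/n]*n x d)) (distribute (x % d) (x / d) d (suc e))))
              ([m+kn]%n≡m%n ((x % d) ℕ.* suc e) (x / d) (d ℕ.* suc e))
  stretched : ∀ n → V e f n ≡ 0ℤ ⊎ n % (d ℕ.* suc e) ≡ (r ℕ.* suc e) % (d ℕ.* suc e)
  stretched n with V-support e f n
  ... | inj₁ z = inj₁ z
  ... | inj₂ (k , refl) with s k
  ...   | inj₁ z = inj₁ (trans (V-coefficient e f k) z)
  ...   | inj₂ p = inj₂ (trans (scale k) (trans (cong (λ x → (x ℕ.* suc e) % (d ℕ.* suc e)) p) (sym (scale r))))

Supp-V₀ : ∀ e f → Supp (suc e) 0 (V e f)
Supp-V₀ e f = supp λ n → map₂ (λ { (k , refl) → [m+kn]%n≡m%n 0 k (suc e) }) (V-support e f n)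

Supp-divisor : ∀ {m n r f} .{{_ : NonZero m}} .{{_ : NonZero n}} → m ∣ n → Supp n r f → Supp m r f
Supp-divisor {m} {n} {r} m∣n (supp s) = supp λ k →
  map₂ (λ p → trans (sym (m∣n⇒o%n%m≡o%m m n k m∣n)) (trans (cong (_% m) p) (m∣n⇒o%n%m≡o%m m n r m∣n))) (s k)

-- Finitely supported sums over ℤ

S : ℕ → (ℤ → ℤ) → ℤ
S zero    f = f 0ℤ
S (suc N) f = S N f + (f (+ suc N) + f -[1+ N ])

S-cong : ∀ N {f g} → (∀ x → f x ≡ g x) → S N f ≡ S N g
S-cong zero    p = p 0ℤ
S-cong (suc N) p = cong₂ _+_ (S-cong N p) (cong₂ _+_ (p _) (p _))

S-linear : ∀ N c f g → S N (λ x → c * f x + g x) ≡ c * S N f + S N g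
S-linear zero    c f g = refl
S-linear (suc N) c f g =
  trans (cong (_+ (c * f (+ suc N) + g (+ suc N) + (c * f -[1+ N ] + g -[1+ N ]))) (S-linear N c f g))
        (lemma c (S N f) (S N g) (f (+ suc N)) (g (+ suc N)) (f -[1+ N ]) (g -[1+ N ]))
  where
  lemma : ∀ c s t u v w z →
    c * s + t + (c * u + v + (c * w + z)) ≡ c * (s + (u + w)) + (t + (v + z))
  lemma = solve-∀

S-0 : ∀ N → S N (λ _ → 0ℤ) ≡ 0ℤ
S-0 zero    = refl
S-0 (suc N) = cong (_+ 0ℤ) (S-0 N)

S-+ : ∀ N f g → S N (λ x → f x + g x) ≡ S N f + S N g
S-+ N f g =
  trans (S-cong N (λ x → cong (_+ g x) (sym (ℤ.*-identityˡ (f x)))))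
    (trans (S-linear N 1ℤ f g) (cong (_+ S N g) (ℤ.*-identityˡ (S N f))))

S-swap : ∀ M N (H : ℤ → ℤ → ℤ) →
  S M (λ x → S N (λ y → H x y)) ≡ S N (λ y → S M (λ x → H x y))
S-swap zero    N H = refl
S-swap (suc M) N H =
  trans (cong₂ _+_ (S-swap M N H) (sym (S-+ N (H (+ suc M)) (H -[1+ M ]))))
        (sym (S-+ N (λ y → S M (λ x → H x y)) (λ y → H (+ suc M) y + H -[1+ M ] y)))

S-neg : ∀ N f → S N (λ x → f (- x)) ≡ S N f
S-neg zero    f = refl
S-neg (suc N) f = cong₂ _+_ (S-neg N f) (ℤ.+-comm (f -[1+ N ]) (f (+ suc N)))

-- Both sides are the sum of f over the interval from -N to N + 1.
S-shift : ∀ N f → S N (λ x → f (1ℤ + x)) + f (- (+ N)) ≡ S N f + f (+ suc N)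
S-shift zero    f = ℤ.+-comm (f (+ 1)) (f 0ℤ)
S-shift (suc N) f =
  trans (cong (λ z → S N (λ x → f (1ℤ + x)) + (f (+ suc (suc N)) + f z) + f -[1+ N ]) (ℤ.[1+m]⊖[1+n]≡m⊖n 0 N ))
  (trans (cong (λ z → S N (λ x → f (1ℤ + x)) + (f (+ suc (suc N)) + f z) + f -[1+ N ]) (zero⊖ N))
  (trans (rearrange (S N (λ x → f (1ℤ + x))) (f (+ suc (suc N))) (f (- (+ N))) (f -[1+ N ]))
  (trans (cong (_+ (f (+ suc (suc N)) + f -[1+ N ])) (S-shift N f))
         (rearrange′ (S N f) (f (+ suc N)) (f (+ suc (suc N))) (f -[1+ N ])))))
  where
  zero⊖ : ∀ n → 0 ⊖ n ≡ - (+ n)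
  zero⊖ zero    = refl
  zero⊖ (suc n) = refl
  rearrange : ∀ a b c d → a + (b + c) + d ≡ a + c + (b + d)
  rearrange = solve-∀
  rearrange′ : ∀ a b c d → a + b + (c + d) ≡ a + (b + d) + c
  rearrange′ = solve-∀

Bounded : ℕ → (ℤ → ℤ) → Set
Bounded N f = ∀ x → N < ∣ x ∣ → f x ≡ 0ℤ

S-stable : ∀ {N f} → Bounded N f → ∀ k → S (k ℕ.+ N) f ≡ S N f
S-stable b zero    = refl
S-stable {N} {f} b (suc k) = trans
  (cong₂ _+_ (S-stable b k)
    (cong₂ _+_ (b (+ suc (k ℕ.+ N)) (s≤s (ℕ.m≤n+m N k))) (b -[1+ (k ℕ.+ N) ] (s≤s (ℕ.m≤n+m N k)))))
  (ℤ.+-identityʳ (S N f))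

S-stable-≤ : ∀ {M N f} → Bounded N f → N ≤ M → S M f ≡ S N f
S-stable-≤ {M} {N} {f} b N≤M = trans (cong (λ m → S m f) (sym (ℕ.m∸n+n≡m N≤M))) (S-stable b (M ∸ N))

-- f ⟶ s : the finitely supported f has Σ_{x ∈ ℤ} f x = s.
infix 4 _⟶_
_⟶_ : (ℤ → ℤ) → ℤ → Set
f ⟶ s = ∃ λ N → Bounded N f × S N f ≡ s

⟶-at : ∀ {f s N} → Bounded N f → f ⟶ s → S N f ≡ s
⟶-at {f} {N = N} b (M , b′ , p) with ℕ.≤-total M N
... | inj₁ M≤N = trans (S-stable-≤ b′ M≤N) p
... | inj₂ N≤M = trans (sym (S-stable-≤ b N≤M)) p

⟶-unique : ∀ {f s t} → f ⟶ s → f ⟶ t → s ≡ t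
⟶-unique (N , b , p) q = trans (sym p) (⟶-at b q)

⟶-cong : ∀ {f g s} → (∀ x → f x ≡ g x) → f ⟶ s → g ⟶ s
⟶-cong e (N , b , p) = N , (λ x l → trans (sym (e x)) (b x l)) , trans (sym (S-cong N e)) p

⟶-linear : ∀ c {f g s t} → f ⟶ s → g ⟶ t → (λ x → c * f x + g x) ⟶ c * s + t
⟶-linear c {f} {g} (N , b , refl) (M , b′ , refl) =
  M ℕ.+ N
  , (λ x l → trans (cong₂ (λ y z → c * y + z)
                     (b x (ℕ.≤-<-trans (ℕ.m≤n+m N M) l)) (b′ x (ℕ.≤-<-trans (ℕ.m≤m+n M N) l)))
                   (trans (ℤ.+-identityʳ (c * 0ℤ)) (ℤ.*-zeroʳ c)))
  , trans (S-linear (M ℕ.+ N) c f g)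
      (cong₂ (λ y z → c * y + z) (S-stable b M) (S-stable-≤ b′ (ℕ.m≤m+n M N)))

⟶-0 : (λ _ → 0ℤ) ⟶ 0ℤ
⟶-0 = 0 , (λ _ _ → refl) , refl

⟶-neg : ∀ {f s} → f ⟶ s → (λ x → f (- x)) ⟶ s
⟶-neg {f} (N , b , p) =
  N , (λ x l → b (- x) (subst (N <_) (sym (ℤ.∣-i∣≡∣i∣ x)) l)) , trans (S-neg N f) p

⟶-suc : ∀ {f s} → f ⟶ s → (λ x → f (1ℤ + x)) ⟶ s
⟶-suc {f} {s} (N , b , p) = suc N , b′ , value
  where
  abs : ∀ x → suc N < ∣ x ∣ → N < ∣ 1ℤ + x ∣
  abs (+ n)          l       = ℕ.<-trans (ℕ.<-trans (ℕ.n<1+n N) l) (ℕ.n<1+n n)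
  abs -[1+ zero ]    (s≤s ())
  abs -[1+ (suc n) ] (s≤s l) = l
  b′ : Bounded (suc N) (λ x → f (1ℤ + x))
  b′ x l = b (1ℤ + x) (abs x l)
  value : S (suc N) (λ x → f (1ℤ + x)) ≡ s
  value = begin
    S (suc N) (λ x → f (1ℤ + x))                  ≡⟨ sym (ℤ.+-identityʳ _) ⟩
    S (suc N) (λ x → f (1ℤ + x)) + 0ℤ             ≡⟨ cong (λ z → S (suc N) (λ x → f (1ℤ + x)) + z) (sym (b -[1+ N ] ℕ.≤-refl)) ⟩
    S (suc N) (λ x → f (1ℤ + x)) + f (- + suc N)  ≡⟨ S-shift (suc N) f ⟩
    S (suc N) f + f (+ suc (suc N))               ≡⟨ cong (λ z → S (suc N) f + z) (b (+ suc (suc N)) (ℕ.m≤n⇒m≤1+n ℕ.≤-refl)) ⟩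
    S (suc N) f + 0ℤ                              ≡⟨ ℤ.+-identityʳ _ ⟩
    S (suc N) f                                   ≡⟨ S-stable b 1 ⟩
    S N f                                         ≡⟨ p ⟩
    s                                             ∎
    where open ≡-Reasoning

⟶-shift : ∀ c {f s} → f ⟶ s → (λ x → f (c + x)) ⟶ s
⟶-shift (+ n) {f} q = shift⁺ n q
  where
  shift⁺ : ∀ n {f s} → f ⟶ s → (λ x → f (+ n + x)) ⟶ s
  shift⁺ zero    {f} q = ⟶-cong (λ x → cong f (sym (ℤ.+-identityˡ x))) q
  shift⁺ (suc n) {f} q = ⟶-cong (λ x → cong f (lemma n x)) (shift⁺ n (⟶-suc q))
    where
    lemma : ∀ n x → 1ℤ + (+ n + x) ≡ + suc n + x
    lemma n x = sym (ℤ.+-assoc 1ℤ (+ n) x)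
⟶-shift -[1+ n ] {f} q =
  ⟶-cong (λ x → cong f (lemma (+ suc n) x)) (⟶-neg (⟶-shift (+ suc n) (⟶-neg q)))
  where
  lemma : ∀ m x → - (m + - x) ≡ - m + x
  lemma = solve-∀

-- The radius M (d + 1) for g contains precisely the multiples (d + 1) k with |k| ≤ M, and g
-- vanishes at the points in between.
⟶-dilate : ∀ d {g s} → g ⟶ s → (∀ u → g u ≡ 0ℤ ⊎ ∃ λ k → u ≡ + suc d * k) →
  (λ k → g (+ suc d * k)) ⟶ s
⟶-dilate d {g} {s} (N , b , p) off = N , b′ , trans (sym (blocks N)) (trans (S-stable-≤ b (ℕ.m≤m*n N (suc d))) p)
  where
  b′ : Bounded N (λ k → g (+ suc d * k))
  b′ k l = b (+ suc d * k) (ℕ.<-≤-trans l (subst (∣ k ∣ ≤_) (sym (ℤ.abs-* (+ suc d) k)) (ℕ.m≤n*m ∣ k ∣ (suc d))))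
  residue : ∀ m j → suc j < suc d → ∀ u → ∣ u ∣ ≡ suc j ℕ.+ m ℕ.* suc d → g u ≡ 0ℤ
  residue m j j<d u abs with off u
  ... | inj₁ z = z
  ... | inj₂ (k , refl) = contradiction j≡0 λ ()
    where
    open ≡-Reasoning
    j≡0 : suc j ≡ 0
    j≡0 = begin
      suc j                          ≡⟨ sym (m<n⇒m%n≡m j<d) ⟩
      suc j % suc d                  ≡⟨ sym ([m+kn]%n≡m%n (suc j) m (suc d)) ⟩
      (suc j ℕ.+ m ℕ.* suc d) % suc d ≡⟨ cong (_% suc d) (sym abs) ⟩
      ∣ + suc d * k ∣ % suc d        ≡⟨ cong (_% suc d) (trans (ℤ.abs-* (+ suc d) k) (ℕ.*-comm (suc d) ∣ k ∣)) ⟩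
      (∣ k ∣ ℕ.* suc d) % suc d      ≡⟨ m*n%n≡0 ∣ k ∣ (suc d) ⟩
      0                              ∎
  gap : ∀ m j → j ≤ d → S (j ℕ.+ m ℕ.* suc d) g ≡ S (m ℕ.* suc d) g
  gap m zero    _   = refl
  gap m (suc j) j<d = trans
    (cong₂ _+_ (gap m j (ℕ.<⇒≤ j<d))
      (cong₂ _+_ (residue m j (s≤s j<d) _ refl) (residue m j (s≤s j<d) _ refl)))
    (ℤ.+-identityʳ _)
  blocks : ∀ M → S (M ℕ.* suc d) g ≡ S M (λ k → g (+ suc d * k))
  blocks zero    = cong g (sym (ℤ.*-zeroʳ (+ suc d)))
  blocks (suc M) = cong₂ _+_ (trans (gap M d ℕ.≤-refl) (blocks M))
    (cong₂ (λ x y → g x + g y) (trans (cong +_ (ℕ.*-comm (suc M) (suc d))) (ℤ.pos-* (suc d) (suc M)))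
      (cong -[1+_] (ℕ.suc-injective (ℕ.*-comm (suc M) (suc d)))))

⟶-progression : ∀ d c {f s} → f ⟶ s → (∀ u → f u ≡ 0ℤ ⊎ ∃ λ k → u ≡ c - + suc d * k) →
  (λ y → f (c - + suc d * y)) ⟶ s
⟶-progression d c {f} q off =
  ⟶-cong (λ y → cong f (lemma c (+ suc d) y)) (⟶-neg (⟶-dilate d (⟶-shift c q) off′))
  where
  lemma : ∀ c d y → c + d * (- y) ≡ c - d * y
  lemma = solve-∀
  off′ : ∀ u → f (c + u) ≡ 0ℤ ⊎ ∃ λ k → u ≡ + suc d * k
  off′ u = map₂ (λ { (k , p) → - k , trans (solved c u) (trans (cong (_- c) p) (cancel c (+ suc d) k)) }) (off (c + u))
    where
    solved : ∀ c u → u ≡ c + u - c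
    solved = solve-∀
    cancel : ∀ c d k → c - d * k - c ≡ d * - k
    cancel = solve-∀

⟶-elim : ∀ {P : Set} {f s} → (∀ x → f x ≡ 0ℤ ⊎ P) → f ⟶ s → s ≡ 0ℤ ⊎ P
⟶-elim {P} {f} h (N , _ , refl) = go N
  where
  go : ∀ N → S N f ≡ 0ℤ ⊎ P
  go zero    = h 0ℤ
  go (suc N) with go N | h (+ suc N) | h -[1+ N ]
  ... | inj₂ x | _      | _      = inj₂ x
  ... | inj₁ _ | inj₂ x | _      = inj₂ x
  ... | inj₁ _ | inj₁ _ | inj₂ x = inj₂ x
  ... | inj₁ a | inj₁ b | inj₁ c = inj₁ (cong₂ _+_ a (cong₂ _+_ b c))

-- Theta series and rotations of ℤ²

q^_ : ℕ → Series
(q^ zero)  zero    = 1ℤ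
(q^ zero)  (suc n) = 0ℤ
(q^ suc a) zero    = 0ℤ
(q^ suc a) (suc n) = (q^ a) n

q^-support : ∀ a n → (q^ a) n ≡ 0ℤ ⊎ a ≡ n
q^-support zero    zero    = inj₂ refl
q^-support zero    (suc n) = inj₁ refl
q^-support (suc a) zero    = inj₁ refl
q^-support (suc a) (suc n) = map₂ (cong suc) (q^-support a n)

stretch-q^ : ∀ e r a → stretch e r (q^ a) ≈ q^ (r ℕ.+ a ℕ.* suc e)
stretch-q^ e zero    zero    zero    = refl
stretch-q^ e zero    (suc a) zero    = refl
stretch-q^ e zero    zero    (suc n) = trans (stretch-cong e e (λ k → sym (κ0 k)) n) (vanish e n)
  where
  vanish : ∀ r n → stretch e r (κ 0ℤ) n ≡ 0ℤ
  vanish zero    n       = trans (V-κ e 0ℤ n) (κ0 n)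
  vanish (suc r) zero    = refl
  vanish (suc r) (suc n) = vanish r n
stretch-q^ e zero    (suc a) (suc n) = stretch-q^ e e a n
stretch-q^ e (suc r) a       zero    = refl
stretch-q^ e (suc r) a       (suc n) = stretch-q^ e r a n

infix 9 _q^_
_q^_ : ℤ → ℕ → Series
(k q^ a) n = k * (q^ a) n

V-q^ : ∀ e k a → V e (k q^ a) ≈ k q^ (a ℕ.* suc e)
V-q^ e k a n =
  trans (V-cong e (λ j → sym (ℤ.+-identityʳ (k * (q^ a) j))) n)
    (trans (stretch-linear e 0 k (q^ a) (λ _ → 0ℤ) n)
      (trans (cong₂ (λ x y → k * x + y) (stretch-q^ e 0 a n)
               (trans (V-cong e (λ j → sym (κ0 j)) n) (trans (V-κ e 0ℤ n) (κ0 n))))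
        (ℤ.+-identityʳ (k * (q^ (a ℕ.* suc e)) n))))

q^-· : ∀ k l a b → (k q^ a) · (l q^ b) ≈ (k * l) q^ (a ℕ.+ b)
q^-· k l zero b n =
  trans (·-congʳ (l q^ b) k≈ n)
    (trans (κ-· k (l q^ b) n) (sym (ℤ.*-assoc k l ((q^ b) n))))
  where
  k≈ : k q^ 0 ≈ κ k
  k≈ zero    = ℤ.*-identityʳ k
  k≈ (suc _) = ℤ.*-zeroʳ k
q^-· k l (suc a) b zero =
  trans (·-zero (k q^ suc a) (l q^ b))
    (trans (cong (_* (l * (q^ b) 0)) (ℤ.*-zeroʳ k)) (sym (ℤ.*-zeroʳ (k * l))))
q^-· k l (suc a) b (suc n) =
  trans (·-suc (k q^ suc a) (l q^ b) n)
    (trans (cong (λ z → z * (l * (q^ b) (suc n)) + ((k q^ a) · (l q^ b)) n) (ℤ.*-zeroʳ k))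
      (trans (ℤ.+-identityˡ _) (q^-· k l a b n)))

infix 4 _⇒_ _⇛_

_⇒_ : (ℤ → Series) → Series → Set
φ ⇒ f = ∀ n → (λ x → φ x n) ⟶ f n

_⇛_ : (ℤ → ℤ → Series) → Series → Set
Φ ⇛ f = ∃ λ h → (∀ x → Φ x ⇒ h x) × h ⇒ f

⇒-cong : ∀ {φ χ f} → (∀ x → φ x ≈ χ x) → φ ⇒ f → χ ⇒ f
⇒-cong e s n = ⟶-cong (λ x → e x n) (s n)

⇛-cong : ∀ {Φ Χ f} → (∀ x y → Φ x y ≈ Χ x y) → Φ ⇛ f → Χ ⇛ f
⇛-cong e (h , s , t) = h , (λ x → ⇒-cong (e x) (s x)) , t

⇛-map : ∀ {Φ Χ f} → (∀ x n {s} → (λ y → Φ x y n) ⟶ s → (λ y → Χ x y n) ⟶ s) → Φ ⇛ f → Χ ⇛ f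
⇛-map m (h , s , t) = h , (λ x n → m x n (s x n)) , t

⇒-linear : ∀ c {φ χ f g} → φ ⇒ f → χ ⇒ g →
  (λ x n → c * φ x n + χ x n) ⇒ (λ n → c * f n + g n)
⇒-linear c s t n = ⟶-linear c (s n) (t n)

⇛-linear : ∀ c {Φ Χ f g} → Φ ⇛ f → Χ ⇛ g →
  (λ x y n → c * Φ x y n + Χ x y n) ⇛ (λ n → c * f n + g n)
⇛-linear c (h , s , t) (h′ , s′ , t′) = _ , (λ x → ⇒-linear c (s x) (s′ x)) , ⇒-linear c t t′

⇒-stretch : ∀ e r {φ f} → φ ⇒ f → (λ x → stretch e r (φ x)) ⇒ stretch e r f
⇒-stretch e zero    s zero    = s 0
⇒-stretch e zero    s (suc n) = ⇒-stretch e e (λ k → s (suc k)) n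
⇒-stretch e (suc r) s zero    = ⟶-0
⇒-stretch e (suc r) s (suc n) = ⇒-stretch e r s n

⇛-V : ∀ e {Φ f} → Φ ⇛ f → (λ x y → V e (Φ x y)) ⇛ V e f
⇛-V e (h , s , t) = _ , (λ x → ⇒-stretch e 0 (s x)) , ⇒-stretch e 0 t

⟶-scale : ∀ c {f s} → f ⟶ s → (λ x → c * f x) ⟶ c * s
⟶-scale c {f} {s} q =
  subst ((λ x → c * f x) ⟶_) (ℤ.+-identityʳ (c * s))
    (⟶-cong (λ x → ℤ.+-identityʳ (c * f x)) (⟶-linear c q ⟶-0))

⇒-·ˡ : ∀ a {φ f} → φ ⇒ f → (λ x → a · φ x) ⇒ a · f
⇒-·ˡ a {φ} {f} s zero =
  subst (_ ⟶_) (sym (·-zero a f))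
    (⟶-cong (λ x → sym (·-zero a (φ x))) (⟶-scale (a 0) (s 0)))
⇒-·ˡ a {φ} {f} s (suc n) =
  subst (_ ⟶_) (sym (·-suc a f n))
    (⟶-cong (λ x → sym (·-suc a (φ x) n))
      (⟶-linear (a 0) (s (suc n)) (⇒-·ˡ (tail a) s n)))

⇒-·ʳ : ∀ a {φ f} → φ ⇒ f → (λ x → φ x · a) ⇒ f · a
⇒-·ʳ a {φ} {f} s n =
  subst (_ ⟶_) (·-comm a f n) (⟶-cong (λ x → ·-comm a (φ x) n) (⇒-·ˡ a s n))

-- Only pairs in the square of radius n meet the coefficient of qⁿ. This turns an iterated sum into
-- a finite double sum, whose order can be exchanged.
Confined : (ℤ → ℤ → Series) → Set
Confined Φ = ∀ n x y → n < ∣ x ∣ ⊎ n < ∣ y ∣ → Φ x y n ≡ 0ℤ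

⇛-flip : ∀ {Φ f} → Confined Φ → Φ ⇛ f → (λ y x → Φ x y) ⇛ f
⇛-flip {Φ} {f} b (h , s , t) =
  (λ y n → S n (λ x → Φ x y n))
  , (λ y n → n , (λ x l → b n x y (inj₁ l)) , refl)
  , λ n → n , (λ y l → trans (S-cong n (λ x → b n x y (inj₂ l))) (S-0 n)) , value n
  where
  h≡ : ∀ n x → S n (λ y → Φ x y n) ≡ h x n
  h≡ n x = ⟶-at (λ y l → b n x y (inj₂ l)) (s x n)
  value : ∀ n → S n (λ y → S n (λ x → Φ x y n)) ≡ f n
  value n = begin
    S n (λ y → S n (λ x → Φ x y n))  ≡⟨ S-swap n n (λ y x → Φ x y n) ⟩
    S n (λ x → S n (λ y → Φ x y n))  ≡⟨ S-cong n (h≡ n) ⟩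
    S n (λ x → h x n)                ≡⟨ ⟶-at (λ x l → trans (sym (h≡ n x)) (trans (S-cong n (λ y → b n x y (inj₁ l))) (S-0 n))) (t n) ⟩
    f n                              ∎
    where open ≡-Reasoning

⇛-unique : ∀ {Φ f g} → Confined Φ → Φ ⇛ f → Φ ⇛ g → f ≈ g
⇛-unique {Φ} b r r′ n = trans (sym (value r)) (value r′)
  where
  value : ∀ {f} → Φ ⇛ f → S n (λ x → S n (λ y → Φ x y n)) ≡ f n
  value (h , s , t) =
    trans (S-cong n h≡) (⟶-at (λ x l → trans (sym (h≡ x)) (trans (S-cong n (λ y → b n x y (inj₁ l))) (S-0 n))) (t n))
    where
    h≡ : ∀ x → S n (λ y → Φ x y n) ≡ h x n
    h≡ x = ⟶-at (λ y l → b n x y (inj₂ l)) (s x n)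

sq : ℤ → ℕ
sq x = ∣ x ∣ ℕ.* ∣ x ∣

+sq : ∀ x → + sq x ≡ x * x
+sq (+ n)    = ℤ.pos-* n n
+sq -[1+ n ] = refl

∣x∣≤sq : ∀ x → ∣ x ∣ ≤ sq x
∣x∣≤sq x with ∣ x ∣
... | zero  = z≤n
... | suc n = ℕ.m≤m*n (suc n) (suc n)

record θ₁ (c : ℕ) (g : ℤ → ℤ) (f : Series) : Set where
  constructor mk₁
  field sum₁ : (λ x → g x q^ (c ℕ.* sq x)) ⇒ f

record θ₂ (c : ℕ) (K : ℤ → ℤ → ℤ) (f : Series) : Set where
  constructor mk₂
  field sum₂ : (λ x y → K x y q^ (c ℕ.* (sq x ℕ.+ sq y))) ⇛ f

open θ₁
open θ₂

θ₂-· : ∀ {c g h f f′} → θ₁ c g f → θ₁ c h f′ → θ₂ c (λ x y → g x * h y) (f · f′)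
θ₂-· {c} {g} {h} {f} {f′} s t = mk₂
  (⇛-cong (λ x y n → trans (q^-· (g x) (h y) (c ℕ.* sq x) (c ℕ.* sq y) n)
                       (cong (λ a → g x * h y * (q^ a) n) (sym (ℕ.*-distribˡ-+ c (sq x) (sq y)))))
    (_ , (λ x → ⇒-·ˡ (g x q^ (c ℕ.* sq x)) (sum₁ t)) , ⇒-·ʳ f′ (sum₁ s)))

θ₂-cong : ∀ {c K L f} → (∀ x y → K x y ≡ L x y) → θ₂ c K f → θ₂ c L f
θ₂-cong {c} e s = mk₂ (⇛-cong (λ x y n → cong (_* (q^ (c ℕ.* (sq x ℕ.+ sq y))) n) (e x y)) (sum₂ s))

θ₂-V : ∀ e {c K f} → θ₂ c K f → θ₂ (c ℕ.* suc e) K (V e f)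
θ₂-V e {c} {K} s = mk₂
  (⇛-cong (λ x y n → trans (V-q^ e (K x y) (c ℕ.* (sq x ℕ.+ sq y)) n)
                       (cong (λ a → K x y * (q^ a) n) (swap c (sq x ℕ.+ sq y) (suc e))))
    (⇛-V e (sum₂ s)))
  where
  swap : ∀ a b c → a ℕ.* b ℕ.* c ≡ a ℕ.* c ℕ.* b
  swap = solveℕ-∀

θ₂-linear : ∀ k {c K L f g} → θ₂ c K f → θ₂ c L g →
  θ₂ c (λ x y → k * K x y + L x y) (λ n → k * f n + g n)
θ₂-linear k {c} {K} {L} s t = mk₂
  (⇛-cong (λ x y n → lemma k (K x y) (L x y) ((q^ (c ℕ.* (sq x ℕ.+ sq y))) n)) (⇛-linear k (sum₂ s) (sum₂ t)))
  where
  lemma : ∀ k a b z → k * (a * z) + b * z ≡ (k * a + b) * z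
  lemma = solve-∀

q^-confined : ∀ (K : ℤ → ℤ → ℤ) (a : ℤ → ℤ → ℕ) →
  (∀ x y → ∣ x ∣ ≤ a x y) → (∀ x y → ∣ y ∣ ≤ a x y) → Confined (λ x y → K x y q^ a x y)
q^-confined K a p p′ n x y far with q^-support (a x y) n
... | inj₁ z = trans (cong (K x y *_) z) (ℤ.*-zeroʳ (K x y))
... | inj₂ refl with far
...   | inj₁ l = contradiction (p x y) (ℕ.<⇒≱ l)
...   | inj₂ l = contradiction (p′ x y) (ℕ.<⇒≱ l)

θ₂-confined : ∀ c K → Confined (λ x y → K x y q^ (suc c ℕ.* (sq x ℕ.+ sq y)))
θ₂-confined c K = q^-confined K (λ x y → suc c ℕ.* (sq x ℕ.+ sq y))
  (λ x y → ℕ.≤-trans (∣x∣≤sq x) (ℕ.≤-trans (ℕ.m≤m+n (sq x) (sq y)) (ℕ.m≤n*m _ (suc c))))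
  (λ x y → ℕ.≤-trans (∣x∣≤sq y) (ℕ.≤-trans (ℕ.m≤n+m (sq y) (sq x)) (ℕ.m≤n*m _ (suc c))))

θ₂-unique : ∀ {c K f g} → θ₂ (suc c) K f → θ₂ (suc c) K g → f ≈ g
θ₂-unique {c} {K} s t = ⇛-unique (θ₂-confined c K) (sum₂ s) (sum₂ t)

θ₂-flip : ∀ {c K f} → θ₂ (suc c) K f → θ₂ (suc c) (λ x y → K y x) f
θ₂-flip {c} {K} s = mk₂
  (⇛-cong (λ x y n → cong (λ a → K y x * (q^ (suc c ℕ.* a)) n) (ℕ.+-comm (sq y) (sq x)))
    (⇛-flip (θ₂-confined c K) (sum₂ s)))

θ₂-negʳ : ∀ {c K f} → θ₂ c K f → θ₂ c (λ x y → K x (- y)) f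
θ₂-negʳ {c} {K} (mk₂ (h , s , t)) = mk₂
  (⇛-cong (λ x y n → cong (λ a → K x (- y) * (q^ (c ℕ.* (sq x ℕ.+ a ℕ.* a))) n) (ℤ.∣-i∣≡∣i∣ y))
    (h , (λ x n → ⟶-neg (s x n)) , t))

-- The substitution (u , v) = (e x - y , x + e y) maps ℤ² bijectively onto
-- { (u , v) : e² + 1 divides u - e v } and multiplies the norm by e² + 1.
θ₂-rotate : ∀ e {K f} → (∀ u v → K u v ≡ 0ℤ ⊎ ∃ λ k → u ≡ + e * v - + suc (e ℕ.* e) * k) →
  θ₂ 1 K f → θ₂ (suc (e ℕ.* e)) (λ x y → K (+ e * x - y) (x + + e * y)) f
θ₂-rotate e {K} {f} off s = mk₂ (⇛-flip (λ n y x far → θ₂-confined (e ℕ.* e) (λ x y → K (+ e * x - y) (x + + e * y)) n x y (swap far)) inner)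
  where
  swap : ∀ {A B : Set} → A ⊎ B → B ⊎ A
  swap = [ inj₂ , inj₁ ]′
  d : ℕ
  d = suc (e ℕ.* e)
  +d : + d ≡ 1ℤ + + e * + e
  +d = cong (λ z → 1ℤ + z) (ℤ.pos-* e e)
  norm : ∀ v y → sq (+ e * v - + d * y) ℕ.+ sq v ≡ d ℕ.* (sq (v - + e * y) ℕ.+ sq y)
  norm v y = ℤ.+-injective (begin
    + (sq u ℕ.+ sq v)                                  ≡⟨ ℤ.pos-+ (sq u) (sq v) ⟩
    + sq u + + sq v                                    ≡⟨ cong₂ _+_ (+sq u) (+sq v) ⟩
    u * u + v * v                                      ≡⟨ cong (λ z → (+ e * v - z * y) * (+ e * v - z * y) + v * v) +d ⟩
    (+ e * v - (1ℤ + + e * + e) * y) * (+ e * v - (1ℤ + + e * + e) * y) + v * v ≡⟨ lemma (+ e) v y ⟩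
    (1ℤ + + e * + e) * (w * w + y * y)                 ≡⟨ cong₂ _*_ (sym +d) (cong₂ _+_ (sym (+sq w)) (sym (+sq y))) ⟩
    + d * (+ sq w + + sq y)                            ≡⟨ cong (+ d *_) (sym (ℤ.pos-+ (sq w) (sq y))) ⟩
    + d * + (sq w ℕ.+ sq y)                            ≡⟨ sym (ℤ.pos-* d (sq w ℕ.+ sq y)) ⟩
    + (d ℕ.* (sq w ℕ.+ sq y))                          ∎)
    where
    open ≡-Reasoning
    u = + e * v - + d * y
    w = v - + e * y
    lemma : ∀ e v y → (e * v - (1ℤ + e * e) * y) * (e * v - (1ℤ + e * e) * y) + v * v
                      ≡ (1ℤ + e * e) * ((v - e * y) * (v - e * y) + y * y)
    lemma = solve-∀
  -- The bijection is split into two changes of one variable: for fixed v the admissible u form the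
  -- progression e v - d y, and for fixed y the shift v = x + e y follows. The order of summation is
  -- exchanged in between.
  columns : (λ v y → K (+ e * v - + d * y) v q^ (d ℕ.* (sq (v - + e * y) ℕ.+ sq y))) ⇛ f
  columns = ⇛-map
    (λ v n q → ⟶-cong (λ y → cong (λ a → K (+ e * v - + d * y) v * (q^ a) n) (trans (ℕ.+-identityʳ _) (norm v y)))
                 (⟶-progression (e ℕ.* e) (+ e * v) q
                   (λ u → map₁ (cong (_* (q^ (1 ℕ.* (sq u ℕ.+ sq v))) n)) (off u v))))
    (⇛-flip (θ₂-confined 0 K) (sum₂ s))
  columns-confined : Confined (λ v y → K (+ e * v - + d * y) v q^ (d ℕ.* (sq (v - + e * y) ℕ.+ sq y)))
  columns-confined = q^-confined (λ v y → K (+ e * v - + d * y) v) (λ v y → d ℕ.* (sq (v - + e * y) ℕ.+ sq y))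
    (λ v y → subst (∣ v ∣ ≤_) (norm v y) (ℕ.≤-trans (∣x∣≤sq v) (ℕ.m≤n+m (sq v) _)))
    (λ v y → ℕ.≤-trans (∣x∣≤sq y) (ℕ.≤-trans (ℕ.m≤n+m (sq y) (sq (v - + e * y))) (ℕ.m≤n*m _ d)))
  inner : (λ y x → K (+ e * x - y) (x + + e * y) q^ (d ℕ.* (sq x ℕ.+ sq y))) ⇛ f
  inner = ⇛-map
    (λ y n q → ⟶-cong (λ x → cong₂ (λ (p : ℤ × ℤ) w → K (proj₁ p) (proj₂ p) * (q^ (d ℕ.* (sq w ℕ.+ sq y))) n)
                   (cong₂ _,_ (trans (cong (λ z → + e * (+ e * y + x) - z * y) +d) (lemma₁ (+ e) x y)) (ℤ.+-comm (+ e * y) x))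
                   (lemma₂ (+ e) x y))
                 (⟶-shift (+ e * y) q))
    (⇛-flip columns-confined columns)
    where
    lemma₁ : ∀ e x y → e * (e * y + x) - (1ℤ + e * e) * y ≡ e * x - y
    lemma₁ = solve-∀
    lemma₂ : ∀ e x y → e * y + x - e * y ≡ x
    lemma₂ = solve-∀

θ₁-dilate : ∀ d {c g f} → (∀ x → g x ≡ 0ℤ ⊎ ∃ λ k → x ≡ + suc d * k) →
  θ₁ c g f → θ₁ (c ℕ.* (suc d ℕ.* suc d)) (λ k → g (+ suc d * k)) f
θ₁-dilate d {c} {g} off (mk₁ s) = mk₁ λ n →
  ⟶-cong (λ k → cong (λ a → g (+ suc d * k) * (q^ a) n) (norm k))
    (⟶-dilate d (s n) (λ x → map₁ (cong (_* (q^ (c ℕ.* sq x)) n)) (off x)))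
  where
  lemma : ∀ c d k → c ℕ.* (d ℕ.* k ℕ.* (d ℕ.* k)) ≡ c ℕ.* (d ℕ.* d) ℕ.* (k ℕ.* k)
  lemma = solveℕ-∀
  norm : ∀ k → c ℕ.* sq (+ suc d * k) ≡ c ℕ.* (suc d ℕ.* suc d) ℕ.* sq k
  norm k = trans (cong (λ a → c ℕ.* (a ℕ.* a)) (ℤ.abs-* (+ suc d) k)) (lemma c (suc d) ∣ k ∣)

-- Weights that depend on residues modulo 10

res : ℤ → Fin 10
res (+ n)    = n mod 10
res -[1+ n ] = (9 ℕ.* suc n) mod 10

mod-cong : ∀ m n → m % 10 ≡ n % 10 → m mod 10 ≡ n mod 10
mod-cong m n p = Fin.toℕ-injective
  (trans (Fin.toℕ-fromℕ< (m%n<n m 10)) (trans p (sym (Fin.toℕ-fromℕ< (m%n<n n 10)))))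

toℕ-mod : ∀ m → toℕ (m mod 10) ≡ m % 10
toℕ-mod m = Fin.toℕ-fromℕ< (m%n<n m 10)

res-quotient : ∀ x → ∃ λ k → x ≡ + toℕ (res x) + + 10 * k
res-quotient (+ n) = + (n / 10) , (begin
  + n                                    ≡⟨ cong +_ (m≡m%n+[m/n]*n n 10) ⟩
  + (n % 10 ℕ.+ n / 10 ℕ.* 10)           ≡⟨ ℤ.pos-+ (n % 10) _ ⟩
  + (n % 10) + + (n / 10 ℕ.* 10)         ≡⟨ cong₂ (λ r s → + r + s) (sym (toℕ-mod n)) (trans (cong +_ (ℕ.*-comm (n / 10) 10)) (ℤ.pos-* 10 (n / 10))) ⟩
  + toℕ (n mod 10) + + 10 * + (n / 10)   ∎)
  where open ≡-Reasoning
res-quotient -[1+ n ] = + (m / 10) - + suc n , (begin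
  - (+ suc n)                                          ≡⟨ lemma (+ suc n) ⟩
  + 9 * + suc n - + 10 * + suc n                       ≡⟨ cong (_- + 10 * + suc n) (sym (ℤ.pos-* 9 (suc n))) ⟩
  + m - + 10 * + suc n                                 ≡⟨ cong (_- + 10 * + suc n) (proj₂ (res-quotient (+ m))) ⟩
  + toℕ (m mod 10) + + 10 * + (m / 10) - + 10 * + suc n ≡⟨ lemma′ (+ toℕ (m mod 10)) (+ (m / 10)) (+ suc n) ⟩
  + toℕ (m mod 10) + + 10 * (+ (m / 10) - + suc n)     ∎)
  where
  open ≡-Reasoning
  m = 9 ℕ.* suc n
  lemma : ∀ x → - x ≡ + 9 * x - + 10 * x
  lemma = solve-∀
  lemma′ : ∀ r a b → r + + 10 * a - + 10 * b ≡ r + + 10 * (a - b)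
  lemma′ = solve-∀

res-⊖ : ∀ m n → res (m ⊖ n) ≡ (m ℕ.+ 9 ℕ.* n) mod 10
res-⊖ m n with ℕ.≤-total n m
... | inj₁ n≤m = trans (cong res (ℤ.⊖-≥ n≤m)) (mod-cong (m ∸ n) (m ℕ.+ 9 ℕ.* n) (begin
  (m ∸ n) % 10                     ≡⟨ sym ([m+kn]%n≡m%n (m ∸ n) n 10) ⟩
  (m ∸ n ℕ.+ n ℕ.* 10) % 10        ≡⟨ cong (_% 10) (lemma (m ∸ n) n) ⟩
  (m ∸ n ℕ.+ n ℕ.+ 9 ℕ.* n) % 10   ≡⟨ cong (λ z → (z ℕ.+ 9 ℕ.* n) % 10) (ℕ.m∸n+n≡m n≤m) ⟩
  (m ℕ.+ 9 ℕ.* n) % 10             ∎))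
  where
  open ≡-Reasoning
  lemma : ∀ a n → a ℕ.+ n ℕ.* 10 ≡ a ℕ.+ n ℕ.+ 9 ℕ.* n
  lemma = solveℕ-∀
... | inj₂ m≤n = trans (cong res (ℤ.⊖-≤ m≤n)) (trans (res-neg (n ∸ m)) (mod-cong (9 ℕ.* (n ∸ m)) (m ℕ.+ 9 ℕ.* n) (begin
  (9 ℕ.* (n ∸ m)) % 10                    ≡⟨ sym ([m+kn]%n≡m%n (9 ℕ.* (n ∸ m)) m 10) ⟩
  (9 ℕ.* (n ∸ m) ℕ.+ m ℕ.* 10) % 10       ≡⟨ cong (_% 10) (lemma (n ∸ m) m) ⟩
  (m ℕ.+ 9 ℕ.* (n ∸ m ℕ.+ m)) % 10        ≡⟨ cong (λ z → (m ℕ.+ 9 ℕ.* z) % 10) (ℕ.m∸n+n≡m m≤n) ⟩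
  (m ℕ.+ 9 ℕ.* n) % 10                    ∎)))
  where
  open ≡-Reasoning
  lemma : ∀ a m → 9 ℕ.* a ℕ.+ m ℕ.* 10 ≡ m ℕ.+ 9 ℕ.* (a ℕ.+ m)
  lemma = solveℕ-∀
  res-neg : ∀ n → res (- (+ n)) ≡ (9 ℕ.* n) mod 10
  res-neg zero    = refl
  res-neg (suc n) = refl

res-unique : ∀ m k → res (+ m + + 10 * k) ≡ m mod 10
res-unique m (+ j) =
  trans (cong (λ z → res (+ m + z)) (trans (sym (ℤ.pos-* 10 j)) (cong +_ (ℕ.*-comm 10 j))))
        (mod-cong (m ℕ.+ j ℕ.* 10) m ([m+kn]%n≡m%n m j 10))
res-unique m -[1+ j ] = trans (res-⊖ m (10 ℕ.* suc j))
  (mod-cong (m ℕ.+ 9 ℕ.* (10 ℕ.* suc j)) m (trans (cong (λ z → (m ℕ.+ z) % 10) (lemma j)) ([m+kn]%n≡m%n m (9 ℕ.* suc j) 10)))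
  where
  lemma : ∀ j → 9 ℕ.* (10 ℕ.* suc j) ≡ 9 ℕ.* suc j ℕ.* 10
  lemma = solveℕ-∀

-- 9 stands for -1 modulo 10.
rot₁ rot₂ : ℕ → Fin 10 → Fin 10 → Fin 10
rot₁ e i j = (e ℕ.* toℕ i ℕ.+ 9 ℕ.* toℕ j) mod 10
rot₂ e i j = (toℕ i ℕ.+ e ℕ.* toℕ j) mod 10

res-rot₁ : ∀ e x y → res (+ e * x - y) ≡ rot₁ e (res x) (res y)
res-rot₁ e x y with res-quotient x | res-quotient y
... | a , p | b , p′ = trans (cong res (begin
  + e * x - y                          ≡⟨ cong₂ (λ u v → + e * u - v) p p′ ⟩
  + e * (+ r + + 10 * a) - (+ s + + 10 * b) ≡⟨ lemma (+ e) (+ r) (+ s) a b ⟩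
  (+ e * + r + + 9 * + s) + + 10 * (+ e * a - + s - b)
    ≡⟨ cong (_+ + 10 * (+ e * a - + s - b)) (trans (cong₂ _+_ (sym (ℤ.pos-* e r)) (sym (ℤ.pos-* 9 s))) (sym (ℤ.pos-+ (e ℕ.* r) (9 ℕ.* s)))) ⟩
  + (e ℕ.* r ℕ.+ 9 ℕ.* s) + + 10 * (+ e * a - + s - b) ∎))
  (res-unique (e ℕ.* r ℕ.+ 9 ℕ.* s) (+ e * a - + s - b))
  where
  open ≡-Reasoning
  r = toℕ (res x)
  s = toℕ (res y)
  lemma : ∀ e r s a b → e * (r + + 10 * a) - (s + + 10 * b) ≡ (e * r + + 9 * s) + + 10 * (e * a - s - b)
  lemma = solve-∀

res-rot₂ : ∀ e x y → res (x + + e * y) ≡ rot₂ e (res x) (res y)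
res-rot₂ e x y with res-quotient x | res-quotient y
... | a , p | b , p′ = trans (cong res (begin
  x + + e * y                          ≡⟨ cong₂ (λ u v → u + + e * v) p p′ ⟩
  (+ r + + 10 * a) + + e * (+ s + + 10 * b) ≡⟨ lemma (+ e) (+ r) (+ s) a b ⟩
  (+ r + + e * + s) + + 10 * (a + + e * b)
    ≡⟨ cong (_+ + 10 * (a + + e * b)) (trans (cong (_+_ (+ r)) (sym (ℤ.pos-* e s))) (sym (ℤ.pos-+ r (e ℕ.* s)))) ⟩
  + (r ℕ.+ e ℕ.* s) + + 10 * (a + + e * b) ∎))
  (res-unique (r ℕ.+ e ℕ.* s) (a + + e * b))
  where
  open ≡-Reasoning
  r = toℕ (res x)
  s = toℕ (res y)
  lemma : ∀ e r s a b → (r + + 10 * a) + e * (s + + 10 * b) ≡ (r + e * s) + + 10 * (a + e * b)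
  lemma = solve-∀

res-* : ∀ d x → res (+ d * x) ≡ (d ℕ.* toℕ (res x)) mod 10
res-* d x with res-quotient x
... | a , p = trans (cong res (trans (cong (+ d *_) p)
    (trans (lemma (+ d) (+ toℕ (res x)) a) (cong (_+ + 10 * (+ d * a)) (sym (ℤ.pos-* d (toℕ (res x))))))))
  (res-unique (d ℕ.* toℕ (res x)) (+ d * a))
  where
  lemma : ∀ d r a → d * (r + + 10 * a) ≡ d * r + + 10 * (d * a)
  lemma = solve-∀

opposite : Fin 10 → Fin 10
opposite i = (9 ℕ.* toℕ i) mod 10

res-neg : ∀ x → res (- x) ≡ opposite (res x)
res-neg x with res-quotient x
... | a , p = trans (cong res (trans (cong -_ p)
    (trans (lemma (+ toℕ (res x)) a) (cong (_+ + 10 * (- + toℕ (res x) - a)) (sym (ℤ.pos-* 9 (toℕ (res x))))))))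
  (res-unique (9 ℕ.* toℕ (res x)) (- + toℕ (res x) - a))
  where
  lemma : ∀ r a → - (r + + 10 * a) ≡ + 9 * r + + 10 * (- r - a)
  lemma = solve-∀

q^-far : ∀ k n x → n < ∣ x ∣ → (k q^ (1 ℕ.* sq x)) n ≡ 0ℤ
q^-far k n x l with q^-support (1 ℕ.* sq x) n
... | inj₁ z    = trans (cong (k *_) z) (ℤ.*-zeroʳ k)
... | inj₂ refl = contradiction (ℕ.≤-trans (∣x∣≤sq x) (ℕ.m≤n*m (sq x) 1)) (ℕ.<⇒≱ l)

-- All weights below see only the parity of x and its class modulo 5, and the norms 2 and 5 of the
-- two rotations divide 10, so residues modulo 10 are enough. The radius n captures every term
-- because |x| ≤ x².
θ : (Fin 10 → ℤ) → Series
θ g n = S n (λ x → (g (res x) q^ (1 ℕ.* sq x)) n)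

θ-θ₁ : ∀ g → θ₁ 1 (g ∘ res) (θ g)
θ-θ₁ g = mk₁ λ n → n , (λ x → q^-far (g (res x)) n x) , refl

θθ : (Fin 10 → Fin 10 → ℤ) → Series
θθ K n = S n (λ x → S n (λ y → (K (res x) (res y) q^ (1 ℕ.* (sq x ℕ.+ sq y))) n))

_on-res : (Fin 10 → Fin 10 → ℤ) → ℤ → ℤ → ℤ
(K on-res) x y = K (res x) (res y)

θθ-θ₂ : ∀ K → θ₂ 1 (K on-res) (θθ K)
θθ-θ₂ K = mk₂
  ((λ x n → S n (λ y → (K (res x) (res y) q^ (1 ℕ.* (sq x ℕ.+ sq y))) n))
  , (λ x n → n , (λ y l → θ₂-confined 0 (K on-res) n x y (inj₂ l)) , refl)
  , λ n → n , (λ x l → trans (S-cong n (λ y → θ₂-confined 0 (K on-res) n x y (inj₁ l))) (S-0 n)) , refl)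

θ₁-unique : ∀ {c g f f′} → θ₁ c g f → θ₁ c g f′ → f ≈ f′
θ₁-unique (mk₁ s) (mk₁ t) n = ⟶-unique (s n) (t n)

θ₁-cong : ∀ {c g h f} → (∀ x → g x ≡ h x) → θ₁ c g f → θ₁ c h f
θ₁-cong {c} e (mk₁ s) = mk₁ λ n → ⟶-cong (λ x → cong (_* (q^ (c ℕ.* sq x)) n) (e x)) (s n)

θ₁-V : ∀ e {c g f} → θ₁ c g f → θ₁ (c ℕ.* suc e) g (V e f)
θ₁-V e {c} {g} (mk₁ s) = mk₁ λ n →
  ⟶-cong (λ x → trans (V-q^ e (g x) (c ℕ.* sq x) n) (cong (λ a → g x * (q^ a) n) (swap c (sq x) (suc e))))
    (⇒-stretch e 0 s n)
  where
  swap : ∀ a b c → a ℕ.* b ℕ.* c ≡ a ℕ.* c ℕ.* b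
  swap = solveℕ-∀

Multiple : ℕ → ℤ → ℕ → Set
Multiple d z m = z ≡ 0ℤ ⊎ m % suc d ≡ 0

multiple-quotient : ∀ d m → m % suc d ≡ 0 → + m ≡ + suc d * + (m / suc d)
multiple-quotient d m p = trans (cong +_ (trans (m≡m%n+[m/n]*n m (suc d))
  (trans (cong (ℕ._+ m / suc d ℕ.* suc d) p) (ℕ.*-comm (m / suc d) (suc d))))) (ℤ.pos-* (suc d) (m / suc d))

-- Writing x = (d + 1) k multiplies the exponent by (d + 1)², hence `V d` twice.
θ-dilate : ∀ d m → suc d ℕ.* m ≡ 10 → ∀ g h →
  (∀ i → Multiple d (g i) (toℕ i)) → (∀ i → g ((suc d ℕ.* toℕ i) mod 10) ≡ h i) →
  θ g ≈ V d (V d (θ h))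
θ-dilate d m d*m≡10 g h off e =
  θ₁-unique {1 ℕ.* (suc d ℕ.* suc d)}
    (θ₁-cong (λ k → trans (cong g (res-* (suc d) k)) (e (res k))) (θ₁-dilate d off′ (θ-θ₁ g)))
    (subst (λ c → θ₁ c (h ∘ res) (V d (V d (θ h)))) (lemma (suc d)) (θ₁-V d (θ₁-V d (θ-θ₁ h))))
  where
  lemma : ∀ d → 1 ℕ.* d ℕ.* d ≡ 1 ℕ.* (d ℕ.* d)
  lemma = solveℕ-∀
  off′ : ∀ x → g (res x) ≡ 0ℤ ⊎ ∃ λ k → x ≡ + suc d * k
  off′ x with off (res x) | res-quotient x
  ... | inj₁ z | _     = inj₁ z
  ... | inj₂ z | a , p = inj₂ (+ (toℕ (res x) / suc d) + + m * a , (begin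
    x                                                     ≡⟨ p ⟩
    + toℕ (res x) + + 10 * a
      ≡⟨ cong₂ (λ r t → r + t * a) (multiple-quotient d _ z) (trans (cong +_ (sym d*m≡10)) (ℤ.pos-* (suc d) m)) ⟩
    + suc d * + (toℕ (res x) / suc d) + + suc d * + m * a ≡⟨ factor (+ suc d) (+ (toℕ (res x) / suc d)) (+ m) a ⟩
    + suc d * (+ (toℕ (res x) / suc d) + + m * a)         ∎))
    where
    open ≡-Reasoning
    factor : ∀ d r m a → d * r + d * m * a ≡ d * (r + m * a)
    factor = solve-∀

-- Both swapping x and y and changing the sign of y preserve the norm x² + y².
symmetrise : (Fin 10 → Fin 10 → ℤ) → Fin 10 → Fin 10 → ℤ
symmetrise K i j = 1ℤ * K i j + (1ℤ * K j i + (1ℤ * K i (opposite j) + K j (opposite i)))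

θ₂-symmetrise : ∀ {c K f} → θ₂ (suc c) (K on-res) f →
  θ₂ (suc c) (symmetrise K on-res) (λ n → 1ℤ * f n + (1ℤ * f n + (1ℤ * f n + f n)))
θ₂-symmetrise {c} {K} {f} s =
  θ₂-linear 1ℤ s (θ₂-linear 1ℤ (θ₂-flip s) (θ₂-linear 1ℤ
    (θ₂-cong (λ x y → cong (K (res x)) (res-neg y)) (θ₂-negʳ {suc c} {K on-res} s))
    (θ₂-flip (θ₂-negʳ′ s))))
  where
  θ₂-negʳ′ : θ₂ (suc c) (K on-res) f → θ₂ (suc c) ((λ i j → K i (opposite j)) on-res) f
  θ₂-negʳ′ s = θ₂-cong (λ x y → cong (K (res x)) (res-neg y)) (θ₂-negʳ {suc c} {K on-res} s)

-- All four terms of `symmetrise` have the same theta series, so the symmetrised weight yields four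
-- times the original series, and 4 is cancelled. Weights can thus be compared up to these
-- symmetries of the norm.
θ₂-symmetric : ∀ K L {c f g} → (∀ i j → symmetrise K i j ≡ symmetrise L i j) →
  θ₂ (suc c) (K on-res) f → θ₂ (suc c) (L on-res) g → f ≈ g
θ₂-symmetric K L {c} {f} {g} e s t n =
  ℤ.*-cancelˡ-≡ (+ 4) (f n) (g n)
    (trans (lemma (f n)) (trans
      (θ₂-unique (θ₂-cong (λ x y → e (res x) (res y)) (θ₂-symmetrise {c} {K} s)) (θ₂-symmetrise {c} {L} t) n)
      (sym (lemma (g n)))))
  where
  lemma : ∀ x → + 4 * x ≡ 1ℤ * x + (1ℤ * x + (1ℤ * x + x))
  lemma = solve-∀

rotated : ℕ → (Fin 10 → Fin 10 → ℤ) → Fin 10 → Fin 10 → ℤ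
rotated e K i j = K (rot₁ e i j) (rot₂ e i j)

progression : ∀ e m → suc (e ℕ.* e) ℕ.* m ≡ 10 → ∀ (K : Fin 10 → Fin 10 → ℤ) →
  (∀ i j → Multiple (e ℕ.* e) (K i j) (e ℕ.* toℕ j ℕ.+ 9 ℕ.* toℕ i)) →
  ∀ u v → K (res u) (res v) ≡ 0ℤ ⊎ ∃ λ k → u ≡ + e * v - + suc (e ℕ.* e) * k
progression e m d*m≡10 K off u v with off (res u) (res v) | res-quotient u | res-quotient v
... | inj₁ z | _ | _ = inj₁ z
-- The summand -r of the witness compensates for 9 r standing in place of -r in the divisibility
-- condition.
... | inj₂ z | a , p | b , p′ = inj₂ (+ c + + m * (+ e * b - a - + r) , (begin
  u                                  ≡⟨ p ⟩
  + r + + 10 * a                     ≡⟨ lemma (+ e) (+ r) (+ s′) a b ⟩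
  + e * (+ s′ + + 10 * b) - ((+ e * + s′ + + 9 * + r) + + 10 * (+ e * b - a - + r))
    ≡⟨ cong₂ (λ w z → + e * w - (z + + 10 * (+ e * b - a - + r))) (sym p′)
         (trans (cong₂ _+_ (sym (ℤ.pos-* e s′)) (sym (ℤ.pos-* 9 r)))
           (trans (sym (ℤ.pos-+ (e ℕ.* s′) (9 ℕ.* r))) (multiple-quotient (e ℕ.* e) _ z))) ⟩
  + e * v - (+ d * + c + + 10 * (+ e * b - a - + r))
    ≡⟨ cong (λ w → + e * v - (+ d * + c + w * (+ e * b - a - + r))) (trans (cong +_ (sym d*m≡10)) (ℤ.pos-* d m)) ⟩
  + e * v - (+ d * + c + + d * + m * (+ e * b - a - + r))
    ≡⟨ factor (+ e * v) (+ d) (+ c) (+ m) (+ e * b - a - + r) ⟩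
  + e * v - + d * (+ c + + m * (+ e * b - a - + r)) ∎))
  where
  open ≡-Reasoning
  d : ℕ
  d = suc (e ℕ.* e)
  r = toℕ (res u)
  s′ = toℕ (res v)
  c = (e ℕ.* s′ ℕ.+ 9 ℕ.* r) / d
  lemma : ∀ e r s a b → r + + 10 * a ≡ e * (s + + 10 * b) - ((e * s + + 9 * r) + + 10 * (e * b - a - r))
  lemma = solve-∀
  factor : ∀ x d c m k → x - (d * c + d * m * k) ≡ x - d * (c + m * k)
  factor = solve-∀

θ₂-rotation : ∀ e m → suc (e ℕ.* e) ℕ.* m ≡ 10 → ∀ K L {f g} →
  (∀ i j → Multiple (e ℕ.* e) (K i j) (e ℕ.* toℕ j ℕ.+ 9 ℕ.* toℕ i)) →
  (∀ i j → symmetrise (rotated e K) i j ≡ symmetrise L i j) →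
  θ₂ 1 (K on-res) f → θ₂ 1 (L on-res) g → f ≈ V (e ℕ.* e) g
θ₂-rotation e m d*m≡10 K L {f} {g} off sy s t =
  θ₂-symmetric (rotated e K) L sy
    (θ₂-cong (λ x y → cong₂ K (res-rot₁ e x y) (res-rot₂ e x y)) (θ₂-rotate e (progression e m d*m≡10 K off) s))
    (subst (λ c → θ₂ c (L on-res) (V (e ℕ.* e) g)) (ℕ.*-identityˡ d) (θ₂-V (e ℕ.* e) t))
  where
  d : ℕ
  d = suc (e ℕ.* e)

multiple? : ∀ d z m → Dec (Multiple d z m)
multiple? d z m = (z ℤ.≟ 0ℤ) ⊎-dec (m % suc d ℕ.≟ 0)

multiples? : ∀ d (g : Fin 10 → ℤ) → Dec (∀ i → Multiple d (g i) (toℕ i))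
multiples? d g = Fin.all? {P = λ i → Multiple d (g i) (toℕ i)} (λ i → multiple? d (g i) (toℕ i))

multiples₂? : ∀ e (K : Fin 10 → Fin 10 → ℤ) → Dec (∀ i j → Multiple (e ℕ.* e) (K i j) (e ℕ.* toℕ j ℕ.+ 9 ℕ.* toℕ i))
multiples₂? e K = Fin.all? (λ i → Fin.all? (λ j → multiple? (e ℕ.* e) (K i j) (e ℕ.* toℕ j ℕ.+ 9 ℕ.* toℕ i)))

equal? : ∀ (g h : Fin 10 → ℤ) → Dec (∀ i → g i ≡ h i)
equal? g h = Fin.all? (λ i → g i ℤ.≟ h i)

equal₂? : ∀ (K L : Fin 10 → Fin 10 → ℤ) → Dec (∀ i j → K i j ≡ L i j)
equal₂? K L = Fin.all? (λ i → Fin.all? (λ j → K i j ℤ.≟ L i j))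

multiple! : ∀ d (g : Fin 10 → ℤ) → {True (multiples? d g)} → ∀ i → Multiple d (g i) (toℕ i)
multiple! d g {t} = toWitness {a? = multiples? d g} t

multiple₂! : ∀ e (K : Fin 10 → Fin 10 → ℤ) → {True (multiples₂? e K)} →
  ∀ i j → Multiple (e ℕ.* e) (K i j) (e ℕ.* toℕ j ℕ.+ 9 ℕ.* toℕ i)
multiple₂! e K {t} = toWitness {a? = multiples₂? e K} t

equal! : ∀ (g h : Fin 10 → ℤ) → {True (equal? g h)} → ∀ i → g i ≡ h i
equal! g h {t} = toWitness {a? = equal? g h} t

equal₂! : ∀ (K L : Fin 10 → Fin 10 → ℤ) → {True (equal₂? K L)} → ∀ i j → K i j ≡ L i j
equal₂! K L {t} = toWitness {a? = equal₂? K L} t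

-- Quadratic relations between theta series

everything odd even : Fin 10 → ℤ
everything _ = 1ℤ
odd  i = + (toℕ i % 2)
even i = 1ℤ - odd i

square : ℕ → Fin 10 → ℤ
square r i = if toℕ i ℕ.* toℕ i % 5 ℕ.≡ᵇ r then 1ℤ else 0ℤ

infixl 7 _⊓_
_⊓_ : (Fin 10 → ℤ) → (Fin 10 → ℤ) → Fin 10 → ℤ
(g ⊓ h) i = g i * h i

-- `F` is φ(q) and `O` is 2 q ψ(q⁸). The index 1 or 4 is the class of the exponent modulo 5; in the
-- notation of the 5-dissection, `T₁` is 2 q A(q⁴⁰) and `T₄` is 2 q⁹ B(q⁴⁰).
F O F₁ F₄ T₁ T₄ : Series
F  = θ everything
O  = θ odd
F₁ = θ (square 1)
F₄ = θ (square 4)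
T₁ = θ (odd ⊓ square 1)
T₄ = θ (odd ⊓ square 4)

V₂ V₄ V₅ V₈ : Series → Series
V₂ = V 1
V₄ f = V₂ (V₂ f)
V₅ = V 4
V₈ f = V₂ (V₄ f)

θ-even : θ even ≈ V₄ F
θ-even = θ-dilate 1 5 refl even everything
  (multiple! 1 even) (equal! (λ i → even ((suc 1 ℕ.* toℕ i) mod 10)) everything)

-- With x = 2k the condition x² ≡ 1 becomes k² ≡ 4 modulo 5, so the two classes trade places.
θ-even₁ : θ (even ⊓ square 1) ≈ V₄ F₄
θ-even₁ = θ-dilate 1 5 refl (even ⊓ square 1) (square 4)
  (multiple! 1 (even ⊓ square 1)) (equal! (λ i → (even ⊓ square 1) ((suc 1 ℕ.* toℕ i) mod 10)) (square 4))

θ-even₄ : θ (even ⊓ square 4) ≈ V₄ F₁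
θ-even₄ = θ-dilate 1 5 refl (even ⊓ square 4) (square 1)
  (multiple! 1 (even ⊓ square 4)) (equal! (λ i → (even ⊓ square 4) ((suc 1 ℕ.* toℕ i) mod 10)) (square 1))

θ-odd₀ : θ (odd ⊓ square 0) ≈ V₅ (V₅ O)
θ-odd₀ = θ-dilate 4 2 refl (odd ⊓ square 0) odd
  (multiple! 4 (odd ⊓ square 0)) (equal! (λ i → (odd ⊓ square 0) ((suc 4 ℕ.* toℕ i) mod 10)) odd)

θ-all₀ : θ (square 0) ≈ V₅ (V₅ F)
θ-all₀ = θ-dilate 4 2 refl (square 0) everything
  (multiple! 4 (square 0)) (equal! (λ i → (square 0) ((suc 4 ℕ.* toℕ i) mod 10)) everything)

infixl 7 _⊗_
_⊗_ : (Fin 10 → ℤ) → (Fin 10 → ℤ) → Fin 10 → Fin 10 → ℤ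
(g ⊗ h) i j = g i * h j

θ-· : ∀ g h → θ₂ 1 ((g ⊗ h) on-res) (θ g · θ h)
θ-· g h = θ₂-· (θ-θ₁ g) (θ-θ₁ h)

infixl 6 _⊞_
_⊞_ : (Fin 10 → Fin 10 → ℤ) → (Fin 10 → Fin 10 → ℤ) → Fin 10 → Fin 10 → ℤ
(K ⊞ L) i j = 1ℤ * K i j + L i j

θ₂-⊕ : ∀ K L {f g} → θ₂ 1 (K on-res) f → θ₂ 1 (L on-res) g → θ₂ 1 ((K ⊞ L) on-res) (f ⊕ g)
θ₂-⊕ K L {f} {g} s t = θ₂-≈ (λ n → cong (_+ g n) (ℤ.*-identityˡ (f n))) (θ₂-linear 1ℤ s t)
  where
  θ₂-≈ : ∀ {c K f g} → f ≈ g → θ₂ c K f → θ₂ c K g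
  θ₂-≈ p (mk₂ (h , s , t)) = mk₂ (h , s , λ n → subst (_ ⟶_) (p n) (t n))

-- Odd u and v are x - y and x + y for x and y of opposite parity; the two possible orders give the
-- two equal summands.
O²≈ : O · O ≈ V₂ (V₄ F · O ⊕ V₄ F · O)
O²≈ n = trans
  (θ₂-rotation 1 5 refl (odd ⊗ odd) ((even ⊗ odd) ⊞ (even ⊗ odd))
      (multiple₂! 1 (odd ⊗ odd)) (equal₂! (symmetrise (rotated 1 (odd ⊗ odd))) (symmetrise ((even ⊗ odd) ⊞ (even ⊗ odd))))
    (θ-· odd odd) (θ₂-⊕ (even ⊗ odd) (even ⊗ odd) (θ-· even odd) (θ-· even odd)) n)
  (V-cong 1 (⊕-cong (·-congʳ O θ-even) (·-congʳ O θ-even)) n)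

-- The pairs of equal parity form the sublattice of index 2, which is the image of all of ℤ² under
-- the rotation by 1 + i.
F²≈ : V₄ F · V₄ F ⊕ O · O ≈ V₂ (F · F)
F²≈ n = trans
  (cong (_+ (O · O) n) (sym (·-cong θ-even θ-even n)))
  (θ₂-rotation 1 5 refl ((even ⊗ even) ⊞ (odd ⊗ odd)) (everything ⊗ everything)
      (multiple₂! 1 ((even ⊗ even) ⊞ (odd ⊗ odd))) (equal₂! (symmetrise (rotated 1 ((even ⊗ even) ⊞ (odd ⊗ odd)))) (symmetrise (everything ⊗ everything)))
    (θ₂-⊕ (even ⊗ even) (odd ⊗ odd) (θ-· even even) (θ-· odd odd)) (θ-· everything everything) n)

-- The condition is u ≡ 2 v modulo 5, which describes the multiples of 2 + i.
onSublattice : (Fin 10 → ℤ) → Fin 10 → Fin 10 → ℤ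
onSublattice g i j = if (2 ℕ.* toℕ j ℕ.+ 9 ℕ.* toℕ i) % 5 ℕ.≡ᵇ 0 then g i * g j else 0ℤ

-- On the sublattice either 5 divides both coordinates, or their squares are 1 and 4 modulo 5 in
-- some order. Up to symmetry, both orders with half of the sign choices amount to one order with
-- all sign choices, which is the product on the left.
T₁T₄≈ : T₁ · T₄ ⊕ V₅ (V₅ O) · V₅ (V₅ O) ≈ V₅ (O · O)
T₁T₄≈ n = trans
  (sym (cong (λ x → (T₁ · T₄) n + x) (·-cong θ-odd₀ θ-odd₀ n)))
  (trans
    (θ₂-symmetric (((odd ⊓ square 1) ⊗ (odd ⊓ square 4)) ⊞ ((odd ⊓ square 0) ⊗ (odd ⊓ square 0))) (onSublattice odd)
        (equal₂! (symmetrise (((odd ⊓ square 1) ⊗ (odd ⊓ square 4)) ⊞ ((odd ⊓ square 0) ⊗ (odd ⊓ square 0)))) (symmetrise (onSublattice odd)))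
      (θ₂-⊕ ((odd ⊓ square 1) ⊗ (odd ⊓ square 4)) ((odd ⊓ square 0) ⊗ (odd ⊓ square 0)) (θ-· (odd ⊓ square 1) (odd ⊓ square 4)) (θ-· (odd ⊓ square 0) (odd ⊓ square 0))) (θθ-θ₂ (onSublattice odd)) n)
    (θ₂-rotation 2 2 refl (onSublattice odd) (odd ⊗ odd)
        (multiple₂! 2 (onSublattice odd)) (equal₂! (symmetrise (rotated 2 (onSublattice odd))) (symmetrise (odd ⊗ odd)))
      (θθ-θ₂ (onSublattice odd)) (θ-· odd odd) n))

F₁F₄≈ : F₁ · F₄ ⊕ V₅ (V₅ F) · V₅ (V₅ F) ≈ V₅ (F · F)
F₁F₄≈ n = trans
  (sym (cong (λ x → (F₁ · F₄) n + x) (·-cong θ-all₀ θ-all₀ n)))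
  (trans
    (θ₂-symmetric ((square 1 ⊗ square 4) ⊞ (square 0 ⊗ square 0)) (onSublattice everything)
        (equal₂! (symmetrise ((square 1 ⊗ square 4) ⊞ (square 0 ⊗ square 0))) (symmetrise (onSublattice everything)))
      (θ₂-⊕ (square 1 ⊗ square 4) (square 0 ⊗ square 0) (θ-· (square 1) (square 4)) (θ-· (square 0) (square 0))) (θθ-θ₂ (onSublattice everything)) n)
    (θ₂-rotation 2 2 refl (onSublattice everything) (everything ⊗ everything)
        (multiple₂! 2 (onSublattice everything)) (equal₂! (symmetrise (rotated 2 (onSublattice everything))) (symmetrise (everything ⊗ everything)))
      (θθ-θ₂ (onSublattice everything)) (θ-· everything everything) n))

-- If u = x - y and v = x + y with 5 dividing v, then u ≡ 2x modulo 5, so u² ≡ 1 becomes x² ≡ y² ≡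
-- 4; and x, y have opposite parity.
T₁O≈ : T₁ · V₅ (V₅ O) ≈ V₂ (V₄ F₁ · T₄)
T₁O≈ n = trans (sym (·-congˡ T₁ θ-odd₀ n)) (trans
  (θ₂-rotation 1 5 refl ((odd ⊓ square 1) ⊗ (odd ⊓ square 0)) ((even ⊓ square 4) ⊗ (odd ⊓ square 4))
      (multiple₂! 1 ((odd ⊓ square 1) ⊗ (odd ⊓ square 0))) (equal₂! (symmetrise (rotated 1 ((odd ⊓ square 1) ⊗ (odd ⊓ square 0)))) (symmetrise ((even ⊓ square 4) ⊗ (odd ⊓ square 4))))
    (θ-· (odd ⊓ square 1) (odd ⊓ square 0)) (θ-· (even ⊓ square 4) (odd ⊓ square 4)) n)
  (V-cong 1 (·-congʳ T₄ θ-even₄) n))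

T₄O≈ : T₄ · V₅ (V₅ O) ≈ V₂ (V₄ F₄ · T₁)
T₄O≈ n = trans (sym (·-congˡ T₄ θ-odd₀ n)) (trans
  (θ₂-rotation 1 5 refl ((odd ⊓ square 4) ⊗ (odd ⊓ square 0)) ((even ⊓ square 1) ⊗ (odd ⊓ square 1))
      (multiple₂! 1 ((odd ⊓ square 4) ⊗ (odd ⊓ square 0))) (equal₂! (symmetrise (rotated 1 ((odd ⊓ square 4) ⊗ (odd ⊓ square 0)))) (symmetrise ((even ⊓ square 1) ⊗ (odd ⊓ square 1))))
    (θ-· (odd ⊓ square 4) (odd ⊓ square 0)) (θ-· (even ⊓ square 1) (odd ⊓ square 1)) n)
  (V-cong 1 (·-congʳ T₁ θ-even₁) n))

O-split : O ≈ T₁ ⊕ T₄ ⊕ V₅ (V₅ O)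
O-split n = trans
  (⟶-unique (θ₁.sum₁ (θ-θ₁ odd) n)
    (⟶-cong (λ x → trans (lemma (odd₁ (res x)) (odd₄ (res x)) (odd₀ (res x)) ((q^ (1 ℕ.* sq x)) n)) (cong (_* (q^ (1 ℕ.* sq x)) n) (sym (split (res x)))))
      (⟶-linear 1ℤ (θ₁.sum₁ (θ-θ₁ odd₁) n) (⟶-linear 1ℤ (θ₁.sum₁ (θ-θ₁ odd₄) n) (θ₁.sum₁ (θ-θ₁ odd₀) n)))))
  (trans (assoc (T₁ n) (T₄ n) (θ odd₀ n)) (cong (λ z → T₁ n + T₄ n + z) (θ-odd₀ n)))
  where
  odd₁ odd₄ odd₀ : Fin 10 → ℤ
  odd₁ = odd ⊓ square 1
  odd₄ = odd ⊓ square 4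
  odd₀ = odd ⊓ square 0
  split : ∀ i → odd i ≡ 1ℤ * odd₁ i + (1ℤ * odd₄ i + odd₀ i)
  split = equal! odd (λ i → 1ℤ * odd₁ i + (1ℤ * odd₄ i + odd₀ i))
  lemma : ∀ a b c z → 1ℤ * (a * z) + (1ℤ * (b * z) + c * z) ≡ (1ℤ * a + (1ℤ * b + c)) * z
  lemma = solve-∀
  assoc : ∀ a b c → 1ℤ * a + (1ℤ * b + c) ≡ a + b + c
  assoc = solve-∀

-- Polynomial identities between the forms

-- The forms below are evaluated at p = φ(q), s = 2 q^(1/4) ψ(q²), r = φ(q⁵), t = 2 q^(5/4) ψ(q¹⁰)
-- (with q⁸ for q), o = 2 q^(1/8) ψ(q) and u = 2 q^(5/8) ψ(q⁵).
module Forms {A : Set} (_⊹_ _⊖′_ _∙_ : A → A → A) (# : ℤ → A) where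

  infixl 6 _+′_ _-′_
  infixl 7 _*′_
  _+′_ _-′_ _*′_ Δ : A → A → A
  _+′_ = _⊹_
  _-′_ = _⊖′_
  _*′_ = _∙_
  Δ x y = x *′ x -′ y *′ y

  -- Put p² = P² + S², s² = 2PS, r² = R² + T², t² = 2RT. Then (p² - r²)(s² - t²) + 4r²t² is 2 (b₀ +
  -- b₁) at P, S, R, T, and its square minus 16p²s²r²t² is 4 (octic + octic′), grouped according to
  -- the exponents modulo 16.
  ε b₀ b₁ octic octic′ quartic sextic factor : A → A → A → A → A
  ε p s r t = p *′ s -′ r *′ t
  b₀ p s r t = Δ s t *′ ε p s r t +′ # (+ 4) *′ (r *′ (t *′ t *′ t))
  b₁ p s r t = Δ p r *′ ε p s r t +′ # (+ 4) *′ (r *′ r *′ r *′ t)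
  octic p s r t =
    b₀ p s r t *′ b₀ p s r t +′ b₁ p s r t *′ b₁ p s r t
    -′ # (+ 16) *′ (p *′ s *′ (r *′ t) *′ (p *′ p *′ (r *′ r) +′ s *′ s *′ (t *′ t)))
  octic′ p s r t =
    # (+ 2) *′ (b₀ p s r t *′ b₁ p s r t)
    -′ # (+ 16) *′ (p *′ s *′ (r *′ t) *′ (p *′ p *′ (t *′ t) +′ s *′ s *′ (r *′ r)))
  quartic p s r t =
    Δ p r *′ Δ p r +′ Δ s t *′ Δ s t -′ # (+ 4) *′ (r *′ r *′ Δ p r +′ t *′ t *′ Δ s t)
  factor p s r t = ε p s r t *′ ε p s r t +′ # (+ 4) *′ (r *′ t *′ (r *′ t))
  sextic p s r t = p *′ t *′ (Δ s t *′ Δ s t) -′ s *′ r *′ (Δ p r *′ Δ p r)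

  ω : A → A → A
  ω o u = o *′ o *′ o *′ u -′ o *′ (u *′ u *′ u)

module Identities
  (R : AlmostCommutativeRing 0ℓ 0ℓ)
  (morphism : +-*-rawRing -Raw-AlmostCommutative⟶ R)
  where

  open AlmostCommutativeRing R using (Carrier; *-cong; +-cong) 
    renaming (_≈_ to _≃_; _+_ to _⊹_; _*_ to _∙_; -_ to ⊟_; -‿cong to ⊟-cong; refl to ≃-refl; sym to ≃-sym; trans to ≃-trans)
  open _-Raw-AlmostCommutative⟶_ morphism using () renaming (⟦_⟧ to #)

  coefficient≟ : WeaklyDecidable (Induced-equivalence morphism)
  coefficient≟ x y with x ℤ.≟ y
  ... | yes refl = just ≃-refl
  ... | no  _    = nothing

  open Solver +-*-rawRing R morphism coefficient≟ using (Polynomial; solve; _:=_; _:+_; _:*_; _:-_; :-_; con)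

  infixl 6 _⊖′_
  _⊖′_ : Carrier → Carrier → Carrier
  x ⊖′ y = x ⊹ (⊟ y)

  open Forms _⊹_ _⊖′_ _∙_ #
  module P {n} = Forms {Polynomial n} _:+_ _:-_ _:*_ con

  difference : ∀ {x y} → x ≃ y → x ⊖′ y ≃ # 0ℤ
  difference {x} {y} x≃y =
    ≃-trans (+-cong x≃y ≃-refl) (solve 1 (λ y → y :- y := con 0ℤ) ≃-refl y)

  equality : ∀ {x y} → x ⊖′ y ≃ # 0ℤ → x ≃ y
  equality {x} {y} z =
    ≃-trans (solve 2 (λ x y → x := (x :- y) :+ y) ≃-refl x y)
      (≃-trans (+-cong z ≃-refl) (solve 1 (λ y → con 0ℤ :+ y := y) ≃-refl y))

  multiple : ∀ {x y} c → x ≃ y → c ∙ (x ⊖′ y) ≃ # 0ℤ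
  multiple c x≃y =
    ≃-trans (*-cong ≃-refl (difference x≃y)) (solve 1 (λ c → c :* con 0ℤ := con 0ℤ) ≃-refl c)

  0+0 : ∀ {x y} → x ≃ # 0ℤ → y ≃ # 0ℤ → x ⊹ y ≃ # 0ℤ
  0+0 p q = ≃-trans (+-cong p q) (solve 0 (con 0ℤ :+ con 0ℤ := con 0ℤ) ≃-refl)

  -- Equations are derived by certificates: l - r is a combination, with explicit cofactors, of the
  -- defects of known equations, and the ring solver confirms the combination.
  from₁ : ∀ {l r a b} c → a ≃ b → l ⊖′ r ≃ c ∙ (a ⊖′ b) → l ≃ r
  from₁ c p e = equality (≃-trans e (multiple c p))

  from₂ : ∀ {l r a b a′ b′} c c′ → a ≃ b → a′ ≃ b′ →
    l ⊖′ r ≃ c ∙ (a ⊖′ b) ⊹ c′ ∙ (a′ ⊖′ b′) → l ≃ r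
  from₂ c c′ p p′ e = equality (≃-trans e (0+0 (multiple c p) (multiple c′ p′)))

  from₃ : ∀ {l r a b a′ b′ a″ b″} c c′ c″ → a ≃ b → a′ ≃ b′ → a″ ≃ b″ →
    l ⊖′ r ≃ c ∙ (a ⊖′ b) ⊹ c′ ∙ (a′ ⊖′ b′) ⊹ c″ ∙ (a″ ⊖′ b″) → l ≃ r
  from₃ c c′ c″ p p′ p″ e = equality (≃-trans e (0+0 (0+0 (multiple c p) (multiple c′ p′)) (multiple c″ p″)))

  Modular : Carrier → Carrier → Carrier → Carrier → Set
  Modular p s r t = Δ p r ∙ Δ s t ≃ # (+ 4) ∙ (r ∙ t ∙ ε p s r t)

  -- Here o² - u² = 2 ε and u² = 2rt, so the left side of the last hypothesis is 4rt ε.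
  modular : ∀ p s r t o u → o ∙ o ≃ p ∙ s ⊹ p ∙ s → u ∙ u ≃ r ∙ t ⊹ r ∙ t →
    Δ o u ∙ (u ∙ u) ≃ Δ p r ∙ Δ s t → Modular p s r t
  modular p s r t o u h h′ h″ =
    from₃ (u ∙ u) (# (+ 2) ∙ ε p s r t ⊖′ u ∙ u) (# -[1+ 0 ]) h h′ h″
      (solve 6 (λ p s r t o u →
          P.Δ p r :* P.Δ s t :- con (+ 4) :* (r :* t :* P.ε p s r t)
        := u :* u :* (o :* o :- (p :* s :+ p :* s))
           :+ (con (+ 2) :* P.ε p s r t :- u :* u) :* (u :* u :- (r :* t :+ r :* t))
           :+ con -[1+ 0 ] :* (P.Δ o u :* (u :* u) :- P.Δ p r :* P.Δ s t)) ≃-refl p s r t o u)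

  -- Once 4 (p²r² + s²t²) times the defect of `Modular` is subtracted, `octic` splits into two forms
  -- of degree 4.
  octic-factors : ∀ p s r t → Modular p s r t → octic p s r t ≃ # 0ℤ → factor p s r t ∙ quartic p s r t ≃ # 0ℤ
  octic-factors p s r t m o =
    from₂ (# 1ℤ) (⊟ (# (+ 4) ∙ (p ∙ p ∙ (r ∙ r) ⊹ s ∙ s ∙ (t ∙ t)))) o m
      (solve 4 (λ p s r t →
          P.factor p s r t :* P.quartic p s r t :- con 0ℤ
        := con 1ℤ :* (P.octic p s r t :- con 0ℤ)
           :+ (:- (con (+ 4) :* (p :* p :* (r :* r) :+ s :* s :* (t :* t))))
              :* (P.Δ p r :* P.Δ s t :- con (+ 4) :* (r :* t :* P.ε p s r t))) ≃-refl p s r t)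

  octic-split : ∀ p s r t P S R T → p ∙ p ≃ P ∙ P ⊹ S ∙ S → r ∙ r ≃ R ∙ R ⊹ T ∙ T →
    s ∙ s ≃ P ∙ S ⊹ P ∙ S → t ∙ t ≃ R ∙ T ⊹ R ∙ T → Modular p s r t →
    # (+ 4) ∙ (octic P S R T ⊹ octic′ P S R T) ≃ # 0ℤ
  octic-split p s r t P S R T hp hr hs ht m =
    from₁ (# -[1+ 0 ])
      (≃-trans (*-cong (*-cong (*-cong (*-cong ≃-refl (≃-sym hp)) (≃-sym hr)) (≃-sym hs)) (≃-sym ht))
        (≃-trans squared (*-cong N-cong N-cong)))
      (solve 4 (λ P S R T →
          con (+ 4) :* (P.octic P S R T :+ P.octic′ P S R T) :- con 0ℤ
        := con -[1+ 0 ] :* (con (+ 16) :* (P :* P :+ S :* S) :* (R :* R :+ T :* T) :* (P :* S :+ P :* S) :* (R :* T :+ R :* T)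
             :- (((P :* P :+ S :* S) :- (R :* R :+ T :* T)) :* ((P :* S :+ P :* S) :- (R :* T :+ R :* T))
                   :+ con (+ 4) :* ((R :* R :+ T :* T) :* (R :* T :+ R :* T)))
                :* (((P :* P :+ S :* S) :- (R :* R :+ T :* T)) :* ((P :* S :+ P :* S) :- (R :* T :+ R :* T))
                   :+ con (+ 4) :* ((R :* R :+ T :* T) :* (R :* T :+ R :* T))))) ≃-refl P S R T)
    where
    N : Carrier → Carrier → Carrier → Carrier → Carrier
    N x y z w = (x ⊖′ z) ∙ (y ⊖′ w) ⊹ # (+ 4) ∙ (z ∙ w)
    N-cong : N (p ∙ p) (s ∙ s) (r ∙ r) (t ∙ t) ≃ N (P ∙ P ⊹ S ∙ S) (P ∙ S ⊹ P ∙ S) (R ∙ R ⊹ T ∙ T) (R ∙ T ⊹ R ∙ T)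
    N-cong = +-cong (*-cong (+-cong hp (⊟-cong hr)) (+-cong hs (⊟-cong ht))) (*-cong ≃-refl (*-cong hr ht))
    -- `Modular` reads N = 4prst, with N a function of the squares alone; squaring leaves only p²,
    -- s², r², t², for which the quadratic relations can be substituted.
    squared : # (+ 16) ∙ (p ∙ p) ∙ (r ∙ r) ∙ (s ∙ s) ∙ (t ∙ t)
      ≃ N (p ∙ p) (s ∙ s) (r ∙ r) (t ∙ t) ∙ N (p ∙ p) (s ∙ s) (r ∙ r) (t ∙ t)
    squared = from₁ (⊟ (# (+ 4) ∙ (p ∙ r ∙ s ∙ t) ⊹ N (p ∙ p) (s ∙ s) (r ∙ r) (t ∙ t))) m
      (solve 4 (λ p s r t →
          con (+ 16) :* (p :* p) :* (r :* r) :* (s :* s) :* (t :* t)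
          :- (P.Δ p r :* P.Δ s t :+ con (+ 4) :* (r :* r :* (t :* t))) :* (P.Δ p r :* P.Δ s t :+ con (+ 4) :* (r :* r :* (t :* t)))
        := (:- (con (+ 4) :* (p :* r :* s :* t) :+ (P.Δ p r :* P.Δ s t :+ con (+ 4) :* (r :* r :* (t :* t)))))
           :* (P.Δ p r :* P.Δ s t :- con (+ 4) :* (r :* t :* P.ε p s r t))) ≃-refl p s r t)

  -- Up to the factor 2st, `sextic` is the difference of the squares of the two sides of the
  -- relation sought, o t Δ(s,t) = s u Δ(p,r). The two known relations give it multiplied by s² -
  -- 5t².
  sextic-multiple : ∀ p s r t → Modular p s r t → quartic p s r t ≃ # 0ℤ →
    (s ∙ s ⊖′ # (+ 5) ∙ (t ∙ t)) ∙ sextic p s r t ≃ # 0ℤ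
  sextic-multiple p s r t m h =
    from₂ (p ∙ t ∙ Δ s t) (⊟ (Δ p r ∙ (p ∙ t ⊹ s ∙ r))) h m
      (solve 4 (λ p s r t →
          (s :* s :- con (+ 5) :* (t :* t)) :* P.sextic p s r t :- con 0ℤ
        := p :* t :* P.Δ s t :* (P.quartic p s r t :- con 0ℤ)
           :+ (:- (P.Δ p r :* (p :* t :+ s :* r))) :* (P.Δ p r :* P.Δ s t :- con (+ 4) :* (r :* t :* P.ε p s r t))) ≃-refl p s r t)

  cubic-squared : ∀ p s r t o u → o ∙ o ≃ p ∙ s ⊹ p ∙ s → u ∙ u ≃ r ∙ t ⊹ r ∙ t → sextic p s r t ≃ # 0ℤ →
    (o ∙ t ∙ Δ s t ⊹ s ∙ u ∙ Δ p r) ∙ (o ∙ t ∙ Δ s t ⊖′ s ∙ u ∙ Δ p r) ≃ # 0ℤ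
  cubic-squared p s r t o u ho hu h =
    from₃ (t ∙ t ∙ (Δ s t ∙ Δ s t)) (⊟ (s ∙ s ∙ (Δ p r ∙ Δ p r))) (# (+ 2) ∙ (s ∙ t)) ho hu h
      (solve 6 (λ p s r t o u →
          (o :* t :* P.Δ s t :+ s :* u :* P.Δ p r) :* (o :* t :* P.Δ s t :- s :* u :* P.Δ p r) :- con 0ℤ
        := t :* t :* (P.Δ s t :* P.Δ s t) :* (o :* o :- (p :* s :+ p :* s))
           :+ (:- (s :* s :* (P.Δ p r :* P.Δ p r))) :* (u :* u :- (r :* t :+ r :* t))
           :+ con (+ 2) :* (s :* t) :* (P.sextic p s r t :- con 0ℤ)) ≃-refl p s r t o u)

  -- Below Φ = p² - r².
  quotient-even : ∀ Φ s t o u c → c ∙ o ≃ u ∙ (u ∙ (u ∙ (u ∙ u))) → o ∙ t ∙ Δ s t ≃ s ∙ u ∙ Φ →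
    Δ o u ∙ (u ∙ u) ≃ Φ ∙ Δ s t →
    o ∙ ((o ∙ (u ∙ u ∙ u) ⊖′ c) ∙ s ⊖′ t ∙ (Δ s t ∙ Δ s t)) ≃ # 0ℤ
  quotient-even Φ s t o u c hc h m =
    from₃ (⊟ s) (⊟ Δ s t) (s ∙ u) hc h m
      (solve 6 (λ Φ s t o u c →
          o :* ((o :* (u :* u :* u) :- c) :* s :- t :* (P.Δ s t :* P.Δ s t)) :- con 0ℤ
        := (:- s) :* (c :* o :- u :* (u :* (u :* (u :* u))))
           :+ (:- P.Δ s t) :* (o :* t :* P.Δ s t :- s :* u :* Φ)
           :+ s :* u :* (P.Δ o u :* (u :* u) :- Φ :* P.Δ s t)) ≃-refl Φ s t o u c)

  -- With Δ = o² - u², multiplication by o turns the two summands into u Δ² and u³ Δ. Their sum is u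
  -- Δ o², because Δ + u² = o².
  quotient-sum : ∀ o u c g → c ∙ o ≃ u ∙ (u ∙ (u ∙ (u ∙ u))) → g ∙ o ≃ u ∙ (Δ o u ∙ Δ o u) →
    o ∙ (g ⊹ (o ∙ (u ∙ u ∙ u) ⊖′ c) ⊖′ ω o u) ≃ # 0ℤ
  quotient-sum o u c g hc hg =
    from₂ (# 1ℤ) (# -[1+ 0 ]) hg hc
      (solve 4 (λ o u c g →
          o :* (g :+ (o :* (u :* u :* u) :- c) :- P.ω o u) :- con 0ℤ
        := con 1ℤ :* (g :* o :- u :* (P.Δ o u :* P.Δ o u))
           :+ con -[1+ 0 ] :* (c :* o :- u :* (u :* (u :* (u :* u))))) ≃-refl o u c g)

  -- Since ω(o,u) = o u Δ(o,u), the hypotheses give s u Φ² = o t Δ(s,t) Φ = o t u² Δ(o,u) = u t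
  -- ω(o,u).
  ω-multiple : ∀ Φ s t o u → o ∙ t ∙ Δ s t ≃ s ∙ u ∙ Φ → Δ o u ∙ (u ∙ u) ≃ Φ ∙ Δ s t →
    u ∙ (s ∙ (Φ ∙ Φ) ⊖′ ω o u ∙ t) ≃ # 0ℤ
  ω-multiple Φ s t o u h m =
    from₂ (⊟ Φ) (⊟ (o ∙ t)) h m
      (solve 5 (λ Φ s t o u →
          u :* (s :* (Φ :* Φ) :- P.ω o u :* t) :- con 0ℤ
        := (:- Φ) :* (o :* t :* P.Δ s t :- s :* u :* Φ)
           :+ (:- (o :* t)) :* (P.Δ o u :* (u :* u) :- Φ :* P.Δ s t)) ≃-refl Φ s t o u)

  -- The cross term 2sab of s (a + b)² is 2 ω(s,t) t. Removing it leaves squares, whose exponents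
  -- will agree modulo 16.
  ω-even : ∀ w Φ s t a b → s ∙ (Φ ∙ Φ) ≃ w ∙ t → Φ ≃ a ⊹ b → Δ s t ∙ (t ∙ t) ≃ a ∙ b →
    (w ⊖′ # (+ 2) ∙ ω s t) ∙ t ≃ s ∙ (a ∙ a ⊹ b ∙ b)
  ω-even w Φ s t a b hw hΦ m =
    from₃ (# -[1+ 0 ]) (s ∙ (Φ ⊹ (a ⊹ b))) (⊟ (# (+ 2) ∙ s)) hw hΦ m
      (solve 6 (λ w Φ s t a b →
          (w :- con (+ 2) :* P.ω s t) :* t :- s :* (a :* a :+ b :* b)
        := con -[1+ 0 ] :* (s :* (Φ :* Φ) :- w :* t)
           :+ s :* (Φ :+ (a :+ b)) :* (Φ :- (a :+ b))
           :+ (:- (con (+ 2) :* s)) :* (P.Δ s t :* (t :* t) :- a :* b)) ≃-refl w Φ s t a b)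

  interchange : ∀ a b c d → (a ∙ b) ∙ (c ∙ d) ≃ (a ∙ c) ∙ (b ∙ d)
  interchange = solve 4 (λ a b c d → (a :* b) :* (c :* d) := (a :* c) :* (b :* d)) ≃-refl

  -- The terms 3a²b + 3az² = 3a (ab + z²) collapse to 3au², and likewise with a and b exchanged. For
  -- a, b, z in the classes 1, 4, 0 modulo 5 the summands are sorted by class.
  cube-split : ∀ a b z u → a ∙ b ⊹ z ∙ z ≃ u ∙ u →
    (a ⊹ b ⊹ z) ∙ (a ⊹ b ⊹ z) ∙ (a ⊹ b ⊹ z) ∙ u
    ≃ (z ∙ z ∙ z ⊹ # (+ 6) ∙ (a ∙ b ∙ z)) ∙ u ⊹ # (+ 3) ∙ (a ∙ (u ∙ u ∙ u))
      ⊹ (b ∙ b ∙ b ⊹ # (+ 3) ∙ (a ∙ a ∙ z)) ∙ u ⊹ (a ∙ a ∙ a ⊹ # (+ 3) ∙ (b ∙ b ∙ z)) ∙ u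
      ⊹ # (+ 3) ∙ (b ∙ (u ∙ u ∙ u))
  cube-split a b z u h = from₁ (# (+ 3) ∙ ((a ⊹ b) ∙ u)) h
    (solve 4 (λ a b z u →
        (a :+ b :+ z) :* (a :+ b :+ z) :* (a :+ b :+ z) :* u
        :- ((z :* z :* z :+ con (+ 6) :* (a :* b :* z)) :* u :+ con (+ 3) :* (a :* (u :* u :* u))
            :+ (b :* b :* b :+ con (+ 3) :* (a :* a :* z)) :* u :+ (a :* a :* a :+ con (+ 3) :* (b :* b :* z)) :* u
            :+ con (+ 3) :* (b :* (u :* u :* u)))
      := con (+ 3) :* ((a :+ b) :* u) :* (a :* b :+ z :* z :- u :* u)) ≃-refl a b z u)

  dissected : ∀ o u → (u ∙ u ∙ u ⊹ # (+ 6) ∙ (Δ o u ∙ u)) ∙ o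
    ≃ # (+ 6) ∙ (o ∙ o ∙ o ∙ u) ⊖′ # (+ 5) ∙ (o ∙ (u ∙ u ∙ u))
  dissected = solve 2 (λ o u →
      (u :* u :* u :+ con (+ 6) :* (P.Δ o u :* u)) :* o
    := con (+ 6) :* (o :* o :* o :* u) :- con (+ 5) :* (o :* (u :* u :* u))) ≃-refl

  scaled-quotient : ∀ c v e m m₁ m₅ → c ∙ v ≃ e ∙ (e ∙ (e ∙ (e ∙ e))) → m ∙ m₁ ≃ m₅ ∙ (m₅ ∙ (m₅ ∙ (m₅ ∙ m₅))) →
    let u = # (+ 2) ∙ (m₅ ∙ e) in
    # (+ 16) ∙ (m ∙ c) ∙ (# (+ 2) ∙ (m₁ ∙ v)) ≃ u ∙ (u ∙ (u ∙ (u ∙ u)))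
  scaled-quotient c v e m m₁ m₅ h h′ =
    from₂ (# (+ 32) ∙ (m ∙ m₁)) (# (+ 32) ∙ (e ∙ (e ∙ (e ∙ (e ∙ e))))) h h′
      (solve 6 (λ c v e m m₁ m₅ → let u = con (+ 2) :* (m₅ :* e) in
          con (+ 16) :* (m :* c) :* (con (+ 2) :* (m₁ :* v)) :- u :* (u :* (u :* (u :* u)))
        := con (+ 32) :* (m :* m₁) :* (c :* v :- e :* (e :* (e :* (e :* e))))
           :+ con (+ 32) :* (e :* (e :* (e :* (e :* e)))) :* (m :* m₁ :- m₅ :* (m₅ :* (m₅ :* (m₅ :* m₅))))) ≃-refl c v e m m₁ m₅)

-- Triangular numbers and ψ

tri : ℕ → ℕ
tri zero    = 0
tri (suc n) = suc n ℕ.+ tri n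

tri-*2 : ∀ n → n ℕ.* (n ℕ.+ 1) ≡ tri n ℕ.* 2
tri-*2 zero    = refl
tri-*2 (suc n) = trans (lemma n) (trans (cong (λ z → suc n ℕ.* 2 ℕ.+ z) (tri-*2 n)) (sym (ℕ.*-distribʳ-+ 2 (suc n) (tri n))))
  where
  lemma : ∀ n → suc n ℕ.* (suc n ℕ.+ 1) ≡ suc n ℕ.* 2 ℕ.+ n ℕ.* (n ℕ.+ 1)
  lemma = solveℕ-∀

triangular≡tri : ∀ n → triangular n ≡ tri n
triangular≡tri n = trans (cong (_/ 2) (tri-*2 n)) (m*n/n≡m (tri n) 2)

n≤tri : ∀ n → n ≤ tri n
n≤tri zero    = z≤n
n≤tri (suc n) = ℕ.m≤m+n (suc n) (tri n)

sq-odd : ∀ n → suc (2 ℕ.* n) ℕ.* suc (2 ℕ.* n) ≡ suc (tri n ℕ.* 8)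
sq-odd n = trans (lemma n) (trans (cong (λ z → suc (z ℕ.* 4)) (tri-*2 n)) (lemma′ (tri n)))
  where
  lemma : ∀ n → suc (2 ℕ.* n) ℕ.* suc (2 ℕ.* n) ≡ suc (n ℕ.* (n ℕ.+ 1) ℕ.* 4)
  lemma = solveℕ-∀
  lemma′ : ∀ t → suc (t ℕ.* 2 ℕ.* 4) ≡ suc (t ℕ.* 8)
  lemma′ = solveℕ-∀

-- This is k (k + 1) / 2, invariant under k ↦ -1 - k; every triangular number occurs twice, whence
-- the factor 2 between `O` and `ψ`.
triℤ : ℤ → ℕ
triℤ (+ n)    = tri n
triℤ -[1+ n ] = tri n

sq-1+2* : ∀ k → sq (1ℤ + + 2 * k) ≡ suc (triℤ k ℕ.* 8)
sq-1+2* (+ n)    = trans (cong (λ z → sq (1ℤ + z)) (sym (ℤ.pos-* 2 n))) (sq-odd n)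
sq-1+2* -[1+ n ] =
  trans (cong sq (trans (lemma (+ n)) (cong (λ z → - (1ℤ + z)) (sym (ℤ.pos-* 2 n))))) (sq-odd n)
  where
  lemma : ∀ x → 1ℤ + + 2 * - (1ℤ + x) ≡ - (1ℤ + + 2 * x)
  lemma = solve-∀

∑< : ℕ → Series → ℤ
∑< zero    f = 0ℤ
∑< (suc N) f = ∑< N f + f N

ψ : Series
ψ m = ∑< (suc m) (λ i → (q^ tri i) m)

-- O is 2 q ψ(q⁸): an odd x is 1 + 2 k, and then x² = 1 + 8 k (k + 1) / 2.
O-triangular : ∀ n → (λ k → (q^ suc (triℤ k ℕ.* 8)) n) ⟶ O n
O-triangular n =
  ⟶-cong (λ k → trans (cong (λ x → (odd (res x) q^ (1 ℕ.* sq x)) n) (lemma k))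
                  (trans (cong₂ (λ c a → c * (q^ a) n) (odd-res k) (trans (ℕ.*-identityˡ _) (sq-1+2* k)))
                    (ℤ.*-identityˡ _)))
    (⟶-neg (⟶-progression 1 1ℤ (θ₁.sum₁ (θ-θ₁ odd) n) off))
  where
  lemma : ∀ k → 1ℤ - + 2 * - k ≡ 1ℤ + + 2 * k
  lemma = solve-∀
  odd-res : ∀ k → odd (res (1ℤ + + 2 * k)) ≡ 1ℤ
  odd-res k = trans (cong odd (res-rot₂ 2 1ℤ k)) (equal! (λ i → odd (rot₂ 2 (res 1ℤ) i)) everything (res k))
  off : ∀ u → (odd (res u) q^ (1 ℕ.* sq u)) n ≡ 0ℤ ⊎ ∃ λ k → u ≡ 1ℤ - + 2 * k
  off u with progression 1 5 refl (odd ⊗ odd) (multiple₂! 1 (odd ⊗ odd)) u 1ℤ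
  ... | inj₁ z = inj₁ (cong (_* (q^ (1 ℕ.* sq u)) n) (trans (sym (ℤ.*-identityʳ (odd (res u)))) z))
  ... | inj₂ p = inj₂ p

O-support : ∀ n → O n ≡ 0ℤ ⊎ ∃ λ m → n ≡ suc (m ℕ.* 8)
O-support n = ⟶-elim (λ k → map₂ (λ p → triℤ k , sym p) (q^-support (suc (triℤ k ℕ.* 8)) n)) (O-triangular n)

O-coefficient : ∀ m → O (suc (m ℕ.* 8)) ≡ + 2 * ψ m
O-coefficient m = trans (sym (⟶-at bounded series)) (trans (fold (suc m))
  (trans (cong (λ z → ψ m + ψ m + z) (beyond (suc m) ℕ.≤-refl)) (lemma (ψ m))))
  where
  lemma : ∀ x → x + x + 0ℤ ≡ + 2 * x
  lemma = solve-∀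
  beyond : ∀ n → m < n → (q^ tri n) m ≡ 0ℤ
  beyond n l with q^-support (tri n) m
  ... | inj₁ z    = z
  ... | inj₂ refl = contradiction (n≤tri n) (ℕ.<⇒≱ l)
  stretched : ∀ a → (q^ (a ℕ.* 8)) (m ℕ.* 8) ≡ (q^ a) m
  stretched a = trans (sym (stretch-q^ 7 0 a (m ℕ.* 8))) (V-coefficient 7 (q^ a) m)
  series : (λ k → (q^ triℤ k) m) ⟶ O (suc (m ℕ.* 8))
  series = ⟶-cong (λ k → stretched (triℤ k)) (O-triangular (suc (m ℕ.* 8)))
  bounded : Bounded (suc m) (λ k → (q^ triℤ k) m)
  bounded (+ n)    l       = beyond n (ℕ.<-trans (ℕ.n<1+n m) l)
  bounded -[1+ n ] (s≤s l) = beyond n l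
  -- The interval from -N to N is not stable under k ↦ -1 - k, so the term at N stays unpaired. For
  -- N = m + 1 its exponent exceeds m.
  fold : ∀ N → S N (λ k → (q^ triℤ k) m) ≡
    ∑< N (λ i → (q^ tri i) m) + ∑< N (λ i → (q^ tri i) m) + (q^ tri N) m
  fold zero    = sym (ℤ.+-identityˡ _)
  fold (suc N) = trans (cong (_+ ((q^ tri (suc N)) m + (q^ tri N) m)) (fold N))
    (rearrange (∑< N (λ i → (q^ tri i) m)) ((q^ tri N) m) ((q^ tri (suc N)) m))
    where
    rearrange : ∀ a b c → a + a + b + (c + b) ≡ a + b + (a + b) + c
    rearrange = solve-∀

O-Supp : Supp 8 1 O
O-Supp = supp λ n → map₂ (λ { (m , refl) → [m+kn]%n≡m%n 1 m 8 }) (O-support n)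

-- The modular equation

κ-homomorphism : +-*-rawRing -Raw-AlmostCommutative⟶ fromCommutativeRing seriesRing
κ-homomorphism = record
  { ⟦_⟧    = κ
  ; +-homo = λ { x y zero → refl ; x y (suc n) → refl }
  ; *-homo = λ { x y zero → sym (κ-· x (κ y) 0) ; x y (suc n) → sym (trans (κ-· x (κ y) (suc n)) (ℤ.*-zeroʳ x)) }
  ; -‿homo = λ { x zero → refl ; x (suc n) → refl }
  ; 0-homo = λ _ → refl
  ; 1-homo = λ _ → refl }

open Identities (fromCommutativeRing seriesRing) κ-homomorphism
open Forms _⊕_ _⊝_ _·_ κ

≈-sym : ∀ {f g} → f ≈ g → g ≈ f
≈-sym p n = sym (p n)

infixr 2 _⨾_
_⨾_ : ∀ {f g h} → f ≈ g → g ≈ h → f ≈ h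
(p ⨾ q) n = trans (p n) (q n)

V⟨·⟩ : ∀ e {f g f′ g′} → V e f ≈ f′ → V e g ≈ g′ → V e (f · g) ≈ f′ · g′
V⟨·⟩ e {f} {g} p q = V-· e f g ⨾ ·-cong p q

V⟨⊕⟩ : ∀ e {f g f′ g′} → V e f ≈ f′ → V e g ≈ g′ → V e (f ⊕ g) ≈ f′ ⊕ g′
V⟨⊕⟩ e {f} {g} p q = V-⊕ e f g ⨾ ⊕-cong p q

V⟨⊝⟩ : ∀ e {f g f′ g′} → V e f ≈ f′ → V e g ≈ g′ → V e (f ⊝ g) ≈ f′ ⊝ g′
V⟨⊝⟩ e {f} {g} p q = V-⊝ e f g ⨾ ⊝-cong p q

V⟨Δ⟩ : ∀ e {f g f′ g′} → V e f ≈ f′ → V e g ≈ g′ → V e (Δ f g) ≈ Δ f′ g′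
V⟨Δ⟩ e p q = V⟨⊝⟩ e (V⟨·⟩ e p p) (V⟨·⟩ e q q)

p s r t o u P S′ R T : Series
o  = O
u  = V₅ O
p  = V₈ F
s  = V₂ O
r  = V₅ p
t  = V₅ s
P  = V₂ p
S′ = V₂ s
R  = V₅ P
T  = V₅ S′

V₂r≈ : V₂ r ≈ R
V₂r≈ = V-comm 1 4 p

V₂t≈ : V₂ t ≈ T
V₂t≈ = V-comm 1 4 s

V₂u≈ : V₂ u ≈ t
V₂u≈ = V-comm 1 4 O

o²≈ : o · o ≈ p · s ⊕ p · s
o²≈ = O²≈ ⨾ V⟨⊕⟩ 1 (V-· 1 (V₄ F) O) (V-· 1 (V₄ F) O)

u²≈ : u · u ≈ r · t ⊕ r · t
u²≈ = ≈-sym (V-· 4 O O) ⨾ V-cong 4 o²≈ ⨾ V⟨⊕⟩ 4 (V-· 4 p s) (V-· 4 p s)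

s²≈ : s · s ≈ P · S′ ⊕ P · S′
s²≈ = ≈-sym (V-· 1 O O) ⨾ V-cong 1 o²≈ ⨾ V⟨⊕⟩ 1 (V-· 1 p s) (V-· 1 p s)

t²≈ : t · t ≈ R · T ⊕ R · T
t²≈ = ≈-sym (V-· 4 s s) ⨾ V-cong 4 s²≈ ⨾ V⟨⊕⟩ 4 (V-· 4 P S′) (V-· 4 P S′)

p²≈ : p · p ≈ P · P ⊕ S′ · S′
p²≈ =
  ≈-sym (V⟨·⟩ 1 {V₄ F} {V₄ F} (λ _ → refl) (λ _ → refl))
  ⨾ V-cong 1 (≈-sym (V⟨·⟩ 1 {V₂ F} {V₂ F} (λ _ → refl) (λ _ → refl) ))
  ⨾ V-cong 1 (V-cong 1 (≈-sym (V-· 1 F F) ⨾ ≈-sym F²≈))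
  ⨾ V-cong 1 (V⟨⊕⟩ 1 (V-· 1 (V₄ F) (V₄ F)) (V-· 1 O O))
  ⨾ V⟨⊕⟩ 1 (V-· 1 _ _) (V-· 1 _ _)

r²≈ : r · r ≈ R · R ⊕ T · T
r²≈ = ≈-sym (V-· 4 p p) ⨾ V-cong 4 p²≈ ⨾ V⟨⊕⟩ 4 (V-· 4 P P) (V-· 4 S′ S′)

T₁T₄≈Δ : T₁ · T₄ ≈ V₅ (Δ o u)
T₁T₄≈Δ =
  (λ n → lemma ((T₁ · T₄) n) ((V₅ u · V₅ u) n))
  ⨾ ⊝-cong T₁T₄≈ (λ _ → refl)
  ⨾ ≈-sym (V⟨⊝⟩ 4 (λ _ → refl) (V-· 4 u u))
  where
  lemma : ∀ a b → a ≡ a + b - b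
  lemma = solve-∀

F₁F₄≈Δ : F₁ · F₄ ≈ V₅ (Δ F (V₅ F))
F₁F₄≈Δ =
  (λ n → lemma ((F₁ · F₄) n) ((V₅ (V₅ F) · V₅ (V₅ F)) n))
  ⨾ ⊝-cong F₁F₄≈ (λ _ → refl)
  ⨾ ≈-sym (V⟨⊝⟩ 4 (λ _ → refl) (V-· 4 (V₅ F) (V₅ F)))
  where
  lemma : ∀ a b → a ≡ a + b - b
  lemma = solve-∀

-- Multiplying the relations for T₁ z and T₄ z, where z = O(q²⁵), leaves T₁ and T₄, and F₁ and F₄,
-- only in the products T₁ T₄ and F₁ F₄. These are series in q⁵, so the substitution q ↦ q⁵ can be
-- undone on both sides.
Δou·u²≈ : Δ o u · (u · u) ≈ Δ p r · Δ s t
Δou·u²≈ = V-injective 4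
  ( V⟨·⟩ 4 {Δ o u} {u · u} (≈-sym T₁T₄≈Δ) (V-· 4 u u)
  ⨾ interchange T₁ T₄ (V₅ u) (V₅ u)
  ⨾ ·-cong T₁O≈ T₄O≈
  ⨾ ≈-sym (V-· 1 (V₄ F₁ · T₄) (V₄ F₄ · T₁))
  ⨾ V-cong 1
    ( interchange (V₄ F₁) T₄ (V₄ F₄) T₁
    ⨾ ·-cong
        (≈-sym (V-cong 1 (V-· 1 F₁ F₄) ⨾ V-· 1 (V₂ F₁) (V₂ F₄)) ⨾ V-cong 1 (V-cong 1 F₁F₄≈Δ)
          ⨾ V-cong 1 (V-comm 1 4 (Δ F (V₅ F))) ⨾ V-comm 1 4 (V₂ (Δ F (V₅ F))))
        (·-comm T₄ T₁ ⨾ T₁T₄≈Δ)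
    ⨾ ≈-sym (V-· 4 (V₄ (Δ F (V₅ F))) (Δ o u)))
  ⨾ V-comm 1 4 (V₄ (Δ F (V₅ F)) · Δ o u)
  ⨾ V-cong 4 (V⟨·⟩ 1 {V₄ (Δ F (V₅ F))} {Δ o u} V₈Δ (V⟨Δ⟩ 1 {O} {u} (λ _ → refl) V₂u≈)))
  where
  V₈Δ : V₈ (Δ F (V₅ F)) ≈ Δ p r
  V₈Δ =
    V-cong 1 (V-cong 1 (V⟨Δ⟩ 1 {F} {V₅ F} (λ _ → refl) (V-comm 1 4 F)))
    ⨾ V-cong 1 (V⟨Δ⟩ 1 {V₂ F} {V₅ (V₂ F)} (λ _ → refl) (V-comm 1 4 (V₂ F)))
    ⨾ V⟨Δ⟩ 1 {V₄ F} {V₅ (V₄ F)} (λ _ → refl) (V-comm 1 4 (V₄ F))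

modular-prst : Modular p s r t
modular-prst = modular p s r t o u o²≈ u²≈ Δou·u²≈

P-Supp : Supp 16 0 P
P-Supp = Supp-V 1 {8} refl (Supp-V 1 {4} refl (Supp-V 1 {2} refl (Supp-V₀ 1 F)))

S-Supp : Supp 16 4 S′
S-Supp = Supp-V 1 {8} refl (Supp-V 1 {4} refl (Supp-divisor (ℕ.divides 2 refl) O-Supp))

s-Supp : Supp 16 2 s
s-Supp = Supp-V 1 {8} refl O-Supp

R-Supp : Supp 16 0 R
R-Supp = Supp-V′ 4 P-Supp

T-Supp : Supp 16 4 T
T-Supp = Supp-% refl (Supp-V′ 4 S-Supp)

-- Modulo 16 the exponents of P and R are 0, those of S′ and T are 4. This puts `octic` in the class
-- 8 and `octic′` in the class 0.
octic-PSRT : octic P S′ R T ≈ κ 0ℤ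
octic-PSRT = Supp-disjoint {16} {8} {0} (λ ()) octic-Supp octic′-Supp
  (·-cancel 0 (κ (+ 4)) _ (λ ()) (octic-split p s r t P S′ R T p²≈ r²≈ s²≈ t²≈ modular-prst))
  where
  ε-Supp : Supp 16 4 (ε P S′ R T)
  ε-Supp = Supp-⊝ (Supp-· P-Supp S-Supp) (Supp-· R-Supp T-Supp)
  κ-Supp : ∀ c {f r} → Supp 16 r f → Supp 16 r (κ c · f)
  κ-Supp c h = Supp-· (Supp-κ c) h
  b₀-Supp : Supp 16 12 (b₀ P S′ R T)
  b₀-Supp = Supp-⊕ (Supp-· (Supp-⊝ (Supp-· S-Supp S-Supp) (Supp-· T-Supp T-Supp)) ε-Supp)
    (κ-Supp (+ 4) (Supp-· R-Supp (Supp-· (Supp-· T-Supp T-Supp) T-Supp)))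
  b₁-Supp : Supp 16 4 (b₁ P S′ R T)
  b₁-Supp = Supp-⊕ (Supp-· (Supp-⊝ (Supp-· P-Supp P-Supp) (Supp-· R-Supp R-Supp)) ε-Supp)
    (κ-Supp (+ 4) (Supp-· (Supp-· (Supp-· R-Supp R-Supp) R-Supp) T-Supp))
  octic-Supp : Supp 16 8 (octic P S′ R T)
  octic-Supp = Supp-⊝
    (Supp-⊕ (Supp-% refl (Supp-· b₀-Supp b₀-Supp)) (Supp-· b₁-Supp b₁-Supp))
    (κ-Supp (+ 16) (Supp-· (Supp-· (Supp-· P-Supp S-Supp) (Supp-· R-Supp T-Supp))
      (Supp-⊕ (Supp-· (Supp-· P-Supp P-Supp) (Supp-· R-Supp R-Supp))
        (Supp-% refl (Supp-· (Supp-· S-Supp S-Supp) (Supp-· T-Supp T-Supp))))))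
  octic′-Supp : Supp 16 0 (octic′ P S′ R T)
  octic′-Supp = Supp-⊝
    (Supp-% refl (κ-Supp (+ 2) (Supp-· b₀-Supp b₁-Supp)))
    (κ-Supp (+ 16) (Supp-% refl (Supp-· (Supp-· (Supp-· P-Supp S-Supp) (Supp-· R-Supp T-Supp))
      (Supp-⊕ (Supp-· (Supp-· P-Supp P-Supp) (Supp-· T-Supp T-Supp))
        (Supp-· (Supp-· S-Supp S-Supp) (Supp-· R-Supp R-Supp))))))

octic-prst : octic p s r t ≈ κ 0ℤ
octic-prst = V-injective 1 (V₂octic ⨾ octic-PSRT ⨾ ≈-sym (V-κ 1 0ℤ))
  where
  refl≈ : ∀ {f} → f ≈ f
  refl≈ _ = refl
  V₂p : V₂ p ≈ P
  V₂p = refl≈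
  V₂s : V₂ s ≈ S′
  V₂s = refl≈
  V₂ε : V₂ (ε p s r t) ≈ ε P S′ R T
  V₂ε = V⟨⊝⟩ 1 (V⟨·⟩ 1 V₂p V₂s) (V⟨·⟩ 1 V₂r≈ V₂t≈)
  V₂b₀ : V₂ (b₀ p s r t) ≈ b₀ P S′ R T
  V₂b₀ = V⟨⊕⟩ 1 (V⟨·⟩ 1 (V⟨Δ⟩ 1 V₂s V₂t≈) V₂ε)
    (V⟨·⟩ 1 (V-κ 1 (+ 4)) (V⟨·⟩ 1 V₂r≈ (V⟨·⟩ 1 (V⟨·⟩ 1 V₂t≈ V₂t≈) V₂t≈)))
  V₂b₁ : V₂ (b₁ p s r t) ≈ b₁ P S′ R T
  V₂b₁ = V⟨⊕⟩ 1 (V⟨·⟩ 1 (V⟨Δ⟩ 1 V₂p V₂r≈) V₂ε)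
    (V⟨·⟩ 1 (V-κ 1 (+ 4)) (V⟨·⟩ 1 (V⟨·⟩ 1 (V⟨·⟩ 1 V₂r≈ V₂r≈) V₂r≈) V₂t≈))
  V₂octic : V₂ (octic p s r t) ≈ octic P S′ R T
  V₂octic = V⟨⊝⟩ 1
    (V⟨⊕⟩ 1 (V⟨·⟩ 1 V₂b₀ V₂b₀) (V⟨·⟩ 1 V₂b₁ V₂b₁))
    (V⟨·⟩ 1 (V-κ 1 (+ 16)) (V⟨·⟩ 1 (V⟨·⟩ 1 (V⟨·⟩ 1 V₂p V₂s) (V⟨·⟩ 1 V₂r≈ V₂t≈))
      (V⟨⊕⟩ 1 (V⟨·⟩ 1 (V⟨·⟩ 1 V₂p V₂p) (V⟨·⟩ 1 V₂r≈ V₂r≈))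
             (V⟨·⟩ 1 (V⟨·⟩ 1 V₂s V₂s) (V⟨·⟩ 1 V₂t≈ V₂t≈)))))

opaque
  unfolding _·_

  factor-4 : factor p s r t 4 ≡ + 4
  factor-4 = refl

  s²-5t²-4 : (s · s ⊝ κ (+ 5) · (t · t)) 4 ≡ + 4
  s²-5t²-4 = refl

  -- Both summands begin with 16 q¹⁵. This decides the sign: the sum is not zero, so the difference
  -- is.
  cubic-15 : (o · t · Δ s t ⊕ s · u · Δ p r) 15 ≡ + 32
  cubic-15 = refl

nonzero : ∀ {x m} → x ≡ + suc m → x ≢ 0ℤ
nonzero refl ()

quartic-prst : quartic p s r t ≈ κ 0ℤ
quartic-prst = ·-cancel 4 (factor p s r t) _ (nonzero factor-4) (octic-factors p s r t modular-prst octic-prst)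

sextic-prst : sextic p s r t ≈ κ 0ℤ
sextic-prst = ·-cancel 4 (s · s ⊝ κ (+ 5) · (t · t)) _ (nonzero s²-5t²-4) (sextic-multiple p s r t modular-prst quartic-prst)

otΔ≈suΔ : o · t · Δ s t ≈ s · u · Δ p r
otΔ≈suΔ = equality (·-cancel 15 (o · t · Δ s t ⊕ s · u · Δ p r) _ (nonzero cubic-15)
  (cubic-squared p s r t o u o²≈ u²≈ sextic-prst))

o-cancel : ∀ {f} → o · f ≈ κ 0ℤ → f ≈ κ 0ℤ
o-cancel = ·-cancel 1 o _ (λ ())

u-cancel : ∀ {f} → u · f ≈ κ 0ℤ → f ≈ κ 0ℤ
u-cancel = ·-cancel 5 u _ (λ ())

t-cancel : ∀ {f} → t · f ≈ κ 0ℤ → f ≈ κ 0ℤ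
t-cancel = ·-cancel 10 t _ (λ ())

X Y W : Series
X = o · o · o · u
Y = o · (u · u · u)
W = ω o u

sW : s · (Δ p r · Δ p r) ≈ W · t
sW = equality (u-cancel (ω-multiple (Δ p r) s t o u otΔ≈suΔ Δou·u²≈))

V₂W : V₂ W ≈ ω s t
V₂W = V⟨⊝⟩ 1 (V⟨·⟩ 1 (V⟨·⟩ 1 (V-· 1 o o) (λ _ → refl)) V₂u≈)
  (V⟨·⟩ 1 {o} {u · u · u} (λ _ → refl) (V⟨·⟩ 1 (V⟨·⟩ 1 V₂u≈ V₂u≈) V₂u≈))

Δpr≈ : Δ p r ≈ Δ P R ⊕ Δ S′ T
Δpr≈ = ⊝-cong p²≈ r²≈ ⨾ λ n → lemma ((P · P) n) ((S′ · S′) n) ((R · R) n) ((T · T) n)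
  where
  lemma : ∀ a b c d → a + b - (c + d) ≡ a - c + (b - d)
  lemma = solve-∀

Δst·t²≈ : Δ s t · (t · t) ≈ Δ P R · Δ S′ T
Δst·t²≈ =
  ≈-sym (V⟨·⟩ 1 {Δ o u} {u · u} (V⟨Δ⟩ 1 {o} {u} (λ _ → refl) V₂u≈) (V⟨·⟩ 1 V₂u≈ V₂u≈))
  ⨾ V-cong 1 Δou·u²≈
  ⨾ V⟨·⟩ 1 {Δ p r} {Δ s t} (V⟨Δ⟩ 1 {p} {r} (λ _ → refl) V₂r≈) (V⟨Δ⟩ 1 {s} {t} (λ _ → refl) V₂t≈)

W-even : (W ⊝ κ (+ 2) · ω s t) · t ≈ s · (Δ P R · Δ P R ⊕ Δ S′ T · Δ S′ T)
W-even = ω-even W (Δ p r) s t (Δ P R) (Δ S′ T) sW Δpr≈ Δst·t²≈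

u-Supp : Supp 8 5 u
u-Supp = Supp-V′ 4 O-Supp

W-Supp : Supp 8 0 W
W-Supp = Supp-⊝
  (Supp-% refl (Supp-· (Supp-· (Supp-· O-Supp O-Supp) O-Supp) u-Supp))
  (Supp-% refl (Supp-· O-Supp (Supp-· (Supp-· u-Supp u-Supp) u-Supp)))

8∣⇒mod16 : ∀ n → n % 8 ≡ 0 → n % 16 ≢ 0 → n % 16 ≡ 8
8∣⇒mod16 n n%8≡0 n%16≢0 = subst (λ m → m % 8 ≡ 0 → m ≢ 0 → m ≡ 8) (Fin.toℕ-fromℕ< (m%n<n n 16))
  (toWitness {a? = Fin.all? {n = 16} {P = λ i → toℕ i % 8 ≡ 0 → toℕ i ≢ 0 → toℕ i ≡ 8}
    (λ i → (toℕ i % 8 ℕ.≟ 0) →-dec (¬? (toℕ i ℕ.≟ 0) →-dec (toℕ i ℕ.≟ 8)))} _ (n mod 16))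
  (trans (m∣n⇒o%n%m≡o%m 8 16 n (ℕ.divides 2 refl)) n%8≡0) n%16≢0

-- If f t lives in the class 2 mod 16 and t in the class 10, then f lives in the class 8.
W-double : ∀ m → W (m ℕ.* 8 ℕ.* 2) ≡ + 2 * W (m ℕ.* 8)
W-double m = ℤ.i-j≡0⇒i≡j (W k) (+ 2 * W (m ℕ.* 8)) (begin
  W k - + 2 * W (m ℕ.* 8)       ≡⟨ cong (λ z → W k - + 2 * z) (sym (trans (sym (V₂W k)) (V-coefficient 1 W (m ℕ.* 8)))) ⟩
  W k - + 2 * ω s t k         ≡⟨ cong (λ z → W k - z) (sym (κ-· (+ 2) (ω s t) k)) ⟩
  f k                            ≡⟨ sym (f₀-0 k k%16≡0) ⟩
  f₀ k                           ≡⟨ trans (t-cancel tf₀≈0 k) (κ0 k) ⟩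
  0ℤ                             ∎)
  where
  open ≡-Reasoning
  k : ℕ
  k = m ℕ.* 8 ℕ.* 2
  k%16≡0 : k % 16 ≡ 0
  k%16≡0 = trans (cong (_% 16) (ℕ.*-assoc m 8 2)) (m*n%n≡0 m 16)
  f f₀ f₈ : Series
  f = W ⊝ κ (+ 2) · ω s t
  f₀ n with n % 16 ℕ.≟ 0
  ... | yes _ = f n
  ... | no  _ = 0ℤ
  f₈ n with n % 16 ℕ.≟ 0
  ... | yes _ = 0ℤ
  ... | no  _ = f n
  f₀-0 : ∀ n → n % 16 ≡ 0 → f₀ n ≡ f n
  f₀-0 n p with n % 16 ℕ.≟ 0
  ... | yes _ = refl
  ... | no ¬p = contradiction p ¬p
  f≈ : f ≈ f₀ ⊕ f₈
  f≈ n with n % 16 ℕ.≟ 0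
  ... | yes _ = sym (ℤ.+-identityʳ (f n))
  ... | no  _ = sym (ℤ.+-identityˡ (f n))
  f-Supp : Supp 8 0 f
  f-Supp = Supp-⊝ W-Supp (Supp-· (Supp-κ (+ 2)) (Supp-cong V₂W (Supp-V′ 1 W-Supp)))
  f₀-Supp : Supp 16 0 f₀
  f₀-Supp = supp go
    where
    go : ∀ n → f₀ n ≡ 0ℤ ⊎ n % 16 ≡ 0
    go n with n % 16 ℕ.≟ 0
    ... | yes p = inj₂ p
    ... | no  _ = inj₁ refl
  f₈-Supp : Supp 16 8 f₈
  f₈-Supp = supp go
    where
    go : ∀ n → f₈ n ≡ 0ℤ ⊎ n % 16 ≡ 8
    go n with n % 16 ℕ.≟ 0
    ... | yes _ = inj₁ refl
    ... | no ¬p = map₂ (λ q → 8∣⇒mod16 n q ¬p) (Supp.supported f-Supp n)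
  t-Supp : Supp 16 10 t
  t-Supp = Supp-V′ 4 s-Supp
  ft-Supp : Supp 16 2 (f · t)
  ft-Supp = Supp-cong (≈-sym W-even) (Supp-· s-Supp
    (Supp-⊕ (Supp-· ΔPR ΔPR) (Supp-% refl (Supp-· ΔST ΔST))))
    where
    ΔPR : Supp 16 0 (Δ P R)
    ΔPR = Supp-⊝ (Supp-· P-Supp P-Supp) (Supp-· R-Supp R-Supp)
    ΔST : Supp 16 8 (Δ S′ T)
    ΔST = Supp-⊝ (Supp-· S-Supp S-Supp) (Supp-· T-Supp T-Supp)
  tf₀≈0 : t · f₀ ≈ κ 0ℤ
  tf₀≈0 = ·-comm t f₀ ⨾ Supp-disjoint {16} {10} {2} (λ ())
    (Supp-· f₀-Supp t-Supp) (Supp-⊝ (Supp-% refl (Supp-· f₈-Supp t-Supp)) ft-Supp)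
    λ n → trans (cong (λ z → (f₀ · t) n + ((f₈ · t) n - z)) (trans (·-congʳ t f≈ n) (·-distribʳ t f₀ f₈ n)))
            (trans (lemma ((f₀ · t) n) ((f₈ · t) n)) (sym (κ0 n)))
    where
    lemma : ∀ a b → a + (b - (a + b)) ≡ 0ℤ
    lemma = solve-∀

-- Dissection modulo 5

sq-residue : ∀ x → sq x % 5 ≡ (toℕ (res x) ℕ.* toℕ (res x)) % 5
sq-residue (+ n) = trans (%-distribˡ-* n n 5) (trans (cong (λ a → (a ℕ.* a) % 5) (sym r%5)) (sym (%-distribˡ-* (toℕ (n mod 10)) (toℕ (n mod 10)) 5)))
  where
  r%5 : toℕ (n mod 10) % 5 ≡ n % 5
  r%5 = trans (cong (_% 5) (toℕ-mod n)) (m∣n⇒o%n%m≡o%m 5 10 n (ℕ.divides 2 refl))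
sq-residue -[1+ n ] = begin
  -- The representative of a negative number is 9 times its absolute value, and 9² = 1 + 16 · 5.
  (suc n ℕ.* suc n) % 5                                ≡⟨ sym ([m+kn]%n≡m%n (suc n ℕ.* suc n) (16 ℕ.* (suc n ℕ.* suc n)) 5) ⟩
  (suc n ℕ.* suc n ℕ.+ 16 ℕ.* (suc n ℕ.* suc n) ℕ.* 5) % 5 ≡⟨ cong (_% 5) (lemma (suc n)) ⟩
  (m ℕ.* m) % 5                                        ≡⟨ sq-residue (+ m) ⟩
  (toℕ (m mod 10) ℕ.* toℕ (m mod 10)) % 5              ∎
  where
  open ≡-Reasoning
  m : ℕ
  m = 9 ℕ.* suc n
  lemma : ∀ a → a ℕ.* a ℕ.+ 16 ℕ.* (a ℕ.* a) ℕ.* 5 ≡ 9 ℕ.* a ℕ.* (9 ℕ.* a)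
  lemma = solveℕ-∀

θ-square-Supp : ∀ g c → c < 5 → Supp 5 c (θ (g ⊓ square c))
θ-square-Supp g c c<5 = supp λ n → ⟶-elim (term n) (θ₁.sum₁ (θ-θ₁ (g ⊓ square c)) n)
  where
  square-off : ∀ i → square c i ≡ 0ℤ ⊎ (toℕ i ℕ.* toℕ i) % 5 ≡ c
  square-off i with (toℕ i ℕ.* toℕ i) % 5 ℕ.≡ᵇ c in eq
  ... | true  = inj₂ (ℕ.≡ᵇ⇒≡ _ c (subst Bool.T (sym eq) _))
  ... | false = inj₁ refl
  term : ∀ n x → ((g ⊓ square c) (res x) q^ (1 ℕ.* sq x)) n ≡ 0ℤ ⊎ n % 5 ≡ c % 5
  term n x with square-off (res x) | q^-support (1 ℕ.* sq x) n
  ... | inj₁ z | _ = inj₁ (cong (_* (q^ (1 ℕ.* sq x)) n) (trans (cong (g (res x) *_) z) (ℤ.*-zeroʳ (g (res x)))))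
  ... | inj₂ _ | inj₁ z = inj₁ (trans (cong ((g ⊓ square c) (res x) *_) z) (ℤ.*-zeroʳ ((g ⊓ square c) (res x))))
  ... | inj₂ a | inj₂ refl = inj₂ (trans (cong (_% 5) (ℕ.*-identityˡ (sq x)))
          (trans (sq-residue x) (trans a (sym (m<n⇒m%n≡m c<5)))))

T₁-Supp : Supp 5 1 T₁
T₁-Supp = θ-square-Supp odd 1 (s≤s (s≤s z≤n))

T₄-Supp : Supp 5 4 T₄
T₄-Supp = θ-square-Supp odd 4 (s≤s (s≤s (s≤s (s≤s (s≤s z≤n)))))

z : Series
z = V₅ u

z-Supp : Supp 5 0 z
z-Supp = Supp-V₀ 4 u

u-Supp₅ : Supp 5 0 u
u-Supp₅ = Supp-V₀ 4 o

T₁T₄+z² : T₁ · T₄ ⊕ z · z ≈ u · u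
T₁T₄+z² = T₁T₄≈ ⨾ V-· 4 O O

u³ : Series
u³ = u · u · u

u³-Supp : Supp 5 0 u³
u³-Supp = Supp-· (Supp-· u-Supp₅ u-Supp₅) u-Supp₅

X₀ X₁ X₂ X₃ X₄ : Series
X₀ = (z · z · z ⊕ κ (+ 6) · (T₁ · T₄ · z)) · u
X₁ = κ (+ 3) · (T₁ · u³)
X₂ = (T₄ · T₄ · T₄ ⊕ κ (+ 3) · (T₁ · T₁ · z)) · u
X₃ = (T₁ · T₁ · T₁ ⊕ κ (+ 3) · (T₄ · T₄ · z)) · u
X₄ = κ (+ 3) · (T₄ · u³)

X-split : X ≈ X₀ ⊕ X₁ ⊕ X₂ ⊕ X₃ ⊕ X₄
X-split = ·-congʳ u (·-cong (·-cong O-split O-split) O-split) ⨾ cube-split T₁ T₄ z u T₁T₄+z²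

Y-split : Y ≈ T₁ · u³ ⊕ T₄ · u³ ⊕ z · u³
Y-split = ·-congʳ u³ O-split ⨾ ·-distribʳ u³ (T₁ ⊕ T₄) z ⨾ λ n → cong (_+ (z · u³) n) (·-distribʳ u³ T₁ T₄ n)

X₀-Supp : Supp 5 0 X₀
X₀-Supp = Supp-· (Supp-⊕ (Supp-· (Supp-· z-Supp z-Supp) z-Supp)
  (Supp-% refl (Supp-· (Supp-κ (+ 6)) (Supp-· (Supp-· T₁-Supp T₄-Supp) z-Supp)))) u-Supp₅

X₁-Supp : Supp 5 1 X₁
X₁-Supp = Supp-· (Supp-κ (+ 3)) (Supp-· T₁-Supp u³-Supp)

X₂-Supp : Supp 5 2 X₂
X₂-Supp = Supp-· (Supp-⊕ (Supp-% refl (Supp-· (Supp-· T₄-Supp T₄-Supp) T₄-Supp))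
  (Supp-· (Supp-κ (+ 3)) (Supp-· (Supp-· T₁-Supp T₁-Supp) z-Supp))) u-Supp₅

X₃-Supp : Supp 5 3 X₃
X₃-Supp = Supp-· (Supp-⊕ (Supp-· (Supp-· T₁-Supp T₁-Supp) T₁-Supp)
  (Supp-% refl (Supp-· (Supp-κ (+ 3)) (Supp-· (Supp-· T₄-Supp T₄-Supp) z-Supp)))) u-Supp₅

X₄-Supp : Supp 5 4 X₄
X₄-Supp = Supp-· (Supp-κ (+ 3)) (Supp-· T₄-Supp u³-Supp)

vanishes : ∀ {d r f} .{{_ : NonZero d}} → Supp d r f → ∀ n → n % d ≢ r % d → f n ≡ 0ℤ
vanishes (supp h) n n≢r with h n
... | inj₁ e = e
... | inj₂ e = contradiction e n≢r

distinct : ∀ {n a b : ℕ} → n ≡ a → a ≢ b → n ≢ b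
distinct refl a≢b = a≢b

V₅-at : ∀ f m → V₅ f (m ℕ.* 5) ≡ f m
V₅-at = V-coefficient 4

-- As u³ is a series in q⁵, only the part z of o contributes, and z u³ comes from u o³ by q ↦ q⁵.
Y-5 : ∀ m → Y (m ℕ.* 5) ≡ X m
Y-5 m = begin
  Y k                                             ≡⟨ Y-split k ⟩
  (T₁ · u³) k + (T₄ · u³) k + (z · u³) k          ≡⟨ cong₂ (λ a b → a + b + (z · u³) k)
      (vanishes (Supp-· T₁-Supp u³-Supp) k (distinct (m*n%n≡0 m 5) λ ()))
      (vanishes (Supp-· T₄-Supp u³-Supp) k (distinct (m*n%n≡0 m 5) λ ())) ⟩
  0ℤ + 0ℤ + (z · u³) k                            ≡⟨ ℤ.+-identityˡ _ ⟩
  (z · u³) k                                      ≡⟨ sym (V⟨·⟩ 4 {u} {o · o · o} (λ _ → refl) (V⟨·⟩ 4 (V-· 4 o o) (λ _ → refl)) k) ⟩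
  V₅ (u · (o · o · o)) k                          ≡⟨ V₅-at _ m ⟩
  (u · (o · o · o)) m                             ≡⟨ ·-comm u (o · o · o) m ⟩
  X m                                             ∎
  where
  open ≡-Reasoning
  k : ℕ
  k = m ℕ.* 5

X-5 : ∀ m → X (m ℕ.* 5) ≡ + 6 * X m - + 5 * Y m
X-5 m = begin
  X k                                        ≡⟨ X-split k ⟩
  X₀ k + X₁ k + X₂ k + X₃ k + X₄ k           ≡⟨ cong₂ (λ a b → X₀ k + a + b + X₃ k + X₄ k) (off X₁-Supp λ ()) (off X₂-Supp λ ()) ⟩
  X₀ k + 0ℤ + 0ℤ + X₃ k + X₄ k               ≡⟨ cong₂ (λ a b → X₀ k + 0ℤ + 0ℤ + a + b) (off X₃-Supp λ ()) (off X₄-Supp λ ()) ⟩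
  X₀ k + 0ℤ + 0ℤ + 0ℤ + 0ℤ                   ≡⟨ lemma (X₀ k) ⟩
  X₀ k                                       ≡⟨ sym (V₅K k) ⟩
  V₅ K k                                     ≡⟨ V₅-at K m ⟩
  K m                                        ≡⟨ dissected o u m ⟩
  (κ (+ 6) · X ⊝ κ (+ 5) · Y) m              ≡⟨ cong₂ _-_ (κ-· (+ 6) X m) (κ-· (+ 5) Y m) ⟩
  + 6 * X m - + 5 * Y m                      ∎
  where
  open ≡-Reasoning
  k : ℕ
  k = m ℕ.* 5
  off : ∀ {c f} → Supp 5 c f → 0 ≢ c % 5 → f k ≡ 0ℤ
  off h 0≢c = vanishes h k (distinct (m*n%n≡0 m 5) 0≢c)
  lemma : ∀ a → a + 0ℤ + 0ℤ + 0ℤ + 0ℤ ≡ a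
  lemma = solve-∀
  K : Series
  K = (u · u · u ⊕ κ (+ 6) · (Δ o u · u)) · o
  V₅K : V₅ K ≈ X₀
  V₅K = V⟨·⟩ 4 (V⟨⊕⟩ 4 (V⟨·⟩ 4 (V-· 4 u u) (λ _ → refl))
    (V⟨·⟩ 4 (V-κ 4 (+ 6)) (V⟨·⟩ 4 {Δ o u} {u} (≈-sym T₁T₄≈Δ) (λ _ → refl)))) (λ _ → refl)

-- The classes 1 and 4 are 8 times the classes ±2 modulo 5. In them X has the components 3 T₁ u³ and
-- 3 T₄ u³, three times those of Y.
X≡3Y : ∀ n → n % 5 ≡ 1 ⊎ n % 5 ≡ 4 → X n ≡ + 3 * Y n
X≡3Y n (inj₁ e) = begin
  X n                                        ≡⟨ X-split n ⟩
  X₀ n + X₁ n + X₂ n + X₃ n + X₄ n           ≡⟨ cong₂ (λ a b → a + X₁ n + b + X₃ n + X₄ n) (off X₀-Supp λ ()) (off X₂-Supp λ ()) ⟩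
  0ℤ + X₁ n + 0ℤ + X₃ n + X₄ n               ≡⟨ cong₂ (λ a b → 0ℤ + X₁ n + 0ℤ + a + b) (off X₃-Supp λ ()) (off X₄-Supp λ ()) ⟩
  0ℤ + X₁ n + 0ℤ + 0ℤ + 0ℤ                   ≡⟨ cong (λ a → 0ℤ + a + 0ℤ + 0ℤ + 0ℤ) (κ-· (+ 3) (T₁ · u³) n) ⟩
  0ℤ + + 3 * (T₁ · u³) n + 0ℤ + 0ℤ + 0ℤ      ≡⟨ lemma ((T₁ · u³) n) ⟩
  + 3 * ((T₁ · u³) n + 0ℤ + 0ℤ)              ≡⟨ cong₂ (λ a b → + 3 * ((T₁ · u³) n + a + b))
      (sym (off (Supp-· T₄-Supp u³-Supp) λ ())) (sym (off (Supp-· z-Supp u³-Supp) λ ())) ⟩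
  + 3 * ((T₁ · u³) n + (T₄ · u³) n + (z · u³) n) ≡⟨ cong (+ 3 *_) (sym (Y-split n)) ⟩
  + 3 * Y n                                  ∎
  where
  open ≡-Reasoning
  off : ∀ {c f} → Supp 5 c f → 1 ≢ c % 5 → f n ≡ 0ℤ
  off h 1≢c = vanishes h n (distinct e 1≢c)
  lemma : ∀ a → 0ℤ + + 3 * a + 0ℤ + 0ℤ + 0ℤ ≡ + 3 * (a + 0ℤ + 0ℤ)
  lemma = solve-∀
X≡3Y n (inj₂ e) = begin
  X n                                        ≡⟨ X-split n ⟩
  X₀ n + X₁ n + X₂ n + X₃ n + X₄ n           ≡⟨ cong₂ (λ a b → a + X₁ n + b + X₃ n + X₄ n) (off X₀-Supp λ ()) (off X₂-Supp λ ()) ⟩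
  0ℤ + X₁ n + 0ℤ + X₃ n + X₄ n               ≡⟨ cong₂ (λ a b → 0ℤ + a + 0ℤ + b + X₄ n) (off X₁-Supp λ ()) (off X₃-Supp λ ()) ⟩
  0ℤ + 0ℤ + 0ℤ + 0ℤ + X₄ n                   ≡⟨ cong (λ a → 0ℤ + 0ℤ + 0ℤ + 0ℤ + a) (κ-· (+ 3) (T₄ · u³) n) ⟩
  0ℤ + 0ℤ + 0ℤ + 0ℤ + + 3 * (T₄ · u³) n      ≡⟨ lemma ((T₄ · u³) n) ⟩
  + 3 * (0ℤ + (T₄ · u³) n + 0ℤ)              ≡⟨ cong₂ (λ a b → + 3 * (a + (T₄ · u³) n + b))
      (sym (off (Supp-· T₁-Supp u³-Supp) λ ())) (sym (off (Supp-· z-Supp u³-Supp) λ ())) ⟩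
  + 3 * ((T₁ · u³) n + (T₄ · u³) n + (z · u³) n) ≡⟨ cong (+ 3 *_) (sym (Y-split n)) ⟩
  + 3 * Y n                                  ∎
  where
  open ≡-Reasoning
  off : ∀ {c f} → Supp 5 c f → 4 ≢ c % 5 → f n ≡ 0ℤ
  off h 4≢c = vanishes h n (distinct e 4≢c)
  lemma : ∀ a → 0ℤ + 0ℤ + 0ℤ + 0ℤ + + 3 * a ≡ + 3 * (0ℤ + a + 0ℤ)
  lemma = solve-∀

-- The quotient ψ(q⁵)⁵ / ψ(q)

parity : ∀ m → ∃ λ k → m ≡ k ℕ.* 2 ⊎ m ≡ suc (k ℕ.* 2)
parity zero    = 0 , inj₁ refl
parity (suc m) with parity m
... | k , inj₁ refl = k , inj₂ refl
... | k , inj₂ refl = suc k , inj₁ refl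

evens odds : Series → Series
evens f n = f (n ℕ.* 2)
odds  f n = f (suc (n ℕ.* 2))

bisect : ∀ f → f ≈ V₂ (evens f) ⊕ stretch 1 1 (odds f)
bisect f zero          = sym (ℤ.+-identityʳ (f 0))
bisect f (suc zero)    = sym (ℤ.+-identityˡ (f 1))
bisect f (suc (suc n)) = bisect (tail (tail f)) n

stretch-1-even : ∀ f k → stretch 1 1 f (k ℕ.* 2) ≡ 0ℤ
stretch-1-even f zero    = refl
stretch-1-even f (suc k) = stretch-1-even (tail f) k

module Quotient (C : Series) (C·o≈ : C · o ≈ u · (u · (u · (u · u)))) where

  D G : Series
  D = Y ⊝ C
  G = evens D

  -- One has o D = u³ Δ(o,u), and the two modular relations turn s u³ Δ(o,u) into o t Δ(s,t)². The
  -- right side and s are series in q², and so D must be one as well.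
  D·s≈ : D · s ≈ t · (Δ s t · Δ s t)
  D·s≈ = equality (o-cancel (quotient-even (Δ p r) s t o u C C·o≈ otΔ≈suΔ Δou·u²≈))

  D·s-bisected : V₂ (G · o) ⊕ stretch 1 1 (odds D · o) ≈ V₂ (u · (Δ o u · Δ o u))
  D·s-bisected =
    ⊕-cong (V-· 1 G o) (stretch-· 1 1 (odds D) o)
    ⨾ ≈-sym (·-distribʳ s (V₂ G) (stretch 1 1 (odds D)))
    ⨾ ·-congʳ s (≈-sym (bisect D))
    ⨾ D·s≈
    ⨾ ≈-sym (V⟨·⟩ 1 {u} {Δ o u · Δ o u} V₂u≈ (V⟨·⟩ 1 {Δ o u} {Δ o u} V₂Δ V₂Δ))
    where
    V₂Δ : V₂ (Δ o u) ≈ Δ s t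
    V₂Δ = V⟨Δ⟩ 1 {o} {u} (λ _ → refl) V₂u≈

  G·o≈ : G · o ≈ u · (Δ o u · Δ o u)
  G·o≈ k = begin
    (G · o) k                                                        ≡⟨ sym (V-coefficient 1 (G · o) k) ⟩
    V₂ (G · o) (k ℕ.* 2)                                             ≡⟨ sym (ℤ.+-identityʳ _) ⟩
    V₂ (G · o) (k ℕ.* 2) + 0ℤ                                        ≡⟨ cong (λ e → V₂ (G · o) (k ℕ.* 2) + e) (sym (stretch-1-even (odds D · o) k)) ⟩
    (V₂ (G · o) ⊕ stretch 1 1 (odds D · o)) (k ℕ.* 2)                ≡⟨ D·s-bisected (k ℕ.* 2) ⟩
    V₂ (u · (Δ o u · Δ o u)) (k ℕ.* 2)                               ≡⟨ V-coefficient 1 _ k ⟩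
    (u · (Δ o u · Δ o u)) k                                          ∎
    where open ≡-Reasoning

  odds-D≈0 : odds D ≈ κ 0ℤ
  odds-D≈0 = o-cancel (·-comm o (odds D) ⨾ λ k → trans (value k) (sym (κ0 k)))
    where
    open ≡-Reasoning
    value : ∀ k → (odds D · o) k ≡ 0ℤ
    value k = begin
      (odds D · o) k                                                  ≡⟨ sym (stretch-coefficient 1 1 (odds D · o) k) ⟩
      stretch 1 1 (odds D · o) (suc (k ℕ.* 2))                        ≡⟨ sym (ℤ.+-identityˡ _) ⟩
      0ℤ + stretch 1 1 (odds D · o) (suc (k ℕ.* 2))                   ≡⟨ cong (_+ stretch 1 1 (odds D · o) (suc (k ℕ.* 2))) (sym (stretch-1-even (tail (G · o)) k)) ⟩
      (V₂ (G · o) ⊕ stretch 1 1 (odds D · o)) (suc (k ℕ.* 2))         ≡⟨ D·s-bisected (suc (k ℕ.* 2)) ⟩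
      V₂ (u · (Δ o u · Δ o u)) (suc (k ℕ.* 2))                        ≡⟨ stretch-1-even (tail (u · (Δ o u · Δ o u))) k ⟩
      0ℤ                                                              ∎

  G+D≡W : ∀ n → G n + D n ≡ W n
  G+D≡W = equality (o-cancel (quotient-sum o u C G C·o≈ G·o≈))

  x y w g c : ℕ → ℤ
  x m = X (m ℕ.* 8)
  y m = Y (m ℕ.* 8)
  w m = W (m ℕ.* 8)
  g m = G (m ℕ.* 8)
  c m = C (m ℕ.* 8)

  -- With G + D = W, D = G(q²) and W supported on multiples of 8, halving the index twice gives
  -- G(4m) = -G(2m) = G(m). For odd m this is zero because D has no odd exponents.
  G-odd : ∀ k → G (suc (k ℕ.* 2) ℕ.* 4) ≡ 0ℤ
  G-odd k = trans (cong G (*2*2 m)) (trans (step (m ℕ.* 2) (vanishes {8} W-Supp _ (distinct m*4%8 λ ())))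
    (cong -_ (trans (step m (vanishes {4} (Supp-divisor (ℕ.divides 2 refl) W-Supp) _ (distinct m*2%4 λ ())))
      (cong -_ G-m))))
    where
    m : ℕ
    m = suc (k ℕ.* 2)
    *2*2 : ∀ m → m ℕ.* 4 ≡ m ℕ.* 2 ℕ.* 2
    *2*2 = solveℕ-∀
    m*4%8 : (m ℕ.* 2 ℕ.* 2) % 8 ≡ 4
    m*4%8 = trans (cong (_% 8) (lemma k)) ([m+kn]%n≡m%n 4 k 8)
      where
      lemma : ∀ k → suc (k ℕ.* 2) ℕ.* 2 ℕ.* 2 ≡ 4 ℕ.+ k ℕ.* 8
      lemma = solveℕ-∀
    m*2%4 : (m ℕ.* 2) % 4 ≡ 2
    m*2%4 = trans (cong (_% 4) (lemma k)) ([m+kn]%n≡m%n 2 k 4)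
      where
      lemma : ∀ k → suc (k ℕ.* 2) ℕ.* 2 ≡ 2 ℕ.+ k ℕ.* 4
      lemma = solveℕ-∀
    solved : ∀ a b → a ≡ a + b - b
    solved = solve-∀
    step : ∀ n → W (n ℕ.* 2) ≡ 0ℤ → G (n ℕ.* 2) ≡ - G n
    step n W≡0 = trans (solved (G (n ℕ.* 2)) (G n))
      (trans (cong (_- G n) (trans (G+D≡W (n ℕ.* 2)) W≡0)) (ℤ.+-identityˡ (- G n)))
    G-m : G m ≡ 0ℤ
    G-m = trans (solved (G m) (D m)) (cong₂ _-_
      (trans (G+D≡W m) (vanishes {2} (Supp-divisor (ℕ.divides 4 refl) W-Supp) m (distinct ([m+kn]%n≡m%n 1 k 2) λ ())))
      (trans (odds-D≈0 k) (κ0 k)))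

  D-8 : ∀ m → D (m ℕ.* 8) ≡ G (m ℕ.* 4)
  D-8 m = cong D (sym (ℕ.*-assoc m 4 2))

  D-16 : ∀ k → D (k ℕ.* 2 ℕ.* 8) ≡ g k
  D-16 k = cong D (lemma k)
    where
    lemma : ∀ k → k ℕ.* 2 ℕ.* 8 ≡ k ℕ.* 8 ℕ.* 2
    lemma = solveℕ-∀

  c-odd : ∀ k → c (suc (k ℕ.* 2)) ≡ y (suc (k ℕ.* 2))
  c-odd k = sym (ℤ.i-j≡0⇒i≡j (y m) (c m) (trans (D-8 m) (G-odd k)))
    where
    m : ℕ
    m = suc (k ℕ.* 2)

  c-even : ∀ k → c (k ℕ.* 2) ≡ y (k ℕ.* 2) - g k
  c-even k = trans (lemma (y m) (c m)) (cong (λ e → y m - e) (D-16 k))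
    where
    m : ℕ
    m = k ℕ.* 2
    lemma : ∀ a b → b ≡ a - (a - b)
    lemma = solve-∀

  g-odd : ∀ k → g (suc (k ℕ.* 2)) ≡ w (suc (k ℕ.* 2))
  g-odd k = trans (sym (ℤ.+-identityʳ (g m))) (trans (cong (λ e → g m + e) (sym (trans (D-8 m) (G-odd k)))) (G+D≡W (m ℕ.* 8)))
    where
    m : ℕ
    m = suc (k ℕ.* 2)

  g-even : ∀ k → g (k ℕ.* 2) ≡ w (k ℕ.* 2) - g k
  g-even k = trans (lemma (g m) (D (m ℕ.* 8))) (cong₂ _-_ (G+D≡W (m ℕ.* 8)) (D-16 k))
    where
    m : ℕ
    m = k ℕ.* 2
    lemma : ∀ a b → a ≡ a + b - b
    lemma = solve-∀

  w-double : ∀ k → w (k ℕ.* 2) ≡ + 2 * w k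
  w-double k = trans (cong W (lemma k)) (W-double k)
    where
    lemma : ∀ k → k ℕ.* 2 ℕ.* 8 ≡ k ℕ.* 8 ℕ.* 2
    lemma = solveℕ-∀

  5*m*8 : ∀ m → m ℕ.* 5 ℕ.* 8 ≡ m ℕ.* 8 ℕ.* 5
  5*m*8 = solveℕ-∀

  y-5 : ∀ m → y (m ℕ.* 5) ≡ x m
  y-5 m = trans (cong Y (5*m*8 m)) (Y-5 (m ℕ.* 8))

  x-5 : ∀ m → x (m ℕ.* 5) ≡ + 6 * x m - + 5 * y m
  x-5 m = trans (cong X (5*m*8 m)) (X-5 (m ℕ.* 8))

  w-5 : ∀ m → w (m ℕ.* 5) ≡ + 5 * w m
  w-5 m = trans (cong₂ _-_ (x-5 m) (y-5 m)) (lemma (x m) (y m))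
    where
    lemma : ∀ x y → + 6 * x - + 5 * y - x ≡ + 5 * (x - y)
    lemma = solve-∀

  y-25 : ∀ m → y (m ℕ.* 5 ℕ.* 5) ≡ + 6 * y (m ℕ.* 5) - + 5 * y m
  y-25 m = trans (y-5 (m ℕ.* 5)) (trans (x-5 m) (cong (λ e → + 6 * e - + 5 * y m) (sym (y-5 m))))

  g-0 : g 0 ≡ 0ℤ
  -- `D 0` is `G 0` by definition, so 2 g 0 = w 0, and w 0 = 2 w 0 forces both to vanish.
  g-0 = ℤ.*-cancelˡ-≡ (+ 2) (g 0) 0ℤ (trans (double (g 0)) (trans (G+D≡W 0) w-0))
    where
    double : ∀ a → + 2 * a ≡ a + a
    double = solve-∀
    w-0 : w 0 ≡ 0ℤ
    w-0 = trans (lemma (w 0)) (trans (cong (_- w 0) (sym (w-double 0))) (ℤ.+-inverseʳ (w 0)))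
      where
      lemma : ∀ a → a ≡ + 2 * a - a
      lemma = solve-∀

  odd*5 : ∀ k → suc (k ℕ.* 2) ℕ.* 5 ≡ suc ((k ℕ.* 5 ℕ.+ 2) ℕ.* 2)
  odd*5 = solveℕ-∀

  even*5 : ∀ k → k ℕ.* 2 ℕ.* 5 ≡ k ℕ.* 5 ℕ.* 2
  even*5 = solveℕ-∀

  -- For odd m, g is w, which is an eigenvector for the eigenvalue 5; for even m, g(2k) = w(2k) -
  -- g(k) leads back to half the index.
  g-5 : ∀ m → g (m ℕ.* 5) ≡ + 5 * g m
  g-5 = <-rec (λ m → g (m ℕ.* 5) ≡ + 5 * g m) go
    where
    open ≡-Reasoning
    go : ∀ m → (∀ {k} → k < m → g (k ℕ.* 5) ≡ + 5 * g k) → g (m ℕ.* 5) ≡ + 5 * g m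
    go m ih with parity m
    ... | zero  , inj₁ refl = trans g-0 (cong (λ e → + 5 * e) (sym g-0))
    ... | k     , inj₂ refl = begin
      g (suc (k ℕ.* 2) ℕ.* 5)               ≡⟨ cong g (odd*5 k) ⟩
      g (suc ((k ℕ.* 5 ℕ.+ 2) ℕ.* 2))       ≡⟨ g-odd (k ℕ.* 5 ℕ.+ 2) ⟩
      w (suc ((k ℕ.* 5 ℕ.+ 2) ℕ.* 2))       ≡⟨ cong w (sym (odd*5 k)) ⟩
      w (suc (k ℕ.* 2) ℕ.* 5)               ≡⟨ w-5 (suc (k ℕ.* 2)) ⟩
      + 5 * w (suc (k ℕ.* 2))               ≡⟨ cong (+ 5 *_) (sym (g-odd k)) ⟩
      + 5 * g (suc (k ℕ.* 2))               ∎
    ... | suc j , inj₁ refl = begin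
      g (k ℕ.* 2 ℕ.* 5)                     ≡⟨ cong g (even*5 k) ⟩
      g (k ℕ.* 5 ℕ.* 2)                     ≡⟨ g-even (k ℕ.* 5) ⟩
      w (k ℕ.* 5 ℕ.* 2) - g (k ℕ.* 5)       ≡⟨ cong₂ _-_ (trans (cong w (sym (even*5 k))) (w-5 (k ℕ.* 2))) (ih (ℕ.m<m*n k 2 (s≤s (s≤s z≤n)))) ⟩
      + 5 * w (k ℕ.* 2) - + 5 * g k         ≡⟨ lemma (w (k ℕ.* 2)) (g k) ⟩
      + 5 * (w (k ℕ.* 2) - g k)             ≡⟨ cong (+ 5 *_) (sym (g-even k)) ⟩
      + 5 * g (k ℕ.* 2)                     ∎
      where
      k : ℕ
      k = suc j
      lemma : ∀ a b → + 5 * a - + 5 * b ≡ + 5 * (a - b)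
      lemma = solve-∀

  -- The recurrence holds for y, and also for g because 5 is a root of λ² - 6λ + 5; and c is y at
  -- odd and y(2k) - g(k) at even indices, which multiplication by 5 respects.
  c-25 : ∀ m → c (m ℕ.* 5 ℕ.* 5) ≡ + 6 * c (m ℕ.* 5) - + 5 * c m
  c-25 m with parity m
  ... | k , inj₁ refl = begin
    c (k ℕ.* 2 ℕ.* 5 ℕ.* 5)    ≡⟨ cong (λ e → c (e ℕ.* 5)) (even*5 k) ⟩
    c (k ℕ.* 5 ℕ.* 2 ℕ.* 5)    ≡⟨ cong c (even*5 (k ℕ.* 5)) ⟩
    c (k ℕ.* 5 ℕ.* 5 ℕ.* 2)    ≡⟨ c-even (k ℕ.* 5 ℕ.* 5) ⟩
    y (k ℕ.* 5 ℕ.* 5 ℕ.* 2) - g (k ℕ.* 5 ℕ.* 5)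
      ≡⟨ cong₂ (λ a b → y a - b) (trans (sym (even*5 (k ℕ.* 5))) (cong (ℕ._* 5) (sym (even*5 k)))) (trans (g-5 (k ℕ.* 5)) (cong (+ 5 *_) (g-5 k))) ⟩
    y (k ℕ.* 2 ℕ.* 5 ℕ.* 5) - + 5 * (+ 5 * g k)
      ≡⟨ cong (_- + 5 * (+ 5 * g k)) (y-25 (k ℕ.* 2)) ⟩
    + 6 * y (k ℕ.* 2 ℕ.* 5) - + 5 * y (k ℕ.* 2) - + 5 * (+ 5 * g k)
      ≡⟨ lemma (y (k ℕ.* 2 ℕ.* 5)) (y (k ℕ.* 2)) (g k) ⟩
    + 6 * (y (k ℕ.* 2 ℕ.* 5) - + 5 * g k) - + 5 * (y (k ℕ.* 2) - g k)
      ≡⟨ cong₂ (λ a b → + 6 * a - + 5 * b)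
           (trans (cong₂ (λ a b → y a - b) (even*5 k) (sym (g-5 k))) (trans (sym (c-even (k ℕ.* 5))) (cong c (sym (even*5 k)))))
           (sym (c-even k)) ⟩
    + 6 * c (k ℕ.* 2 ℕ.* 5) - + 5 * c (k ℕ.* 2) ∎
    where
    open ≡-Reasoning
    lemma : ∀ a b g → + 6 * a - + 5 * b - + 5 * (+ 5 * g) ≡ + 6 * (a - + 5 * g) - + 5 * (b - g)
    lemma = solve-∀
  ... | k , inj₂ refl = trans (c≡y-5 (k ℕ.* 5 ℕ.+ 2) (odd*5 k))
      (trans (y-25 m′) (cong₂ (λ a b → + 6 * a - + 5 * b) (sym (c≡y-5 k refl)) (sym (c-odd k))))
    where
    m′ : ℕ
    m′ = suc (k ℕ.* 2)
    c≡y-5 : ∀ {n} j → n ≡ suc (j ℕ.* 2) → c (n ℕ.* 5) ≡ y (n ℕ.* 5)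
    c≡y-5 j refl = trans (cong c (odd*5 j)) (trans (c-odd (j ℕ.* 5 ℕ.+ 2)) (cong y (sym (odd*5 j))))

  -- For n = 2m with m odd, g(m) = w(m), and 2 w(m) = w(n) = x(n) - y(n) = 2 y(n) in these classes;
  -- so y(n) - g(m) cancels.
  c-vanishes : ∀ k → (suc (k ℕ.* 2) ℕ.* 2) % 5 ≡ 2 ⊎ (suc (k ℕ.* 2) ℕ.* 2) % 5 ≡ 3 → c (suc (k ℕ.* 2) ℕ.* 2) ≡ 0ℤ
  c-vanishes k nonresidue = begin
    c n               ≡⟨ c-even m ⟩
    y n - g m         ≡⟨ cong (λ e → y n - e) (trans (g-odd k) w≡y) ⟩
    y n - y n         ≡⟨ ℤ.+-inverseʳ (y n) ⟩
    0ℤ                ∎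
    where
    open ≡-Reasoning
    m n : ℕ
    m = suc (k ℕ.* 2)
    n = m ℕ.* 2
    class : (n ℕ.* 8) % 5 ≡ 1 ⊎ (n ℕ.* 8) % 5 ≡ 4
    class = [ (λ e → inj₁ (trans (%-distribˡ-* n 8 5) (cong (λ a → (a ℕ.* 3) % 5) e)))
            , (λ e → inj₂ (trans (%-distribˡ-* n 8 5) (cong (λ a → (a ℕ.* 3) % 5) e))) ]′ nonresidue
    lemma : ∀ a → + 3 * a - a ≡ + 2 * a
    lemma = solve-∀
    w≡y : w m ≡ y n
    w≡y = ℤ.*-cancelˡ-≡ (+ 2) (w m) (y n) (trans (sym (w-double m))
      (trans (cong (_- y n) (X≡3Y (n ℕ.* 8) class)) (lemma (y n))))

-- The sign change q ↦ -q and the link with b̅₅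

σ : ℕ → ℤ
σ zero    = 1ℤ
σ (suc n) = - σ n

σ-+ : ∀ m n → σ (m ℕ.+ n) ≡ σ m * σ n
σ-+ zero    n = sym (ℤ.*-identityˡ (σ n))
σ-+ (suc m) n = trans (cong -_ (σ-+ m n)) (ℤ.neg-distribˡ-* (σ m) (σ n))

σ-involutive : ∀ n → σ n * σ n ≡ 1ℤ
σ-involutive zero    = refl
σ-involutive (suc n) = trans (lemma (σ n)) (σ-involutive n)
  where
  lemma : ∀ a → - a * - a ≡ a * a
  lemma = solve-∀

σ-even : ∀ a b → σ (a ℕ.+ b ℕ.* 2) ≡ σ a
σ-even a b = trans (σ-+ a (b ℕ.* 2)) (trans (cong (σ a *_) (trans (cong σ (lemma b)) (trans (σ-+ b b) (σ-involutive b)))) (ℤ.*-identityʳ (σ a)))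
  where
  lemma : ∀ b → b ℕ.* 2 ≡ b ℕ.+ b
  lemma = solveℕ-∀

-1^≡σ : ∀ n → -[1+ 0 ] ℤ.^ n ≡ σ n
-1^≡σ zero    = refl
-1^≡σ (suc n) = trans (ℤ.-1*i≡-i (-[1+ 0 ] ℤ.^ n)) (cong -_ (-1^≡σ n))

-- τ f is f(-q).
τ : Series → Series
τ f n = σ n * f n

τ-· : ∀ f g → τ (f · g) ≈ τ f · τ g
τ-· f g zero = trans (cong (1ℤ *_) (·-zero f g)) (trans (lemma (f 0) (g 0)) (sym (·-zero (τ f) (τ g))))
  where
  lemma : ∀ a b → 1ℤ * (a * b) ≡ 1ℤ * a * (1ℤ * b)
  lemma = solve-∀
τ-· f g (suc n) = begin
  - σ n * (f · g) (suc n)                                        ≡⟨ cong (- σ n *_) (·-suc f g n) ⟩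
  - σ n * (f 0 * g (suc n) + (tail f · g) n)                     ≡⟨ lemma (σ n) (f 0) (g (suc n)) ((tail f · g) n) ⟩
  1ℤ * f 0 * (- σ n * g (suc n)) + (-[1+ 0 ] * (σ n * (tail f · g) n) + 0ℤ)
    ≡⟨ cong₂ (λ a b → 1ℤ * f 0 * (- σ n * g (suc n)) + (-[1+ 0 ] * a + b)) (τ-· (tail f) g n) (sym (0-· (τ g) n)) ⟩
  1ℤ * f 0 * (- σ n * g (suc n)) + (-[1+ 0 ] * (τ (tail f) · τ g) n + ((λ _ → 0ℤ) · τ g) n)
    ≡⟨ cong (λ a → 1ℤ * f 0 * (- σ n * g (suc n)) + a)
         (trans (sym (·-linearˡ -[1+ 0 ] (τ (tail f)) (λ _ → 0ℤ) (τ g) n)) (·-congʳ (τ g) (λ k → lemma′ (σ k) (f (suc k))) n)) ⟩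
  1ℤ * f 0 * (- σ n * g (suc n)) + (tail (τ f) · τ g) n          ≡⟨ sym (·-suc (τ f) (τ g) n) ⟩
  (τ f · τ g) (suc n)                                            ∎
  where
  open ≡-Reasoning
  lemma : ∀ s a b c → - s * (a * b + c) ≡ 1ℤ * a * (- s * b) + (-[1+ 0 ] * (s * c) + 0ℤ)
  lemma = solve-∀
  lemma′ : ∀ s a → -[1+ 0 ] * (s * a) + 0ℤ ≡ - s * a
  lemma′ = solve-∀

∑≡∑< : ∀ N f → ∑[ i < N ] f (toℕ i) ≡ ∑< N f
∑≡∑< zero    f = refl
∑≡∑< (suc N) f = trans (cong (λ z → f 0 + z) (∑≡∑< N (tail f))) (last N f)
  where
  last : ∀ N f → f 0 + ∑< N (tail f) ≡ ∑< N f + f N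
  last zero    f = ℤ.+-comm (f 0) 0ℤ
  last (suc N) f = trans (sym (ℤ.+-assoc (f 0) (∑< N (tail f)) (f (suc N)))) (cong (_+ f (suc N)) (last N f))

∑<-cong : ∀ N {f g} → f ≈ g → ∑< N f ≡ ∑< N g
∑<-cong zero    p = refl
∑<-cong (suc N) p = cong₂ _+_ (∑<-cong N p) (p N)

∑<-* : ∀ N c f → ∑< N (λ i → c * f i) ≡ c * ∑< N f
∑<-* zero    c f = sym (ℤ.*-zeroʳ c)
∑<-* (suc N) c f = trans (cong (_+ c * f N) (∑<-* N c f)) (sym (ℤ.*-distribˡ-+ c (∑< N f) (f N)))

∑<-stable : ∀ N f k → (∀ i → N ≤ i → f i ≡ 0ℤ) → ∑< (k ℕ.+ N) f ≡ ∑< N f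
∑<-stable N f zero    _ = refl
∑<-stable N f (suc k) p = trans (cong₂ _+_ (∑<-stable N f k p) (p (k ℕ.+ N) (ℕ.m≤n+m N k))) (ℤ.+-identityʳ (∑< N f))

∑<-elim : ∀ {Q : Set} N f → (∀ i → f i ≡ 0ℤ ⊎ Q) → ∑< N f ≡ 0ℤ ⊎ Q
∑<-elim zero    f h = inj₁ refl
∑<-elim (suc N) f h with ∑<-elim N f h | h N
... | inj₂ x | _      = inj₂ x
... | inj₁ _ | inj₂ x = inj₂ x
... | inj₁ a | inj₁ b = inj₁ (cong₂ _+_ a b)

monomial≡ : ∀ c d m → monomial c d m ≡ c * (q^ d) m
monomial≡ c zero    zero    = sym (ℤ.*-identityʳ c)
monomial≡ c zero    (suc m) = sym (ℤ.*-zeroʳ c)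
monomial≡ c (suc d) zero    = sym (ℤ.*-zeroʳ c)
monomial≡ c (suc d) (suc m) = monomial≡ c d m

-- The index j = 1 + 2b is odd, so the sign of t agrees with the sign of the exponent j t, and `τ`
-- removes it.
τψ : ∀ b m → τ ψ[-q^ suc (b ℕ.* 2) ] m ≡ ∑< (suc m) (λ i → (q^ (suc (b ℕ.* 2) ℕ.* tri i)) m)
τψ b m = trans (cong (σ m *_) (trans (∑≡∑< (suc m) _) (∑<-cong (suc m) term)))
  (trans (cong (σ m *_) (∑<-* (suc m) (σ m) _)) (trans (sym (ℤ.*-assoc (σ m) (σ m) _))
    (trans (cong (_* ∑< (suc m) (λ i → (q^ (j ℕ.* tri i)) m)) (σ-involutive m)) (ℤ.*-identityˡ _))))
  where
  j : ℕ
  j = suc (b ℕ.* 2)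
  lemma : ∀ b t → suc (b ℕ.* 2) ℕ.* t ≡ t ℕ.+ b ℕ.* t ℕ.* 2
  lemma = solveℕ-∀
  term : ∀ i → monomial (-[1+ 0 ] ℤ.^ triangular i) (j ℕ.* triangular i) m ≡ σ m * (q^ (j ℕ.* tri i)) m
  term i rewrite triangular≡tri i with q^-support (j ℕ.* tri i) m
  ... | inj₁ z = trans (monomial≡ _ (j ℕ.* tri i) m) (trans (cong (-[1+ 0 ] ℤ.^ tri i *_) z)
      (trans (ℤ.*-zeroʳ (-[1+ 0 ] ℤ.^ tri i)) (sym (trans (cong (σ m *_) z) (ℤ.*-zeroʳ (σ m))))))
  ... | inj₂ e = trans (monomial≡ _ (j ℕ.* tri i) m) (cong (_* (q^ (j ℕ.* tri i)) m)
      (trans (-1^≡σ (tri i)) (trans (sym (σ-even (tri i) (b ℕ.* tri i))) (cong σ (trans (sym (lemma b (tri i))) e)))))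

τψ₁≈ : τ ψ[-q^ 1 ] ≈ ψ
τψ₁≈ m = trans (τψ 0 m) (∑<-cong (suc m) (λ i → cong (λ a → (q^ a) m) (ℕ.*-identityˡ (tri i))))

τψ₅≈ : τ ψ[-q^ 5 ] ≈ V₅ ψ
τψ₅≈ = V-unique 4 ψ (τ ψ[-q^ 5 ]) values support
  where
  stretched : ∀ i k → (q^ (5 ℕ.* tri i)) (k ℕ.* 5) ≡ (q^ tri i) k
  stretched i k = trans (cong (λ a → (q^ a) (k ℕ.* 5)) (ℕ.*-comm 5 (tri i)))
    (trans (sym (stretch-q^ 4 0 (tri i) (k ℕ.* 5))) (V-coefficient 4 (q^ tri i) k))
  beyond : ∀ k i → suc k ≤ i → (q^ tri i) k ≡ 0ℤ
  beyond k i l with q^-support (tri i) k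
  ... | inj₁ z    = z
  ... | inj₂ refl = contradiction (n≤tri i) (ℕ.<⇒≱ l)
  -- At the exponent 5k the definition sums 5k + 1 terms, and those with i > k vanish.
  size : ∀ k → suc (k ℕ.* 5) ≡ k ℕ.* 4 ℕ.+ suc k
  size = solveℕ-∀
  values : ∀ k → τ ψ[-q^ 5 ] (k ℕ.* 5) ≡ ψ k
  values k = trans (τψ 2 (k ℕ.* 5)) (trans (∑<-cong (suc (k ℕ.* 5)) (λ i → stretched i k))
    (trans (cong (λ N → ∑< N (λ i → (q^ tri i) k)) (size k)) (∑<-stable (suc k) _ (k ℕ.* 4) (beyond k))))
  support : ∀ n → τ ψ[-q^ 5 ] n ≡ 0ℤ ⊎ ∃ λ k → n ≡ k ℕ.* 5
  support n = map₁ (trans (τψ 2 n)) (∑<-elim (suc n) _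
    (λ i → map₂ (λ e → tri i , trans (sym e) (ℕ.*-comm 5 (tri i))) (q^-support (5 ℕ.* tri i) n)))

τ-cong : ∀ {f g} → f ≈ g → τ f ≈ τ g
τ-cong e n = cong (σ n *_) (e n)

τb̅₅·ψ≈ : τ b̅₅ · ψ ≈ V₅ ψ · (V₅ ψ · (V₅ ψ · (V₅ ψ · V₅ ψ)))
τb̅₅·ψ≈ =
  ·-congˡ (τ b̅₅) (≈-sym τψ₁≈)
  ⨾ ≈-sym (τ-· b̅₅ ψ[-q^ 1 ])
  ⨾ τ-cong (·≈⊛ b̅₅ ψ[-q^ 1 ] ⨾ b̅₅-generating-function ⨾ fifth)
  ⨾ step (step (step (τ-· f f ⨾ ·-cong τψ₅≈ τψ₅≈)))
  where
  f : Series
  f = ψ[-q^ 5 ]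
  step : ∀ {g h} → τ g ≈ h → τ (f · g) ≈ V₅ ψ · h
  step {g} e = τ-· f g ⨾ ·-cong τψ₅≈ e
  peel : ∀ {g h} → g ≈ h → f ⊛ g ≈ f · h
  peel {g} e = ≈-sym (·≈⊛ f g) ⨾ ·-congˡ f e
  one≈κ : one ≈ κ 1ℤ
  one≈κ zero    = refl
  one≈κ (suc _) = refl
  fifth : f ⊛^ 5 ≈ f · (f · (f · (f · f)))
  fifth = peel (peel (peel (peel (peel one≈κ ⨾ ·-comm f (κ 1ℤ) ⨾ 1-· f))))

stretch≈ : ∀ e r f → stretch e r f ≈ (q^ r) · V e f
stretch≈ e zero    f n       = sym (trans (·-congʳ (V e f) q^0≈ n) (1-· (V e f) n))
  where
  q^0≈ : q^ 0 ≈ κ 1ℤ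
  q^0≈ zero    = refl
  q^0≈ (suc _) = refl
stretch≈ e (suc r) f zero    = sym (·-zero (q^ suc r) (V e f))
stretch≈ e (suc r) f (suc n) = trans (stretch≈ e r f n)
  (sym (trans (·-suc (q^ suc r) (V e f) n) (ℤ.+-identityˡ (((q^ r) · V e f) n))))

q^-+ : ∀ a b → (q^ a) · (q^ b) ≈ q^ (a ℕ.+ b)
q^-+ a b = ·-cong (λ n → sym (ℤ.*-identityˡ ((q^ a) n))) (λ n → sym (ℤ.*-identityˡ ((q^ b) n)))
  ⨾ q^-· 1ℤ 1ℤ a b ⨾ λ n → ℤ.*-identityˡ ((q^ (a ℕ.+ b)) n)

stretch-unique : ∀ e r c (f h : Series) → (∀ k → h (r ℕ.+ k ℕ.* suc e) ≡ c * f k) →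
  (∀ n → h n ≡ 0ℤ ⊎ ∃ λ k → n ≡ r ℕ.+ k ℕ.* suc e) → ∀ n → h n ≡ c * stretch e r f n
stretch-unique e r c f h p q n with q n
... | inj₂ (k , refl) = trans (p k) (cong (c *_) (sym (stretch-coefficient e r f k)))
... | inj₁ h≡0 with stretch-support e r f n
...   | inj₁ s≡0 = trans h≡0 (sym (trans (cong (c *_) s≡0) (ℤ.*-zeroʳ c)))
...   | inj₂ (k , refl) = trans (p k) (cong (c *_) (sym (stretch-coefficient e r f k)))

o≈ : o ≈ κ (+ 2) · ((q^ 1) · V 7 ψ)
o≈ n = trans (stretch-unique 7 1 (+ 2) ψ O O-coefficient O-support n)
  (trans (cong (+ 2 *_) (stretch≈ 7 1 ψ n)) (sym (κ-· (+ 2) ((q^ 1) · V 7 ψ) n)))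

u≈ : u ≈ κ (+ 2) · ((q^ 5) · V 7 (V₅ ψ))
u≈ = V-cong 4 o≈ ⨾ V⟨·⟩ 4 (V-κ 4 (+ 2)) (V⟨·⟩ 4 {q^ 1} {V 7 ψ} (stretch-q^ 4 0 1) (V-comm 4 7 ψ))

-- This is u⁵ / o: 16 = 2⁵ / 2 comes from the factors 2, and 24 = 25 - 1 from the leading powers q⁵
-- and q. Since 24 = 8 · 3, indices are shifted by 3.
C : Series
C = κ (+ 16) · ((q^ 24) · V 7 (τ b̅₅))

C·o≈ : C · o ≈ u · (u · (u · (u · u)))
C·o≈ =
  ·-congˡ C o≈
  ⨾ scaled-quotient (V 7 (τ b̅₅)) (V 7 ψ) e (q^ 24) (q^ 1) (q^ 5) V₇ powers
  ⨾ ≈-sym (·-cong u≈ (·-cong u≈ (·-cong u≈ (·-cong u≈ u≈))))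
  where
  e : Series
  e = V 7 (V₅ ψ)
  V₇ : V 7 (τ b̅₅) · V 7 ψ ≈ e · (e · (e · (e · e)))
  V₇ = ≈-sym (V-· 7 (τ b̅₅) ψ) ⨾ V-cong 7 τb̅₅·ψ≈
    ⨾ V⟨·⟩ 7 (λ _ → refl) (V⟨·⟩ 7 (λ _ → refl) (V⟨·⟩ 7 (λ _ → refl) (V-· 7 (V₅ ψ) (V₅ ψ))))
  powers : (q^ 24) · (q^ 1) ≈ (q^ 5) · ((q^ 5) · ((q^ 5) · ((q^ 5) · (q^ 5))))
  powers = q^-+ 24 1 ⨾ ≈-sym (·-congˡ (q^ 5) (·-congˡ (q^ 5) (·-congˡ (q^ 5) (q^-+ 5 5) ⨾ q^-+ 5 10) ⨾ q^-+ 5 15) ⨾ q^-+ 5 20)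

module Q = Quotient C C·o≈

Q-c : ∀ n → Q.c (n ℕ.+ 3) ≡ + 16 * (σ n * b̅₅ n)
Q-c n = trans (κ-· (+ 16) ((q^ 24) · V 7 (τ b̅₅)) ((n ℕ.+ 3) ℕ.* 8))
  (cong (+ 16 *_) (trans (sym (stretch≈ 7 24 (τ b̅₅) ((n ℕ.+ 3) ℕ.* 8)))
    (trans (cong (stretch 7 24 (τ b̅₅)) (index n)) (stretch-coefficient 7 24 (τ b̅₅) n))))
  where
  index : ∀ n → (n ℕ.+ 3) ℕ.* 8 ≡ 24 ℕ.+ n ℕ.* 8
  index = solveℕ-∀

-- The recurrence and the congruences for b̅₅

next : ℕ → ℕ
next n = 5 ℕ.* n ℕ.+ 12

next-+3 : ∀ n → next n ℕ.+ 3 ≡ (n ℕ.+ 3) ℕ.* 5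
next-+3 = lemma
  where
  lemma : ∀ n → 5 ℕ.* n ℕ.+ 12 ℕ.+ 3 ≡ (n ℕ.+ 3) ℕ.* 5
  lemma = solveℕ-∀

-- The step multiplies n + 3 by 5 and keeps the parity of n, so the signs in `Q-c` are equal and
-- drop out.
b̅₅-next : ∀ n → b̅₅ (next (next n)) ≡ + 6 * b̅₅ (next n) - + 5 * b̅₅ n
b̅₅-next n = begin
  b̅₅ n₂                                              ≡⟨ unsign n₂ (trans (σ-next n₁) (σ-next n)) ⟩
  σ n * (σ n₂ * b̅₅ n₂)                               ≡⟨ cong (σ n *_) (ℤ.*-cancelˡ-≡ (+ 16) _ _ scaled) ⟩
  σ n * (+ 6 * (σ n₁ * b̅₅ n₁) - + 5 * (σ n * b̅₅ n))  ≡⟨ lemma (σ n) (σ n₁ * b̅₅ n₁) (σ n * b̅₅ n) ⟩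
  + 6 * (σ n * (σ n₁ * b̅₅ n₁)) - + 5 * (σ n * (σ n * b̅₅ n))
    ≡⟨ cong₂ (λ a b → + 6 * a - + 5 * b) (sym (unsign n₁ (σ-next n))) (sym (unsign n refl)) ⟩
  + 6 * b̅₅ n₁ - + 5 * b̅₅ n                           ∎
  where
  open ≡-Reasoning
  n₁ n₂ : ℕ
  n₁ = next n
  n₂ = next n₁
  σ-next : ∀ n → σ (next n) ≡ σ n
  σ-next n = trans (cong σ (double n)) (σ-even n (2 ℕ.* n ℕ.+ 6))
    where
    double : ∀ n → 5 ℕ.* n ℕ.+ 12 ≡ n ℕ.+ (2 ℕ.* n ℕ.+ 6) ℕ.* 2
    double = solveℕ-∀
  unsign : ∀ m → σ m ≡ σ n → b̅₅ m ≡ σ n * (σ m * b̅₅ m)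
  unsign m e = trans (sym (ℤ.*-identityˡ (b̅₅ m)))
    (trans (cong (_* b̅₅ m) (trans (sym (σ-involutive m)) (cong (_* σ m) e))) (ℤ.*-assoc (σ n) (σ m) (b̅₅ m)))
  lemma : ∀ s a b → s * (+ 6 * a - + 5 * b) ≡ + 6 * (s * a) - + 5 * (s * b)
  lemma = solve-∀
  lemma′ : ∀ a b → + 6 * (+ 16 * a) - + 5 * (+ 16 * b) ≡ + 16 * (+ 6 * a - + 5 * b)
  lemma′ = solve-∀
  scaled : + 16 * (σ n₂ * b̅₅ n₂) ≡ + 16 * (+ 6 * (σ n₁ * b̅₅ n₁) - + 5 * (σ n * b̅₅ n))
  scaled = begin
    + 16 * (σ n₂ * b̅₅ n₂)                       ≡⟨ sym (Q-c n₂) ⟩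
    Q.c (n₂ ℕ.+ 3)                              ≡⟨ cong Q.c (trans (next-+3 n₁) (cong (ℕ._* 5) (next-+3 n))) ⟩
    Q.c ((n ℕ.+ 3) ℕ.* 5 ℕ.* 5)                 ≡⟨ Q.c-25 (n ℕ.+ 3) ⟩
    + 6 * Q.c ((n ℕ.+ 3) ℕ.* 5) - + 5 * Q.c (n ℕ.+ 3)
      ≡⟨ cong₂ (λ a b → + 6 * a - + 5 * b) (trans (cong Q.c (sym (next-+3 n))) (Q-c n₁)) (Q-c n) ⟩
    + 6 * (+ 16 * (σ n₁ * b̅₅ n₁)) - + 5 * (+ 16 * (σ n * b̅₅ n)) ≡⟨ lemma′ (σ n₁ * b̅₅ n₁) (σ n * b̅₅ n) ⟩
    + 16 * (+ 6 * (σ n₁ * b̅₅ n₁) - + 5 * (σ n * b̅₅ n)) ∎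

b̅₅-vanishes : ∀ n k → n ℕ.+ 3 ≡ suc (k ℕ.* 2) ℕ.* 2 → (n ℕ.+ 3) % 5 ≡ 2 ⊎ (n ℕ.+ 3) % 5 ≡ 3 → b̅₅ n ≡ 0ℤ
b̅₅-vanishes n k e nonresidue = begin
  b̅₅ n                       ≡⟨ sym (ℤ.*-identityˡ (b̅₅ n)) ⟩
  1ℤ * b̅₅ n                  ≡⟨ cong (_* b̅₅ n) (sym (σ-involutive n)) ⟩
  σ n * σ n * b̅₅ n           ≡⟨ ℤ.*-assoc (σ n) (σ n) (b̅₅ n) ⟩
  σ n * (σ n * b̅₅ n)         ≡⟨ cong (σ n *_) (ℤ.*-cancelˡ-≡ (+ 16) (σ n * b̅₅ n) 0ℤ
      (trans (sym (Q-c n)) (trans (cong Q.c e) (Q.c-vanishes k (subst (λ m → m % 5 ≡ 2 ⊎ m % 5 ≡ 3) e nonresidue))))) ⟩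
  σ n * 0ℤ                   ≡⟨ ℤ.*-zeroʳ (σ n) ⟩
  0ℤ                         ∎
  where open ≡-Reasoning

iterate-next : ℕ → ℕ → ℕ
iterate-next zero    n = n
iterate-next (suc k) n = next (iterate-next k n)

iterate-next-+3 : ∀ k n → iterate-next k n ℕ.+ 3 ≡ 5 ^ k ℕ.* (n ℕ.+ 3)
iterate-next-+3 zero    n = sym (ℕ.*-identityˡ (n ℕ.+ 3))
iterate-next-+3 (suc k) n = trans (next-+3 (iterate-next k n))
  (trans (cong (ℕ._* 5) (iterate-next-+3 k n)) (lemma (5 ^ k) (n ℕ.+ 3)))
  where
  lemma : ∀ a b → a ℕ.* b ℕ.* 5 ≡ 5 ℕ.* a ℕ.* b
  lemma = solveℕ-∀

index≡ : ∀ k n → 5 ^ k ℕ.* (n ℕ.+ 3) ∸ 3 ≡ iterate-next k n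
index≡ k n = trans (cong (_∸ 3) (sym (iterate-next-+3 k n))) (ℕ.m+n∸n≡m (iterate-next k n) 3)

-- The recurrence has the characteristic roots 1 and 5, and 4 is their difference.
b̅₅-iterate : ∀ k n → + 4 * b̅₅ (iterate-next k n) ≡ (+ (5 ^ k) - 1ℤ) * b̅₅ (next n) + (+ 5 - + (5 ^ k)) * b̅₅ n
b̅₅-iterate zero          n = lemma (b̅₅ (next n)) (b̅₅ n)
  where
  lemma : ∀ a b → + 4 * b ≡ (+ 1 - 1ℤ) * a + (+ 5 - + 1) * b
  lemma = solve-∀
b̅₅-iterate (suc zero)    n = lemma (b̅₅ (next n)) (b̅₅ n)
  where
  lemma : ∀ a b → + 4 * a ≡ (+ 5 - 1ℤ) * a + (+ 5 - + 5) * b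
  lemma = solve-∀
b̅₅-iterate (suc (suc k)) n = begin
  + 4 * b̅₅ (iterate-next (suc (suc k)) n)
    ≡⟨ cong (+ 4 *_) (b̅₅-next (iterate-next k n)) ⟩
  + 4 * (+ 6 * b̅₅ (iterate-next (suc k) n) - + 5 * b̅₅ (iterate-next k n))
    ≡⟨ rearrange (b̅₅ (iterate-next (suc k) n)) (b̅₅ (iterate-next k n)) ⟩
  + 6 * (+ 4 * b̅₅ (iterate-next (suc k) n)) - + 5 * (+ 4 * b̅₅ (iterate-next k n))
    ≡⟨ cong₂ (λ x y → + 6 * x - + 5 * y) (b̅₅-iterate (suc k) n) (b̅₅-iterate k n) ⟩
  + 6 * ((+ (5 ^ suc k) - 1ℤ) * a + (+ 5 - + (5 ^ suc k)) * b) - + 5 * ((+ (5 ^ k) - 1ℤ) * a + (+ 5 - + (5 ^ k)) * b)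
    ≡⟨ cong (λ P → + 6 * ((P - 1ℤ) * a + (+ 5 - P) * b) - + 5 * ((+ (5 ^ k) - 1ℤ) * a + (+ 5 - + (5 ^ k)) * b)) (ℤ.pos-* 5 (5 ^ k)) ⟩
  + 6 * ((+ 5 * + (5 ^ k) - 1ℤ) * a + (+ 5 - + 5 * + (5 ^ k)) * b) - + 5 * ((+ (5 ^ k) - 1ℤ) * a + (+ 5 - + (5 ^ k)) * b)
    ≡⟨ lemma (+ (5 ^ k)) a b ⟩
  (+ 5 * (+ 5 * + (5 ^ k)) - 1ℤ) * a + (+ 5 - + 5 * (+ 5 * + (5 ^ k))) * b
    ≡⟨ cong (λ P → (P - 1ℤ) * a + (+ 5 - P) * b) (trans (cong (+ 5 *_) (sym (ℤ.pos-* 5 (5 ^ k)))) (sym (ℤ.pos-* 5 (5 ^ suc k)))) ⟩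
  (+ (5 ^ suc (suc k)) - 1ℤ) * a + (+ 5 - + (5 ^ suc (suc k))) * b ∎
  where
  open ≡-Reasoning
  a b : ℤ
  a = b̅₅ (next n)
  b = b̅₅ n
  rearrange : ∀ x y → + 4 * (+ 6 * x - + 5 * y) ≡ + 6 * (+ 4 * x) - + 5 * (+ 4 * y)
  rearrange = solve-∀
  lemma : ∀ P a b → + 6 * ((+ 5 * P - 1ℤ) * a + (+ 5 - + 5 * P) * b) - + 5 * ((P - 1ℤ) * a + (+ 5 - P) * b)
    ≡ (+ 5 * (+ 5 * P) - 1ℤ) * a + (+ 5 - + 5 * (+ 5 * P)) * b
  lemma = solve-∀

[5^k∸1]/4 : ∀ k → + (5 ^ k) - 1ℤ ≡ + 4 * + ((5 ^ k ∸ 1) / 4)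
[5^k∸1]/4 k with quarter k
  where
  quarter : ∀ k → ∃ λ t → 5 ^ k ≡ suc (t ℕ.* 4)
  quarter zero    = 0 , refl
  quarter (suc k) with quarter k
  ... | t , e = 5 ℕ.* t ℕ.+ 1 , trans (cong (5 ℕ.*_) e) (lemma t)
    where
    lemma : ∀ t → 5 ℕ.* suc (t ℕ.* 4) ≡ suc ((5 ℕ.* t ℕ.+ 1) ℕ.* 4)
    lemma = solveℕ-∀
... | t , e rewrite e = trans (cong +_ (ℕ.*-comm t 4)) (trans (ℤ.pos-* 4 t) (cong (λ s → + 4 * + s) (sym (m*n/n≡m t 4))))

-- If b̅₅ n = 0, only the multiple of 5^k - 1 is left, and cancelling 4 yields the modulus.
b̅₅-divisible : ∀ k n → b̅₅ n ≡ 0ℤ → b̅₅ (iterate-next k n) ≡ 0ℤ [mod (5 ^ k ∸ 1) / 4 ]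
b̅₅-divisible k n b≡0 = divides (b̅₅ (next n)) (ℤ.*-cancelˡ-≡ (+ 4) _ _ (begin
  + 4 * (b̅₅ (iterate-next k n) - 0ℤ)                                  ≡⟨ cong (+ 4 *_) (ℤ.+-identityʳ (b̅₅ (iterate-next k n))) ⟩
  + 4 * b̅₅ (iterate-next k n)                                         ≡⟨ b̅₅-iterate k n ⟩
  (+ (5 ^ k) - 1ℤ) * b̅₅ (next n) + (+ 5 - + (5 ^ k)) * b̅₅ n
    ≡⟨ cong₂ (λ t b → t * b̅₅ (next n) + (+ 5 - + (5 ^ k)) * b) ([5^k∸1]/4 k) b≡0 ⟩
  + 4 * + ((5 ^ k ∸ 1) / 4) * b̅₅ (next n) + (+ 5 - + (5 ^ k)) * 0ℤ    ≡⟨ lemma (+ ((5 ^ k ∸ 1) / 4)) (b̅₅ (next n)) (+ (5 ^ k)) ⟩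
  + 4 * (b̅₅ (next n) * + ((5 ^ k ∸ 1) / 4))                           ∎))
  where
  open ≡-Reasoning
  lemma : ∀ t a P → + 4 * t * a + (+ 5 - P) * 0ℤ ≡ + 4 * (a * t)
  lemma = solve-∀

corollary8 : (n k : ℕ) → 2 ≤ k →
    (+ 4 * b̅₅ (5 ^ k ℕ.* (n ℕ.+ 3) ∸ 3) ≡ + 5 * b̅₅ n - b̅₅ (5 ℕ.* n ℕ.+ 12) [mod 5 ^ k ])
    × (b̅₅ (5 ^ k ℕ.* (20 ℕ.* n ℕ.+ 18) ∸ 3) ≡ 0ℤ [mod (5 ^ k ∸ 1) / 4 ])
    × (b̅₅ (5 ^ k ℕ.* (20 ℕ.* n ℕ.+ 22) ∸ 3) ≡ 0ℤ [mod (5 ^ k ∸ 1) / 4 ])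
corollary8 n k _ = first , second , third
  where
  first : + 4 * b̅₅ (5 ^ k ℕ.* (n ℕ.+ 3) ∸ 3) ≡ + 5 * b̅₅ n - b̅₅ (next n) [mod 5 ^ k ]
  first = divides (b̅₅ (next n) - b̅₅ n)
    (trans (cong (λ i → + 4 * b̅₅ i - (+ 5 * b̅₅ n - b̅₅ (next n))) (index≡ k n))
      (trans (cong (_- (+ 5 * b̅₅ n - b̅₅ (next n))) (b̅₅-iterate k n)) (lemma (+ (5 ^ k)) (b̅₅ (next n)) (b̅₅ n))))
    where
    lemma : ∀ P a b → (P - 1ℤ) * a + (+ 5 - P) * b - (+ 5 * b - a) ≡ (a - b) * P
    lemma = solve-∀
  nonresidue : ∀ m c → m ≡ 20 ℕ.* n ℕ.+ c → m % 5 ≡ c % 5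
  nonresidue m c refl = trans (cong (_% 5) (lemma n c)) ([m+kn]%n≡m%n c (4 ℕ.* n) 5)
    where
    lemma : ∀ n c → 20 ℕ.* n ℕ.+ c ≡ c ℕ.+ 4 ℕ.* n ℕ.* 5
    lemma = solveℕ-∀
  second : b̅₅ (5 ^ k ℕ.* (20 ℕ.* n ℕ.+ 18) ∸ 3) ≡ 0ℤ [mod (5 ^ k ∸ 1) / 4 ]
  second = subst (λ i → b̅₅ i ≡ 0ℤ [mod (5 ^ k ∸ 1) / 4 ])
    (trans (sym (index≡ k m)) (cong (λ e → 5 ^ k ℕ.* e ∸ 3) (shifted n)))
    -- 20n + 18 is twice the odd number 2 (5n + 4) + 1, and it is 3 modulo 5.
    (b̅₅-divisible k m (b̅₅-vanishes m (5 ℕ.* n ℕ.+ 4) (halved n) (inj₂ (nonresidue (m ℕ.+ 3) 18 (shifted n)))))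
    where
    m : ℕ
    m = 20 ℕ.* n ℕ.+ 15
    shifted : ∀ n → 20 ℕ.* n ℕ.+ 15 ℕ.+ 3 ≡ 20 ℕ.* n ℕ.+ 18
    shifted = solveℕ-∀
    halved : ∀ n → 20 ℕ.* n ℕ.+ 15 ℕ.+ 3 ≡ suc ((5 ℕ.* n ℕ.+ 4) ℕ.* 2) ℕ.* 2
    halved = solveℕ-∀
  third : b̅₅ (5 ^ k ℕ.* (20 ℕ.* n ℕ.+ 22) ∸ 3) ≡ 0ℤ [mod (5 ^ k ∸ 1) / 4 ]
  third = subst (λ i → b̅₅ i ≡ 0ℤ [mod (5 ^ k ∸ 1) / 4 ])
    (trans (sym (index≡ k m)) (cong (λ e → 5 ^ k ℕ.* e ∸ 3) (shifted n)))
    (b̅₅-divisible k m (b̅₅-vanishes m (5 ℕ.* n ℕ.+ 5) (halved n) (inj₁ (nonresidue (m ℕ.+ 3) 22 (shifted n)))))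
    where
    m : ℕ
    m = 20 ℕ.* n ℕ.+ 19
    shifted : ∀ n → 20 ℕ.* n ℕ.+ 19 ℕ.+ 3 ≡ 20 ℕ.* n ℕ.+ 22
    shifted = solveℕ-∀
    halved : ∀ n → 20 ℕ.* n ℕ.+ 19 ℕ.+ 3 ≡ suc ((5 ℕ.* n ℕ.+ 5) ℕ.* 2) ℕ.* 2
    halved = solveℕ-∀
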